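{- Let $\alpha=(\alpha_i)_{i\ge1}$, $\beta=(\beta_i)_{i\ge1}$ be sequences of non-negative reals with convergent sums, let $\gamma\ge0$ be real, and let $x=(x_1,x_2,\dots)$ be variables. Then $$\sum_\lambda S_\lambda(\alpha,\beta,\gamma)\,s_\lambda(x)=\sum_\lambda\frac1{z_\lambda}\,\tilde p_\lambda(\alpha,\beta,\gamma)\,p_\lambda(x),$$ where both sums are over all partitions $\lambda$ (of all non-negative integers).
   Context: **Extended Schur functions.** The extended complete symmetric functions $\tilde h_k(\alpha,\beta,\gamma)$ are defined by $$\sum_{k\ge0}\tilde h_k(\alpha,\beta,\gamma)z^k=e^{\gamma z}\prod_{i\ge1}\frac{1+\beta_iz}{1-\alpha_iz},$$ with $\tilde h_k=0$ for $k<0$. For a partition $\lambda=(\lambda_1,\dots,\lambda_m)$, $S_\lambda(\alpha,\beta,\gamma)=\det(\tilde h_{\lambda_i-i+j})_{i,j=1}^m$. **Extended power sums.** $\tilde p_1(\alpha,\beta,\gamma)=\gamma+\sum_i\alpha_i+\sum_i\beta_i$; for $m\ge2$, $\tilde p_m(\alpha,\beta,\gamma)=\sum_i\alpha_i^m+(-1)^{m+1}\sum_i\beta_i^m$; and $\tilde p_\lambda=\prod_i\tilde p_{\lambda_i}$, the product over the parts of $\lambda$. $s_\lambda(x)$ and $p_\lambda(x)$ are the usual Schur and power sum symmetric functions, and $z_\lambda=\prod_{i\ge1}i^{m_i}m_i!$, where $m_i$ is the number of parts of $\lambda$ of size $i$. The identity is one of formal power series in the variables $x_r$. -}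

module Defs where

open import Algebra.Bundles using (CommutativeRing; Semiring)
import Algebra.Definitions.RawSemiring
open import Algebra.Structures using (IsCommutativeRing)
import Algebra.Properties.Semiring.Sum
open import Data.Fin.Base using (Fin; zero; suc; toℕ; punchIn)
open import Data.Integer.Base as ℤ using (ℤ; +_; -[1+_])
open import Data.List.Base
  using (List; []; _∷_; map; foldr; filter; length; concat; upTo; lookup; cartesianProductWith)
open import Data.List.Membership.Propositional using (_∉_)
open import Data.List.Relation.Binary.Prefix.Heterogeneous using (Prefix)
open import Data.List.Relation.Binary.Prefix.Heterogeneous.Properties using (prefix?)
open import Data.List.Relation.Unary.All as All using (All; all?)
open import Data.List.Relation.Unary.All.Properties as All using ()
open import Data.List.Relation.Unary.Linked using (Linked; linked?)
open import Data.List.Relation.Unary.Unique.Propositional using (Unique)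
open import Data.List.Properties using (≡-dec)
open import Data.Nat.Base as ℕ using (ℕ; zero; suc; _∸_; _!)
open import Data.Nat.Coprimality using (1-coprimeTo)
open import Data.Nat.ListAction using () renaming (sum to sumℕ; product to productℕ)
open import Data.Nat.ListAction.Properties using (product≢0)
import Data.Nat.Properties as ℕ
open import Data.Product.Base using (∃; _×_; _,_; proj₁; proj₂)
open import Data.Rational.Base as ℚ using (ℚ; 0ℚ; 1ℚ; ½)
import Data.Rational.Properties as ℚ
open import Data.Rational.Solver using (module +-*-Solver)
open import Data.Sum.Base using (inj₁; inj₂)
open import Level using (0ℓ)
open import Relation.Binary.PropositionalEquality as ≡ using (_≡_; refl)
open import Relation.Nullary.Decidable using (Dec; yes; no; _×-dec_)
open import Relation.Unary using (Decidable)

Eventually : (ℕ → Set) → Set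
Eventually P = ∃ λ N → ∀ n → N ℕ.≤ n → P n

module RationalLemmas where

  both : ∀ {P Q} → Eventually P → Eventually Q → Eventually (λ n → P n × Q n)
  both (M , p) (N , q) =
    M ℕ.⊔ N , λ n le → p n (ℕ.≤-trans (ℕ.m≤m⊔n M N) le) , q n (ℕ.≤-trans (ℕ.m≤n⊔m M N) le)

  always : ∀ {P : ℕ → Set} → (∀ n → P n) → Eventually P
  always p = 0 , λ n _ → p n

  eventually : ∀ {P Q : ℕ → Set} → (∀ n → P n → Q n) → Eventually P → Eventually Q
  eventually f (N , p) = N , λ n le → f n (p n le)

  dist : ℚ → ℚ → ℚ
  dist p q = ℚ.∣ p ℚ.- q ∣

  p≤p+q : ∀ p q → 0ℚ ℚ.≤ q → p ℚ.≤ p ℚ.+ q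
  p≤p+q p q 0≤q = ≡.subst (ℚ._≤ p ℚ.+ q) (ℚ.+-identityʳ p) (ℚ.+-monoʳ-≤ p 0≤q)

  q≤p+q : ∀ p q → 0ℚ ℚ.≤ p → q ℚ.≤ p ℚ.+ q
  q≤p+q p q 0≤p = ≡.subst (q ℚ.≤_) (ℚ.+-comm q p) (p≤p+q q p 0≤p)

  half : ℚ → ℚ
  half ε = ½ ℚ.* ε

  half>0 : ∀ {ε} → 0ℚ ℚ.< ε → 0ℚ ℚ.< half ε
  half>0 {ε} ε>0 = ≡.subst (ℚ._< half ε) (ℚ.*-zeroʳ ½) (ℚ.*-monoʳ-<-pos ½ ε>0)

  half+half : ∀ ε → half ε ℚ.+ half ε ≡ ε
  half+half ε = ≡.trans (≡.sym (ℚ.*-distribʳ-+ ε ½ ½)) (ℚ.*-identityˡ ε)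

  half≤ : ∀ {ε} → 0ℚ ℚ.< ε → half ε ℚ.≤ ε
  half≤ {ε} ε>0 = ≡.subst (half ε ℚ.≤_) (half+half ε) (p≤p+q (half ε) (half ε) (ℚ.<⇒≤ (half>0 ε>0)))

  halves≤ : ∀ {ε p q} → p ℚ.≤ half ε → q ℚ.≤ half ε → p ℚ.+ q ℚ.≤ ε
  halves≤ {ε} p≤ q≤ = ≡.subst (_ ℚ.≤_) (half+half ε) (ℚ.+-mono-≤ p≤ q≤)

  dist-refl : ∀ p → dist p p ≡ 0ℚ
  dist-refl p = ≡.cong ℚ.∣_∣ (ℚ.+-inverseʳ p)

  dist-sym : ∀ p q → dist p q ≡ dist q p
  dist-sym p q = ≡.trans (≡.sym (ℚ.∣-p∣≡∣p∣ (p ℚ.- q))) (≡.cong ℚ.∣_∣ (lemma p q))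
    where
    open +-*-Solver
    lemma : ∀ p q → ℚ.- (p ℚ.- q) ≡ q ℚ.- p
    lemma = solve 2 (λ p q → :- (p :- q) := q :- p) refl

  dist-tri : ∀ p q r → dist p r ℚ.≤ dist p q ℚ.+ dist q r
  dist-tri p q r = ≡.subst (λ t → ℚ.∣ t ∣ ℚ.≤ dist p q ℚ.+ dist q r) (lemma p q r)
                     (ℚ.∣p+q∣≤∣p∣+∣q∣ (p ℚ.- q) (q ℚ.- r))
    where
    open +-*-Solver
    lemma : ∀ p q r → (p ℚ.- q) ℚ.+ (q ℚ.- r) ≡ p ℚ.- r
    lemma = solve 3 (λ p q r → (p :- q) :+ (q :- r) := p :- r) refl

  dist-+ : ∀ p q p′ q′ → dist (p ℚ.+ q) (p′ ℚ.+ q′) ℚ.≤ dist p p′ ℚ.+ dist q q′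
  dist-+ p q p′ q′ = ≡.subst (λ t → ℚ.∣ t ∣ ℚ.≤ dist p p′ ℚ.+ dist q q′) (lemma p q p′ q′)
                       (ℚ.∣p+q∣≤∣p∣+∣q∣ (p ℚ.- p′) (q ℚ.- q′))
    where
    open +-*-Solver
    lemma : ∀ p q p′ q′ → (p ℚ.- p′) ℚ.+ (q ℚ.- q′) ≡ (p ℚ.+ q) ℚ.- (p′ ℚ.+ q′)
    lemma = solve 4 (λ p q p′ q′ → (p :- p′) :+ (q :- q′) := (p :+ q) :- (p′ :+ q′)) refl

  dist-neg : ∀ p q → dist (ℚ.- p) (ℚ.- q) ≡ dist p q
  dist-neg p q = ≡.trans (≡.cong ℚ.∣_∣ (lemma p q)) (ℚ.∣-p∣≡∣p∣ (p ℚ.- q))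
    where
    open +-*-Solver
    lemma : ∀ p q → (ℚ.- p) ℚ.- (ℚ.- q) ≡ ℚ.- (p ℚ.- q)
    lemma = solve 2 (λ p q → (:- p) :- (:- q) := :- (p :- q)) refl

  p≤∣p∣ : ∀ p → p ℚ.≤ ℚ.∣ p ∣
  p≤∣p∣ p with ℚ.≤-total 0ℚ p
  ... | inj₁ 0≤p = ℚ.≤-reflexive (≡.sym (ℚ.0≤p⇒∣p∣≡p 0≤p))
  ... | inj₂ p≤0 = ℚ.≤-trans p≤0 (ℚ.0≤∣p∣ p)

  p≤q+dist : ∀ p q → p ℚ.≤ q ℚ.+ dist p q
  p≤q+dist p q = ≡.subst (ℚ._≤ q ℚ.+ dist p q) (lemma p q) (ℚ.+-monoʳ-≤ q (p≤∣p∣ (p ℚ.- q)))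
    where
    open +-*-Solver
    lemma : ∀ p q → q ℚ.+ (p ℚ.- q) ≡ p
    lemma = solve 2 (λ p q → q :+ (p :- q) := p) refl

  dist-intro : ∀ {p q ε} → p ℚ.≤ q ℚ.+ ε → q ℚ.≤ p ℚ.+ ε → dist p q ℚ.≤ ε
  dist-intro {p} {q} {ε} p≤ q≤ with ℚ.∣p∣≡p∨∣p∣≡-p (p ℚ.- q)
  ... | inj₁ eq = ≡.subst (ℚ._≤ ε) (≡.sym eq)
                    (≡.subst (p ℚ.- q ℚ.≤_) (lemma q ε) (ℚ.+-monoˡ-≤ (ℚ.- q) p≤))
    where
    open +-*-Solver
    lemma : ∀ q ε → (q ℚ.+ ε) ℚ.- q ≡ ε
    lemma = solve 2 (λ q ε → (q :+ ε) :- q := ε) refl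
  ... | inj₂ eq = ≡.subst (ℚ._≤ ε) (≡.sym eq)
                    (≡.subst₂ ℚ._≤_ (lemma₁ p q) (lemma₂ p ε) (ℚ.+-monoˡ-≤ (ℚ.- p) q≤))
    where
    open +-*-Solver
    lemma₁ : ∀ p q → q ℚ.- p ≡ ℚ.- (p ℚ.- q)
    lemma₁ = solve 2 (λ p q → q :- p := :- (p :- q)) refl
    lemma₂ : ∀ q ε → (q ℚ.+ ε) ℚ.- q ≡ ε
    lemma₂ = solve 2 (λ q ε → (q :+ ε) :- q := ε) refl

  ∣∣-lipschitz : ∀ p q → dist ℚ.∣ p ∣ ℚ.∣ q ∣ ℚ.≤ dist p q
  ∣∣-lipschitz p q = dist-intro (side p q) (≡.subst (λ d → ℚ.∣ q ∣ ℚ.≤ ℚ.∣ p ∣ ℚ.+ d) (dist-sym q p) (side q p))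
    where
    open +-*-Solver
    lemma : ∀ p q → q ℚ.+ (p ℚ.- q) ≡ p
    lemma = solve 2 (λ p q → q :+ (p :- q) := p) refl
    side : ∀ p q → ℚ.∣ p ∣ ℚ.≤ ℚ.∣ q ∣ ℚ.+ dist p q
    side p q = ≡.subst (λ t → ℚ.∣ t ∣ ℚ.≤ ℚ.∣ q ∣ ℚ.+ dist p q) (lemma p q) (ℚ.∣p+q∣≤∣p∣+∣q∣ q (p ℚ.- q))

  *-mono-≤-nonNeg : ∀ {p q r s} → 0ℚ ℚ.≤ q → 0ℚ ℚ.≤ r → p ℚ.≤ q → r ℚ.≤ s → p ℚ.* r ℚ.≤ q ℚ.* s
  *-mono-≤-nonNeg {p} {q} {r} {s} 0≤q 0≤r p≤q r≤s =
    ℚ.≤-trans (ℚ.*-monoʳ-≤-nonNeg r {{ℚ.nonNegative 0≤r}} p≤q)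
              (ℚ.*-monoˡ-≤-nonNeg q {{ℚ.nonNegative 0≤q}} r≤s)

  dist-* : ∀ {K δ p q p′ q′} → 0ℚ ℚ.≤ K → ℚ.∣ p ∣ ℚ.≤ K → ℚ.∣ q′ ∣ ℚ.≤ K →
           dist p p′ ℚ.≤ δ → dist q q′ ℚ.≤ δ → dist (p ℚ.* q) (p′ ℚ.* q′) ℚ.≤ K ℚ.* δ ℚ.+ K ℚ.* δ
  dist-* {K} {δ} {p} {q} {p′} {q′} 0≤K p≤K q≤K dp dq = begin
    dist (p ℚ.* q) (p′ ℚ.* q′)
      ≡⟨ ≡.cong ℚ.∣_∣ (lemma p q p′ q′) ⟩
    ℚ.∣ p ℚ.* (q ℚ.- q′) ℚ.+ q′ ℚ.* (p ℚ.- p′) ∣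
      ≤⟨ ℚ.∣p+q∣≤∣p∣+∣q∣ (p ℚ.* (q ℚ.- q′)) (q′ ℚ.* (p ℚ.- p′)) ⟩
    ℚ.∣ p ℚ.* (q ℚ.- q′) ∣ ℚ.+ ℚ.∣ q′ ℚ.* (p ℚ.- p′) ∣
      ≡⟨ ≡.cong₂ ℚ._+_ (ℚ.∣p*q∣≡∣p∣*∣q∣ p (q ℚ.- q′)) (ℚ.∣p*q∣≡∣p∣*∣q∣ q′ (p ℚ.- p′)) ⟩
    ℚ.∣ p ∣ ℚ.* dist q q′ ℚ.+ ℚ.∣ q′ ∣ ℚ.* dist p p′
      ≤⟨ ℚ.+-mono-≤ (*-mono-≤-nonNeg 0≤K (ℚ.0≤∣p∣ (q ℚ.- q′)) p≤K dq)
                    (*-mono-≤-nonNeg 0≤K (ℚ.0≤∣p∣ (p ℚ.- p′)) q≤K dp) ⟩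
    K ℚ.* δ ℚ.+ K ℚ.* δ ∎
    where
    open ℚ.≤-Reasoning
    open +-*-Solver
    lemma : ∀ p q p′ q′ → p ℚ.* q ℚ.- p′ ℚ.* q′ ≡ p ℚ.* (q ℚ.- q′) ℚ.+ q′ ℚ.* (p ℚ.- p′)
    lemma = solve 4 (λ p q p′ q′ → p :* q :- p′ :* q′ := p :* (q :- q′) :+ q′ :* (p :- p′)) refl

  dist-*′ : ∀ {K δ ε p q p′ q′} → K ℚ.* δ ≡ half ε → 0ℚ ℚ.≤ K → ℚ.∣ p ∣ ℚ.≤ K → ℚ.∣ q′ ∣ ℚ.≤ K →
            dist p p′ ℚ.≤ δ → dist q q′ ℚ.≤ δ → dist (p ℚ.* q) (p′ ℚ.* q′) ℚ.≤ ε
  dist-*′ {K} {δ} {ε} {p} {q} {p′} {q′} Kδ 0≤K bp bq dp dq =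
    ≡.subst (dist (p ℚ.* q) (p′ ℚ.* q′) ℚ.≤_)
      (≡.trans (≡.cong₂ ℚ._+_ Kδ Kδ) (half+half ε))
      (dist-* {K} {δ} {p} {q} {p′} {q′} 0≤K bp bq dp dq)

  divide : ∀ {K ε} → 0ℚ ℚ.< K → 0ℚ ℚ.< ε → ∃ λ δ → 0ℚ ℚ.< δ × K ℚ.* δ ≡ ε
  divide {K} {ε} K>0 ε>0 =
    1/K ℚ.* ε ,
    ≡.subst (ℚ._< 1/K ℚ.* ε) (ℚ.*-zeroʳ 1/K)
      (ℚ.*-monoʳ-<-pos 1/K {{ℚ.1/pos⇒pos K {{ℚ.positive K>0}}}} ε>0) ,
    ≡.trans (≡.sym (ℚ.*-assoc K 1/K ε))
      (≡.trans (≡.cong (ℚ._* ε) (ℚ.*-inverseʳ K {{nz}})) (ℚ.*-identityˡ ε))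
    where
    nz : ℚ.NonZero K
    nz = ℚ.pos⇒nonZero K {{ℚ.positive K>0}}
    1/K : ℚ
    1/K = (ℚ.1/ K) {{nz}}

open RationalLemmas

IsCauchy : (ℕ → ℚ) → Set
IsCauchy s = ∀ ε → 0ℚ ℚ.< ε → ∃ λ N → ∀ m n → N ℕ.≤ m → N ℕ.≤ n → ℚ.∣ s m ℚ.- s n ∣ ℚ.≤ ε

record ℝ : Set where
  constructor mkℝ
  field
    seq    : ℕ → ℚ
    cauchy : IsCauchy seq

open ℝ public

infix 4 _≈_ _≤_

record _≈_ (x y : ℝ) : Set where
  constructor mk≈
  field
    close : ∀ ε → 0ℚ ℚ.< ε → Eventually (λ n → ℚ.∣ seq x n ℚ.- seq y n ∣ ℚ.≤ ε)

record _≤_ (x y : ℝ) : Set where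
  constructor mk≤
  field
    below : ∀ ε → 0ℚ ℚ.< ε → Eventually (λ n → seq x n ℚ.≤ seq y n ℚ.+ ε)

open _≈_ public
open _≤_ public

private

  bounded : ∀ {s} → IsCauchy s → ∃ λ K → 0ℚ ℚ.< K × Eventually (λ n → ℚ.∣ s n ∣ ℚ.≤ K)
  bounded {s} c with c 1ℚ (ℚ.positive⁻¹ 1ℚ)
  ... | N , cN = ℚ.∣ s N ∣ ℚ.+ 1ℚ ,
    ℚ.+-mono-≤-< (ℚ.0≤∣p∣ (s N)) (ℚ.positive⁻¹ 1ℚ) ,
    N , λ n le → ℚ.≤-trans (p≤q+dist ℚ.∣ s n ∣ ℚ.∣ s N ∣)
                   (ℚ.+-monoʳ-≤ ℚ.∣ s N ∣ (ℚ.≤-trans (∣∣-lipschitz (s n) (s N)) (cN n N le ℕ.≤-refl)))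

  pair-bounded : ∀ x y → ∃ λ K → 0ℚ ℚ.< K × Eventually (λ n → ℚ.∣ seq x n ∣ ℚ.≤ K × ℚ.∣ seq y n ∣ ℚ.≤ K)
  pair-bounded x y = let K , K>0 , bx = bounded {seq x} (cauchy x)
                         L , L>0 , by = bounded {seq y} (cauchy y) in
    K ℚ.+ L , ℚ.+-mono-< K>0 L>0 ,
    eventually (λ n (p , q) → ℚ.≤-trans p (p≤p+q K L (ℚ.<⇒≤ L>0))
                            , ℚ.≤-trans q (q≤p+q K L (ℚ.<⇒≤ K>0)))
               (both bx by)

abstract
  private

    const-cauchy : ∀ q → IsCauchy (λ _ → q)
    const-cauchy q ε ε>0 = 0 , λ _ _ _ _ → ≡.subst (ℚ._≤ ε) (≡.sym (dist-refl q)) (ℚ.<⇒≤ ε>0)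

    +-cauchy : ∀ x y → IsCauchy (λ n → seq x n ℚ.+ seq y n)
    +-cauchy x y ε ε>0 =
      let M , cx = cauchy x (half ε) (half>0 ε>0)
          N , cy = cauchy y (half ε) (half>0 ε>0)
      in M ℕ.⊔ N , λ m n lm ln →
      ℚ.≤-trans (dist-+ (seq x m) (seq y m) (seq x n) (seq y n))
        (halves≤ {ε} {dist (seq x m) (seq x n)} {dist (seq y m) (seq y n)}
                 (cx m n (ℕ.≤-trans (ℕ.m≤m⊔n M N) lm) (ℕ.≤-trans (ℕ.m≤m⊔n M N) ln))
                 (cy m n (ℕ.≤-trans (ℕ.m≤n⊔m M N) lm) (ℕ.≤-trans (ℕ.m≤n⊔m M N) ln)))

    neg-cauchy : ∀ x → IsCauchy (λ n → ℚ.- seq x n)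
    neg-cauchy x ε ε>0 =
      let N , c = cauchy x ε ε>0
      in N , λ m n lm ln → ≡.subst (ℚ._≤ ε) (≡.sym (dist-neg (seq x m) (seq x n))) (c m n lm ln)

    abs-cauchy : ∀ x → IsCauchy (λ n → ℚ.∣ seq x n ∣)
    abs-cauchy x ε ε>0 =
      let N , c = cauchy x ε ε>0
      in N , λ m n lm ln → ℚ.≤-trans (∣∣-lipschitz (seq x m) (seq x n)) (c m n lm ln)

    *-cauchy : ∀ x y → IsCauchy (λ n → seq x n ℚ.* seq y n)
    *-cauchy x y ε ε>0 =
      let K , K>0 , B , bd = pair-bounded x y
          δ , δ>0 , Kδ     = divide K>0 (half>0 ε>0)
          M , cx = cauchy x δ δ>0
          N , cy = cauchy y δ δ>0
          l₁ : B ℕ.≤ B ℕ.⊔ (M ℕ.⊔ N)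
          l₁ = ℕ.m≤m⊔n B (M ℕ.⊔ N)
          l₂ : M ℕ.≤ B ℕ.⊔ (M ℕ.⊔ N)
          l₂ = ℕ.≤-trans (ℕ.m≤m⊔n M N) (ℕ.m≤n⊔m B (M ℕ.⊔ N))
          l₃ : N ℕ.≤ B ℕ.⊔ (M ℕ.⊔ N)
          l₃ = ℕ.≤-trans (ℕ.m≤n⊔m M N) (ℕ.m≤n⊔m B (M ℕ.⊔ N))
      in B ℕ.⊔ (M ℕ.⊔ N) , λ m n lm ln →
        dist-*′ {K} {δ} {ε} {seq x m} {seq y m} {seq x n} {seq y n} Kδ
          (ℚ.<⇒≤ K>0) (proj₁ (bd m (ℕ.≤-trans l₁ lm))) (proj₂ (bd n (ℕ.≤-trans l₁ ln)))
          (cx m n (ℕ.≤-trans l₂ lm) (ℕ.≤-trans l₂ ln)) (cy m n (ℕ.≤-trans l₃ lm) (ℕ.≤-trans l₃ ln))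

infix  8 -_
infixl 7 _*_
infixl 6 _+_ _-_

-- Opaque because rational arithmetic unfolds even on neutral arguments.
opaque

  fromℚ : ℚ → ℝ
  fromℚ q = mkℝ (λ _ → q) (const-cauchy q)

  _+_ : ℝ → ℝ → ℝ
  x + y = mkℝ (λ n → seq x n ℚ.+ seq y n) (+-cauchy x y)

  _*_ : ℝ → ℝ → ℝ
  x * y = mkℝ (λ n → seq x n ℚ.* seq y n) (*-cauchy x y)

  -_ : ℝ → ℝ
  -_ x = mkℝ (λ n → ℚ.- seq x n) (neg-cauchy x)

  ∣_∣ : ℝ → ℝ
  ∣ x ∣ = mkℝ (λ n → ℚ.∣ seq x n ∣) (abs-cauchy x)

_-_ : ℝ → ℝ → ℝ
x - y = x + (- y)

fromℕ : ℕ → ℝ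
fromℕ n = fromℚ (+ n ℚ./ 1)

0ℝ 1ℝ : ℝ
0ℝ = fromℚ 0ℚ
1ℝ = fromℚ 1ℚ

module EqualityLemmas where

  pointwise : ∀ {x y} → (∀ n → seq x n ≡ seq y n) → x ≈ y
  pointwise {x} {y} eq = mk≈ λ ε ε>0 → always λ n →
    ≡.subst (ℚ._≤ ε) (≡.trans (≡.sym (dist-refl (seq x n))) (≡.cong (dist (seq x n)) (eq n))) (ℚ.<⇒≤ ε>0)

  ≈-refl : ∀ {x} → x ≈ x
  ≈-refl = pointwise λ _ → refl

  ≈-sym : ∀ {x y} → x ≈ y → y ≈ x
  ≈-sym {x} {y} e = mk≈ λ ε ε>0 →
    eventually (λ n → ≡.subst (ℚ._≤ ε) (dist-sym (seq x n) (seq y n))) (close e ε ε>0)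

  ≈-trans : ∀ {x y z} → x ≈ y → y ≈ z → x ≈ z
  ≈-trans {x} {y} {z} e f = mk≈ λ ε ε>0 →
    eventually (λ n (p , q) → ℚ.≤-trans (dist-tri (seq x n) (seq y n) (seq z n)) (halves≤ p q))
      (both (close e (half ε) (half>0 ε>0)) (close f (half ε) (half>0 ε>0)))

  opaque
    unfolding fromℚ _+_ _*_ -_ ∣_∣

    +-cong : ∀ {x x′ y y′} → x ≈ x′ → y ≈ y′ → x + y ≈ x′ + y′
    +-cong {x} {x′} {y} {y′} e f = mk≈ λ ε ε>0 →
      eventually (λ n (p , q) → ℚ.≤-trans (dist-+ (seq x n) (seq y n) (seq x′ n) (seq y′ n)) (halves≤ p q))
        (both (close e (half ε) (half>0 ε>0)) (close f (half ε) (half>0 ε>0)))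

    neg-cong : ∀ {x x′} → x ≈ x′ → - x ≈ - x′
    neg-cong {x} {x′} e = mk≈ λ ε ε>0 →
      eventually (λ n → ≡.subst (ℚ._≤ ε) (≡.sym (dist-neg (seq x n) (seq x′ n)))) (close e ε ε>0)

    abs-cong : ∀ {x x′} → x ≈ x′ → ∣ x ∣ ≈ ∣ x′ ∣
    abs-cong {x} {x′} e = mk≈ λ ε ε>0 →
      eventually (λ n → ℚ.≤-trans (∣∣-lipschitz (seq x n) (seq x′ n))) (close e ε ε>0)

    *-cong : ∀ {x x′ y y′} → x ≈ x′ → y ≈ y′ → x * y ≈ x′ * y′
    *-cong {x} {x′} {y} {y′} e f = mk≈ go
      where
      go : ∀ ε → 0ℚ ℚ.< ε → Eventually (λ n → dist (seq (x * y) n) (seq (x′ * y′) n) ℚ.≤ ε)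
      go ε ε>0 =
        let K , K>0 , bd = pair-bounded x y′
            δ , δ>0 , Kδ = divide K>0 (half>0 ε>0)
        in eventually (λ n ((bx , by) , (p , q)) →
             dist-*′ {K} {δ} {ε} {seq x n} {seq y n} {seq x′ n} {seq y′ n} Kδ (ℚ.<⇒≤ K>0) bx by p q)
           (both bd (both (close e δ δ>0) (close f δ δ>0)))

    +-assoc : ∀ x y z → (x + y) + z ≈ x + (y + z)
    +-assoc x y z = pointwise λ n → ℚ.+-assoc (seq x n) (seq y n) (seq z n)

    +-comm : ∀ x y → x + y ≈ y + x
    +-comm x y = pointwise λ n → ℚ.+-comm (seq x n) (seq y n)

    +-identityˡ : ∀ x → 0ℝ + x ≈ x
    +-identityˡ x = pointwise λ n → ℚ.+-identityˡ (seq x n)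

    +-inverseˡ : ∀ x → - x + x ≈ 0ℝ
    +-inverseˡ x = pointwise λ n → ℚ.+-inverseˡ (seq x n)

    *-assoc : ∀ x y z → (x * y) * z ≈ x * (y * z)
    *-assoc x y z = pointwise λ n → ℚ.*-assoc (seq x n) (seq y n) (seq z n)

    *-comm : ∀ x y → x * y ≈ y * x
    *-comm x y = pointwise λ n → ℚ.*-comm (seq x n) (seq y n)

    *-identityˡ : ∀ x → 1ℝ * x ≈ x
    *-identityˡ x = pointwise λ n → ℚ.*-identityˡ (seq x n)

    *-distribˡ-+ : ∀ x y z → x * (y + z) ≈ x * y + x * z
    *-distribˡ-+ x y z = pointwise λ n → ℚ.*-distribˡ-+ (seq x n) (seq y n) (seq z n)

  *-distribʳ-+ : ∀ x y z → (y + z) * x ≈ y * x + z * x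
  *-distribʳ-+ x y z = ≈-trans (*-comm (y + z) x)
    (≈-trans (*-distribˡ-+ x y z) (+-cong (*-comm x y) (*-comm x z)))

  ℝ-isCommutativeRing : IsCommutativeRing _≈_ _+_ _*_ -_ 0ℝ 1ℝ
  ℝ-isCommutativeRing = record
    { isRing = record
      { +-isAbelianGroup = record
        { isGroup = record
          { isMonoid = record
            { isSemigroup = record
              { isMagma = record
                { isEquivalence = record { refl = ≈-refl ; sym = ≈-sym ; trans = ≈-trans }
                ; ∙-cong = +-cong
                }
              ; assoc = +-assoc
              }
            ; identity = +-identityˡ , λ x → ≈-trans (+-comm x 0ℝ) (+-identityˡ x)
            }
          ; inverse = +-inverseˡ , λ x → ≈-trans (+-comm x (- x)) (+-inverseˡ x)
          ; ⁻¹-cong = neg-cong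
          }
        ; comm = +-comm
        }
      ; *-cong = *-cong
      ; *-assoc = *-assoc
      ; *-identity = *-identityˡ , λ x → ≈-trans (*-comm x 1ℝ) (*-identityˡ x)
      ; distrib = *-distribˡ-+ , *-distribʳ-+
      }
    ; *-comm = *-comm
    }

open EqualityLemmas

ℝ-commutativeRing : CommutativeRing 0ℓ 0ℓ
ℝ-commutativeRing = record
  { Carrier = ℝ
  ; _≈_ = _≈_
  ; _+_ = _+_
  ; _*_ = _*_
  ; -_ = -_
  ; 0# = 0ℝ
  ; 1# = 1ℝ
  ; isCommutativeRing = ℝ-isCommutativeRing
  }

private
  module R = CommutativeRing ℝ-commutativeRing
  module Sum = Algebra.Properties.Semiring.Sum R.semiring

open Algebra.Definitions.RawSemiring (Semiring.rawSemiring R.semiring) public using (_^_; sum)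

infix 4 _⟶_

_⟶_ : (ℕ → ℝ) → ℝ → Set
s ⟶ L = ∀ ε → 0ℚ ℚ.< ε → Eventually (λ n → ∣ s n - L ∣ ≤ fromℚ ε)

Convergent : (ℕ → ℝ) → Set
Convergent s = ∃ λ L → s ⟶ L

lim : ∀ {s} → Convergent s → ℝ
lim = proj₁

partialSums : (ℕ → ℝ) → ℕ → ℝ
partialSums a zero    = 0ℝ
partialSums a (suc n) = partialSums a n + a n

Summable : (ℕ → ℝ) → Set
Summable a = Convergent (partialSums a)

module ConvergenceLemmas where

  pointwise-≤ : ∀ {x y} → (∀ n → seq x n ℚ.≤ seq y n) → x ≤ y
  pointwise-≤ {x} {y} le = mk≤ λ ε ε>0 → always λ n →
    ℚ.≤-trans (le n) (p≤p+q (seq y n) ε (ℚ.<⇒≤ ε>0))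

  ≈⇒≤ : ∀ {x y} → x ≈ y → x ≤ y
  ≈⇒≤ {x} {y} e = mk≤ λ ε ε>0 → eventually
    (λ n p → ℚ.≤-trans (p≤q+dist (seq x n) (seq y n)) (ℚ.+-monoʳ-≤ (seq y n) p)) (close e ε ε>0)

  ≤-refl : ∀ {x} → x ≤ x
  ≤-refl = ≈⇒≤ ≈-refl

  ≤-trans : ∀ {x y z} → x ≤ y → y ≤ z → x ≤ z
  ≤-trans {x} {y} {z} p q = mk≤ λ ε ε>0 → eventually
    (λ n (p , q) → ℚ.≤-trans p (≡.subst (seq y n ℚ.+ half ε ℚ.≤_)
        (≡.trans (ℚ.+-assoc (seq z n) (half ε) (half ε)) (≡.cong (seq z n ℚ.+_) (half+half ε)))
        (ℚ.+-monoˡ-≤ (half ε) q)))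
    (both (below p (half ε) (half>0 ε>0)) (below q (half ε) (half>0 ε>0)))

  opaque
    unfolding fromℚ _+_ _*_ -_ ∣_∣

    +-mono : ∀ {x x′ y y′} → x ≤ x′ → y ≤ y′ → x + y ≤ x′ + y′
    +-mono {x} {x′} {y} {y′} p q = mk≤ λ ε ε>0 → eventually
      (λ n (p , q) → ≡.subst (seq x n ℚ.+ seq y n ℚ.≤_)
          (≡.trans (lemma (seq x′ n) (seq y′ n) (half ε)) (≡.cong (seq x′ n ℚ.+ seq y′ n ℚ.+_) (half+half ε)))
          (ℚ.+-mono-≤ p q))
      (both (below p (half ε) (half>0 ε>0)) (below q (half ε) (half>0 ε>0)))
      where
      open +-*-Solver
      lemma : ∀ x y h → (x ℚ.+ h) ℚ.+ (y ℚ.+ h) ≡ (x ℚ.+ y) ℚ.+ (h ℚ.+ h)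
      lemma = solve 3 (λ x y h → (x :+ h) :+ (y :+ h) := (x :+ y) :+ (h :+ h)) refl

    0≤∣_∣ : ∀ x → 0ℝ ≤ ∣ x ∣
    0≤∣ x ∣ = pointwise-≤ λ n → ℚ.0≤∣p∣ (seq x n)

    triangle : ∀ x y → ∣ x + y ∣ ≤ ∣ x ∣ + ∣ y ∣
    triangle x y = pointwise-≤ λ n → ℚ.∣p+q∣≤∣p∣+∣q∣ (seq x n) (seq y n)

    triangle-- : ∀ x y z → ∣ x - z ∣ ≤ ∣ x - y ∣ + ∣ y - z ∣
    triangle-- x y z = pointwise-≤ λ n → dist-tri (seq x n) (seq y n) (seq z n)

    ∣-∣-+ : ∀ x y x′ y′ → ∣ (x + y) - (x′ + y′) ∣ ≤ ∣ x - x′ ∣ + ∣ y - y′ ∣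
    ∣-∣-+ x y x′ y′ = pointwise-≤ λ n → dist-+ (seq x n) (seq y n) (seq x′ n) (seq y′ n)

    ∣-∣-sym : ∀ x y → ∣ x - y ∣ ≈ ∣ y - x ∣
    ∣-∣-sym x y = pointwise λ n → dist-sym (seq x n) (seq y n)

    ∣∣-neg : ∀ x → ∣ - x ∣ ≈ ∣ x ∣
    ∣∣-neg x = pointwise λ n → ℚ.∣-p∣≡∣p∣ (seq x n)

    ∣∣-* : ∀ x y → ∣ x * y ∣ ≈ ∣ x ∣ * ∣ y ∣
    ∣∣-* x y = pointwise λ n → ℚ.∣p*q∣≡∣p∣*∣q∣ (seq x n) (seq y n)

    x≤∣x∣ : ∀ x → x ≤ ∣ x ∣
    x≤∣x∣ x = pointwise-≤ λ n → p≤∣p∣ (seq x n)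

    nonneg-abs : ∀ {x} → 0ℝ ≤ x → ∣ x ∣ ≈ x
    nonneg-abs {x} 0≤x = mk≈ λ ε ε>0 → eventually
      (λ n p → dist-intro (bound (seq x n) ε ε>0 p)
        (ℚ.≤-trans (p≤∣p∣ (seq x n)) (p≤p+q ℚ.∣ seq x n ∣ ε (ℚ.<⇒≤ ε>0))))
      (below 0≤x (half ε) (half>0 ε>0))
      where
      open +-*-Solver
      lemma : ∀ x h → (x ℚ.+ h) ℚ.+ ((x ℚ.+ h) ℚ.+ ℚ.- x) ≡ x ℚ.+ (h ℚ.+ h)
      lemma = solve 2 (λ x h → (x :+ h) :+ ((x :+ h) :+ (:- x)) := x :+ (h :+ h)) refl
      bound : ∀ p ε → 0ℚ ℚ.< ε → 0ℚ ℚ.≤ p ℚ.+ half ε → ℚ.∣ p ∣ ℚ.≤ p ℚ.+ ε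
      bound p ε ε>0 le with ℚ.∣p∣≡p∨∣p∣≡-p p
      ... | inj₁ eq = ≡.subst₂ ℚ._≤_ (≡.trans (ℚ.+-identityʳ p) (≡.sym eq)) refl (ℚ.+-monoʳ-≤ p (ℚ.<⇒≤ ε>0))
      ... | inj₂ eq = ≡.subst₂ ℚ._≤_
        (≡.trans (≡.trans (≡.cong₂ ℚ._+_ (refl {x = 0ℚ}) (ℚ.+-identityˡ (ℚ.- p))) (ℚ.+-identityˡ (ℚ.- p))) (≡.sym eq))
        (≡.trans (lemma p (half ε)) (≡.cong (p ℚ.+_) (half+half ε)))
        (ℚ.+-mono-≤ le (ℚ.+-monoˡ-≤ (ℚ.- p) le))

    fromℚ-mono : ∀ {p q} → p ℚ.≤ q → fromℚ p ≤ fromℚ q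
    fromℚ-mono le = pointwise-≤ λ _ → le

    fromℚ-+ : ∀ p q → fromℚ p + fromℚ q ≈ fromℚ (p ℚ.+ q)
    fromℚ-+ p q = pointwise λ _ → refl

    fromℚ-* : ∀ p q → fromℚ p * fromℚ q ≈ fromℚ (p ℚ.* q)
    fromℚ-* p q = pointwise λ _ → refl

    fromℚ-nonneg : ∀ {p} → 0ℚ ℚ.< p → 0ℝ ≤ fromℚ p
    fromℚ-nonneg p>0 = fromℚ-mono (ℚ.<⇒≤ p>0)

    ∣1∣≈1 : ∣ 1ℝ ∣ ≈ 1ℝ
    ∣1∣≈1 = pointwise λ _ → refl

    close⇒ : ∀ {x y ε} → 0ℚ ℚ.< ε → ∣ x - y ∣ ≤ fromℚ (half ε) → Eventually (λ n → dist (seq x n) (seq y n) ℚ.≤ ε)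
    close⇒ {x} {y} {ε} ε>0 le = eventually
      (λ n → ≡.subst (dist (seq x n) (seq y n) ℚ.≤_) (half+half ε)) (below le (half ε) (half>0 ε>0))

    close⇐ : ∀ {x y ε} → Eventually (λ n → dist (seq x n) (seq y n) ℚ.≤ ε) → ∣ x - y ∣ ≤ fromℚ ε
    close⇐ {x} {y} {ε} ev = mk≤ λ η η>0 → eventually
      (λ n le → ℚ.≤-trans le (p≤p+q ε η (ℚ.<⇒≤ η>0))) ev

    ℝ-bounded : ∀ x → ∃ λ K → 0ℚ ℚ.< K × ∣ x ∣ ≤ fromℚ K
    ℝ-bounded x =
      let K , K>0 , ev = bounded {seq x} (cauchy x)
      in K , K>0 , mk≤ λ ε ε>0 → eventually (λ n le → ℚ.≤-trans le (p≤p+q K ε (ℚ.<⇒≤ ε>0))) ev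

    x-y+y : ∀ x y → (x - y) + y ≈ x
    x-y+y x y = pointwise λ n → lemma (seq x n) (seq y n)
      where
      open +-*-Solver
      lemma : ∀ x y → (x ℚ.- y) ℚ.+ y ≡ x
      lemma = solve 2 (λ x y → (x :- y) :+ y := x) refl

    last-term : ∀ A a → (A + a) - A ≈ a
    last-term A a = pointwise λ n → lemma (seq A n) (seq a n)
      where
      open +-*-Solver
      lemma : ∀ A a → (A ℚ.+ a) ℚ.- A ≡ a
      lemma = solve 2 (λ A a → (A :+ a) :- A := a) refl

    last-terms : ∀ K A a B b → K * a + K * b ≈ K * (((A + a) + (B + b)) - (A + B))
    last-terms K A a B b = pointwise λ n → lemma (seq K n) (seq A n) (seq a n) (seq B n) (seq b n)
      where
      open +-*-Solver
      lemma : ∀ K A a B b → K ℚ.* a ℚ.+ K ℚ.* b ≡ K ℚ.* (((A ℚ.+ a) ℚ.+ (B ℚ.+ b)) ℚ.- (A ℚ.+ B))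
      lemma = solve 5 (λ K A a B b → K :* a :+ K :* b := K :* (((A :+ a) :+ (B :+ b)) :- (A :+ B))) refl

    telescope-0 : ∀ t K d → ∣ t - t ∣ ≈ K * (d - d)
    telescope-0 t K d = pointwise λ n → ≡.trans (dist-refl (seq t n))
      (≡.sym (≡.trans (≡.cong (seq K n ℚ.*_) (ℚ.+-inverseʳ (seq d n))) (ℚ.*-zeroʳ (seq K n))))

    telescope-+ : ∀ K x y z → K * (x - y) + K * (y - z) ≈ K * (x - z)
    telescope-+ K x y z = pointwise λ n → lemma (seq K n) (seq x n) (seq y n) (seq z n)
      where
      open +-*-Solver
      lemma : ∀ K x y z → K ℚ.* (x ℚ.- y) ℚ.+ K ℚ.* (y ℚ.- z) ≡ K ℚ.* (x ℚ.- z)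
      lemma = solve 4 (λ K x y z → K :* (x :- y) :+ K :* (y :- z) := K :* (x :- z)) refl

    geometric-step : ∀ a b p → a * (a * p) + b * (a * p) ≈ a * (a * p + b * p) + b * 0ℝ
    geometric-step a b p = pointwise λ n → lemma (seq a n) (seq b n) (seq p n)
      where
      open +-*-Solver
      lemma : ∀ a b p → a ℚ.* (a ℚ.* p) ℚ.+ b ℚ.* (a ℚ.* p) ≡ a ℚ.* (a ℚ.* p ℚ.+ b ℚ.* p) ℚ.+ b ℚ.* 0ℚ
      lemma = solve 3 (λ a b p → a :* (a :* p) :+ b :* (a :* p) := a :* (a :* p :+ b :* p) :+ b :* con 0ℚ) refl

  +-monoˡ : ∀ {x y y′} → y ≤ y′ → x + y ≤ x + y′
  +-monoˡ le = +-mono ≤-refl le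

  *-nonneg : ∀ {x y} → 0ℝ ≤ x → 0ℝ ≤ y → 0ℝ ≤ x * y
  *-nonneg {x} {y} 0≤x 0≤y = ≤-trans (0≤∣ x * y ∣)
    (≈⇒≤ (≈-trans (∣∣-* x y) (*-cong (nonneg-abs 0≤x) (nonneg-abs 0≤y))))

  *-monoˡ : ∀ {x y z} → 0ℝ ≤ x → y ≤ z → x * y ≤ x * z
  *-monoˡ {x} {y} {z} 0≤x y≤z =
    ≤-trans (≈⇒≤ (≈-sym (R.+-identityˡ (x * y))))
      (≤-trans (+-mono (*-nonneg 0≤x 0≤z-y) ≤-refl)
        (≈⇒≤ (≈-trans (≈-sym (R.distribˡ x (z - y) y)) (*-cong ≈-refl (x-y+y z y)))))
    where
    0≤z-y : 0ℝ ≤ z - y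
    0≤z-y = ≤-trans (≈⇒≤ (≈-sym (R.-‿inverseʳ y))) (+-mono y≤z ≤-refl)

  *-monoʳ : ∀ {x y z} → 0ℝ ≤ x → y ≤ z → y * x ≤ z * x
  *-monoʳ {x} {y} {z} 0≤x y≤z =
    ≤-trans (≈⇒≤ (R.*-comm y x)) (≤-trans (*-monoˡ 0≤x y≤z) (≈⇒≤ (R.*-comm x z)))

  fromℚ-halves : ∀ {x y ε} → x ≤ fromℚ (half ε) → y ≤ fromℚ (half ε) → x + y ≤ fromℚ ε
  fromℚ-halves {x} {y} {ε} p q = ≡.subst (λ η → x + y ≤ fromℚ η) (half+half ε)
    (≤-trans (+-mono p q) (≈⇒≤ (fromℚ-+ (half ε) (half ε))))

  1/suc : ℕ → ℚ
  1/suc n = ℚ.mkℚ (+ 1) n (1-coprimeTo (suc n))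

  1/suc>0 : ∀ n → 0ℚ ℚ.< 1/suc n
  1/suc>0 n = ℚ.positive⁻¹ (1/suc n)

  1/suc-small : ∀ ε → 0ℚ ℚ.< ε → Eventually (λ n → 1/suc n ℚ.≤ ε)
  1/suc-small ε ε>0 = go ε {{ℚ.positive ε>0}}
    where
    go : ∀ ε → {{ℚ.Positive ε}} → Eventually (λ n → 1/suc n ℚ.≤ ε)
    go (ℚ.mkℚ (+ suc p) d c) = d , λ n d≤n → ℚ.*≤* (ℤ.+≤+
      (ℕ.≤-trans (ℕ.≤-reflexive (ℕ.*-identityˡ (suc d)))
        (ℕ.≤-trans (ℕ.s≤s d≤n) (ℕ.m≤n*m (suc n) (suc p)))))

  CauchySeq : (ℕ → ℝ) → Set
  CauchySeq s = ∀ ε → 0ℚ ℚ.< ε → ∃ λ N → ∀ m n → N ℕ.≤ m → N ℕ.≤ n → ∣ s m - s n ∣ ≤ fromℚ ε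

  convergent⇒cauchy : ∀ {s} → Convergent s → CauchySeq s
  convergent⇒cauchy {s} (L , c) ε ε>0 =
    let N , cN = c (half ε) (half>0 ε>0)
    in N , λ m n lm ln → ≤-trans (triangle-- (s m) L (s n))
         (fromℚ-halves (cN m lm) (≤-trans (≈⇒≤ (∣-∣-sym L (s n))) (cN n ln)))

  module Complete (s : ℕ → ℝ) (c : CauchySeq s) where

    M : ℕ → ℕ
    M n = proj₁ (cauchy (s n) (1/suc n) (1/suc>0 n))

    q : ℕ → ℚ
    q n = seq (s n) (M n)

    q-close : ∀ n k → M n ℕ.≤ k → dist (seq (s n) k) (q n) ℚ.≤ 1/suc n
    q-close n k le = proj₂ (cauchy (s n) (1/suc n) (1/suc>0 n)) k (M n) le ℕ.≤-refl

    chain : ∀ {ε} a b c d → 0ℚ ℚ.< ε → dist a b ℚ.≤ half (half ε) → dist b c ℚ.≤ half (half ε) →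
            dist c d ℚ.≤ half (half ε) → dist a d ℚ.≤ ε
    chain {ε} a b c d ε>0 ab bc cd = ℚ.≤-trans (dist-tri a b d)
      (halves≤ {ε} {dist a b} {dist b d} (ℚ.≤-trans ab (half≤ (half>0 ε>0)))
        (ℚ.≤-trans (dist-tri b c d) (halves≤ {half ε} {dist b c} {dist c d} bc cd)))

    tail : ∀ ε → 0ℚ ℚ.< ε → ∃ λ N → ∀ m → N ℕ.≤ m →
      1/suc m ℚ.≤ ε × (∀ n → N ℕ.≤ n → Eventually (λ k → dist (seq (s m) k) (seq (s n) k) ℚ.≤ ε))
    tail ε ε>0 =
      let A , a = 1/suc-small ε ε>0
          B , b = c (half ε) (half>0 ε>0)
      in A ℕ.⊔ B , λ m lm → a m (ℕ.≤-trans (ℕ.m≤m⊔n A B) lm) ,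
           λ n ln → close⇒ {s m} {s n} ε>0 (b m n (ℕ.≤-trans (ℕ.m≤n⊔m A B) lm) (ℕ.≤-trans (ℕ.m≤n⊔m A B) ln))

    q-cauchy : IsCauchy q
    q-cauchy ε ε>0 =
      let N , d = tail (half (half ε)) (half>0 (half>0 ε>0))
      in N , λ m n lm ln →
      let K , e = proj₂ (d m lm) n ln
          k = M m ℕ.⊔ (M n ℕ.⊔ K)
          k₁ = ℕ.m≤m⊔n (M m) (M n ℕ.⊔ K)
          k₂ = ℕ.≤-trans (ℕ.m≤m⊔n (M n) K) (ℕ.m≤n⊔m (M m) (M n ℕ.⊔ K))
          k₃ = ℕ.≤-trans (ℕ.m≤n⊔m (M n) K) (ℕ.m≤n⊔m (M m) (M n ℕ.⊔ K))
      in chain (q m) (seq (s m) k) (seq (s n) k) (q n) ε>0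
           (≡.subst (ℚ._≤ half (half ε)) (dist-sym (seq (s m) k) (q m)) (ℚ.≤-trans (q-close m k k₁) (proj₁ (d m lm))))
           (e k k₃)
           (ℚ.≤-trans (q-close n k k₂) (proj₁ (d n ln)))

    L : ℝ
    L = mkℝ q q-cauchy

    s⟶L : s ⟶ L
    s⟶L ε ε>0 =
      let N , d = tail (half (half ε)) (half>0 (half>0 ε>0))
      in N , λ n ln →
      let A , a = cauchy (s n) (half (half ε)) (half>0 (half>0 ε>0))
      in close⇐ {s n} {L} {ε} (A ℕ.⊔ N , λ m lm →
        let m≥A = ℕ.≤-trans (ℕ.m≤m⊔n A N) lm
            m≥N = ℕ.≤-trans (ℕ.m≤n⊔m A N) lm
            K , e = proj₂ (d n ln) m m≥N
            k = A ℕ.⊔ (M m ℕ.⊔ K)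
            k₁ = ℕ.m≤m⊔n A (M m ℕ.⊔ K)
            k₂ = ℕ.≤-trans (ℕ.m≤m⊔n (M m) K) (ℕ.m≤n⊔m A (M m ℕ.⊔ K))
            k₃ = ℕ.≤-trans (ℕ.m≤n⊔m (M m) K) (ℕ.m≤n⊔m A (M m ℕ.⊔ K))
        in chain (seq (s n) m) (seq (s n) k) (seq (s m) k) (q m) ε>0
             (a m k m≥A k₁) (e k k₃) (ℚ.≤-trans (q-close m k k₂) (proj₁ (d m m≥N))))

  cauchy⇒convergent : ∀ {s} → CauchySeq s → Convergent s
  cauchy⇒convergent {s} c = Complete.L s c , Complete.s⟶L s c

  Bounded : (ℕ → ℝ) → Set
  Bounded g = ∃ λ K → 0ℚ ℚ.< K × (∀ n → ∣ g n ∣ ≤ fromℚ K)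

  prefix-bounded : ∀ (g : ℕ → ℝ) N → ∃ λ K → 0ℚ ℚ.< K × (∀ n → n ℕ.≤ N → ∣ g n ∣ ≤ fromℚ K)
  prefix-bounded g zero = let K , K>0 , b = ℝ-bounded (g 0) in K , K>0 , λ { zero _ → b }
  prefix-bounded g (suc N) =
    let K , K>0 , b  = prefix-bounded g N
        J , J>0 , b′ = ℝ-bounded (g (suc N))
    in K ℚ.+ J , ℚ.+-mono-< K>0 J>0 , extend K J K>0 J>0 b b′
    where
    extend : ∀ K J → 0ℚ ℚ.< K → 0ℚ ℚ.< J → (∀ n → n ℕ.≤ N → ∣ g n ∣ ≤ fromℚ K) → ∣ g (suc N) ∣ ≤ fromℚ J →
             ∀ n → n ℕ.≤ suc N → ∣ g n ∣ ≤ fromℚ (K ℚ.+ J)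
    extend K J K>0 J>0 b b′ n le with ℕ.m≤n⇒m<n∨m≡n le
    ... | inj₁ (ℕ.s≤s n≤N) = ≤-trans (b n n≤N) (fromℚ-mono (p≤p+q K J (ℚ.<⇒≤ J>0)))
    ... | inj₂ refl        = ≤-trans b′ (fromℚ-mono (q≤p+q K J (ℚ.<⇒≤ K>0)))

  cauchy⇒bounded : ∀ {s} → CauchySeq s → Bounded s
  cauchy⇒bounded {s} c =
    let N , cN      = c 1ℚ (ℚ.positive⁻¹ 1ℚ)
        K , K>0 , b = prefix-bounded s N
    in 1ℚ ℚ.+ K , ℚ.+-mono-< (ℚ.positive⁻¹ 1ℚ) K>0 , extend N K b λ n le → cN n N le ℕ.≤-refl
    where
    extend : ∀ N K → (∀ n → n ℕ.≤ N → ∣ s n ∣ ≤ fromℚ K) → (∀ n → N ℕ.≤ n → ∣ s n - s N ∣ ≤ 1ℝ) →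
             ∀ n → ∣ s n ∣ ≤ fromℚ (1ℚ ℚ.+ K)
    extend N K b d n with ℕ.≤-total n N
    ... | inj₁ n≤N = ≤-trans (b n n≤N) (fromℚ-mono (q≤p+q 1ℚ K (ℚ.<⇒≤ (ℚ.positive⁻¹ 1ℚ))))
    ... | inj₂ N≤n = ≤-trans (≈⇒≤ (abs-cong (≈-sym (x-y+y (s n) (s N)))))
                    (≤-trans (triangle (s n - s N) (s N))
                    (≤-trans (+-mono (d n N≤n) (b N ℕ.≤-refl)) (≈⇒≤ (fromℚ-+ 1ℚ K))))

  bounded-* : ∀ {f g} → Bounded f → Bounded g → Bounded (λ n → f n * g n)
  bounded-* {f} {g} (K , K>0 , b) (J , J>0 , b′) =
    K ℚ.* J , ≡.subst (ℚ._< K ℚ.* J) (ℚ.*-zeroʳ K) (ℚ.*-monoʳ-<-pos K {{ℚ.positive K>0}} J>0) ,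
    λ n → ≤-trans (≈⇒≤ (∣∣-* (f n) (g n)))
      (≤-trans (*-monoˡ 0≤∣ f n ∣ (b′ n))
      (≤-trans (*-monoʳ (fromℚ-nonneg J>0) (b n)) (≈⇒≤ (fromℚ-* K J))))

  cauchy-+ : ∀ {s t} → CauchySeq s → CauchySeq t → CauchySeq (λ n → s n + t n)
  cauchy-+ {s} {t} c d ε ε>0 =
    let M , cM = c (half ε) (half>0 ε>0)
        N , dN = d (half ε) (half>0 ε>0)
    in M ℕ.⊔ N , λ m n lm ln →
    ≤-trans (∣-∣-+ (s m) (t m) (s n) (t n))
      (fromℚ-halves (cM m n (ℕ.≤-trans (ℕ.m≤m⊔n M N) lm) (ℕ.≤-trans (ℕ.m≤m⊔n M N) ln))
                    (dN m n (ℕ.≤-trans (ℕ.m≤n⊔m M N) lm) (ℕ.≤-trans (ℕ.m≤n⊔m M N) ln)))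

  comparison : ∀ {t D} K → 0ℚ ℚ.< K → CauchySeq D →
               (∀ n → ∣ t (suc n) - t n ∣ ≤ fromℚ K * (D (suc n) - D n)) → CauchySeq t
  comparison {t} {D} K K>0 cD inc ε ε>0 =
    let δ , δ>0 , Kδ = divide K>0 ε>0
        N , cN       = cD δ δ>0
    in N , go δ N cN Kδ
    where
    telescope : ∀ m k → ∣ t (k ℕ.+ m) - t m ∣ ≤ fromℚ K * (D (k ℕ.+ m) - D m)
    telescope m zero = ≈⇒≤ (telescope-0 (t m) (fromℚ K) (D m))
    telescope m (suc k) = ≤-trans (triangle-- (t (suc k ℕ.+ m)) (t (k ℕ.+ m)) (t m))
      (≤-trans (+-mono (inc (k ℕ.+ m)) (telescope m k))
        (≈⇒≤ (telescope-+ (fromℚ K) (D (suc k ℕ.+ m)) (D (k ℕ.+ m)) (D m))))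

    module _ (δ : ℚ) (N : ℕ) (cN : ∀ m n → N ℕ.≤ m → N ℕ.≤ n → ∣ D m - D n ∣ ≤ fromℚ δ) (Kδ : K ℚ.* δ ≡ ε) where

      ordered : ∀ m n → N ℕ.≤ m → m ℕ.≤ n → ∣ t n - t m ∣ ≤ fromℚ ε
      ordered m n N≤m m≤n = ≡.subst (λ η → ∣ t n - t m ∣ ≤ fromℚ η) Kδ
        (≤-trans (≡.subst (λ j → ∣ t j - t m ∣ ≤ fromℚ K * (D j - D m)) (ℕ.m∸n+n≡m m≤n) (telescope m (n ∸ m)))
        (≤-trans (*-monoˡ (fromℚ-nonneg K>0)
                    (≤-trans (x≤∣x∣ (D n - D m)) (cN n m (ℕ.≤-trans N≤m m≤n) N≤m)))
                 (≈⇒≤ (fromℚ-* K δ))))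

      go : ∀ m n → N ℕ.≤ m → N ℕ.≤ n → ∣ t m - t n ∣ ≤ fromℚ ε
      go m n lm ln with ℕ.≤-total m n
      ... | inj₁ m≤n = ≤-trans (≈⇒≤ (∣-∣-sym (t m) (t n))) (ordered m n lm m≤n)
      ... | inj₂ n≤m = ordered n m ln n≤m

  cauchy-cong : ∀ {s t} → (∀ n → s n ≈ t n) → CauchySeq s → CauchySeq t
  cauchy-cong {s} {t} e c ε ε>0 =
    let N , cN = c ε ε>0
    in N , λ m n lm ln →
    ≤-trans (≈⇒≤ (abs-cong (+-cong (≈-sym (e m)) (neg-cong (≈-sym (e n)))))) (cN m n lm ln)

  cauchy-const : ∀ x → CauchySeq (λ _ → x)
  cauchy-const x ε ε>0 = 0 , λ _ _ _ _ → close⇐ {x} {x} {ε} (always λ n →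
    ≡.subst (ℚ._≤ ε) (≡.sym (dist-refl (seq x n))) (ℚ.<⇒≤ ε>0))

  dominated : ∀ {a g K} → 0ℝ ≤ a → ∣ g ∣ ≤ fromℚ K → ∣ a * g ∣ ≤ fromℚ K * a
  dominated {a} {g} {K} 0≤a le = ≤-trans (≈⇒≤ (≈-trans (∣∣-* a g) (*-cong (nonneg-abs 0≤a) ≈-refl)))
    (≤-trans (*-monoˡ 0≤a le) (≈⇒≤ (R.*-comm a (fromℚ K))))

  summable⇒bounded : ∀ {a} → Summable a → Bounded a
  summable⇒bounded {a} sa =
    let K , K>0 , b = cauchy⇒bounded (convergent⇒cauchy sa)
    in K ℚ.+ K , ℚ.+-mono-< K>0 K>0 , λ n →
    ≤-trans (≈⇒≤ (abs-cong (≈-sym (last-term (partialSums a n) (a n)))))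
      (≤-trans (triangle (partialSums a (suc n)) (- partialSums a n))
      (≤-trans (+-mono (b (suc n)) (≤-trans (≈⇒≤ (∣∣-neg (partialSums a n))) (b n)))
               (≈⇒≤ (fromℚ-+ K K))))

  summable-* : ∀ {a g} → (∀ n → 0ℝ ≤ a n) → Summable a → Bounded g → Summable (λ n → a n * g n)
  summable-* {a} {g} a≥0 sa (K , K>0 , b) = cauchy⇒convergent
    (comparison K K>0 (convergent⇒cauchy sa) λ n →
      ≤-trans (≈⇒≤ (abs-cong (last-term (partialSums (λ n → a n * g n) n) (a n * g n))))
      (≤-trans (dominated (a≥0 n) (b n))
               (≈⇒≤ (*-cong ≈-refl (≈-sym (last-term (partialSums a n) (a n)))))))

  powers-bounded : ∀ {a} → Bounded a → ∀ m → Bounded (λ n → a n ^ m)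
  powers-bounded b zero    = 1ℚ , ℚ.positive⁻¹ 1ℚ , λ _ → ≈⇒≤ ∣1∣≈1
  powers-bounded b (suc m) = bounded-* b (powers-bounded b m)

abstract

  powers-summable : ∀ {a} → (∀ n → 0ℝ ≤ a n) → Summable a → ∀ m → Summable (λ n → a n ^ suc m)
  powers-summable a≥0 sa m = summable-* a≥0 sa (powers-bounded (summable⇒bounded sa) m)
    where open ConvergenceLemmas

record Parameters : Set where
  field
    α β : ℕ → ℝ
    γ   : ℝ
    α≥0 : ∀ i → 0ℝ ≤ α i
    β≥0 : ∀ i → 0ℝ ≤ β i
    γ≥0 : 0ℝ ≤ γ
    Σα  : Summable α
    Σβ  : Summable β

infixl 7 _⊛_

-- The Cauchy product of power series in z.
_⊛_ : (ℕ → ℝ) → (ℕ → ℝ) → ℕ → ℝ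
(f ⊛ g) k = sum {suc k} λ i → f (toℕ i) * g (k ∸ toℕ i)

-- The coefficients of 1 + bz, of 1/(1 - az) and of e^{cz}.
linear : ℝ → ℕ → ℝ
linear b 0             = 1ℝ
linear b 1             = b
linear b (suc (suc _)) = 0ℝ

geometric : ℝ → ℕ → ℝ
geometric a k = a ^ k

exponential : ℝ → ℕ → ℝ
exponential c k = fromℚ ((+ 1 ℚ./ k !) {{k ℕ.!≢0}}) * c ^ k

module _ (P : Parameters) where

  open Parameters P

  -- e^{γz} ∏_{i<N} (1 + β_i z)/(1 - α_i z)
  partialProduct : ℕ → ℕ → ℝ
  partialProduct zero    = exponential γ
  partialProduct (suc N) = linear (β N) ⊛ geometric (α N) ⊛ partialProduct N

module PartialProductLemmas (P : Parameters) where

  open Parameters P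
  open ConvergenceLemmas

  φ : ℝ → ℝ → ℕ → ℝ
  φ a b = linear b ⊛ geometric a

  φ-0 : ∀ a b → φ a b 0 ≈ 1ℝ
  φ-0 a b = ≈-trans (R.+-identityʳ (1ℝ * 1ℝ)) (R.*-identityˡ 1ℝ)

  zeros : ∀ n (f : Fin n → ℝ) → sum (λ i → 0ℝ * f i) ≈ 0ℝ
  zeros n f = ≈-trans (≈-sym (Sum.*-distribˡ-sum 0ℝ f)) (R.zeroˡ (sum f))

  φ-suc : ∀ a b k → φ a b (suc k) ≈ a ^ suc k + b * a ^ k
  φ-suc a b k = +-cong (R.*-identityˡ (a ^ suc k))
    (≈-trans (+-cong ≈-refl (zeros k (λ i → a ^ (k ∸ suc (toℕ i))))) (R.+-identityʳ (b * a ^ k)))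

  δ : ℕ → ℝ
  δ zero    = 1ℝ
  δ (suc _) = 0ℝ

  φ-rec : ∀ a b k → φ a b (suc k) ≈ a * φ a b k + b * δ k
  φ-rec a b zero = ≈-trans (φ-suc a b 0)
    (+-cong (*-cong ≈-refl (≈-sym (φ-0 a b))) ≈-refl)
  φ-rec a b (suc k) = ≈-trans (φ-suc a b (suc k))
    (≈-trans (geometric-step a b (a ^ k))
      (+-cong (*-cong ≈-refl (≈-sym (φ-suc a b k))) ≈-refl))

  δ-⊛ : ∀ f k → (δ ⊛ f) k ≈ f k
  δ-⊛ f k = ≈-trans (+-cong (R.*-identityˡ (f k)) (zeros k (λ i → f (k ∸ suc (toℕ i))))) (R.+-identityʳ (f k))

  ⊛-rec : ∀ a b f k → (φ a b ⊛ f) (suc k) ≈ f (suc k) + (a * (φ a b ⊛ f) k + b * f k)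
  ⊛-rec a b f k = +-cong (≈-trans (*-cong (φ-0 a b) ≈-refl) (R.*-identityˡ (f (suc k))))
    (≈-trans (Sum.sum-cong-≋ {n = suc k} (λ i → pw i))
    (≈-trans (Sum.∑-distrib-+ {n = suc k} (λ i → a * (φ a b (toℕ i) * f (k ∸ toℕ i))) (λ i → b * (δ (toℕ i) * f (k ∸ toℕ i))))
      (+-cong (≈-sym (Sum.*-distribˡ-sum {n = suc k} a (λ i → φ a b (toℕ i) * f (k ∸ toℕ i))))
        (≈-trans (≈-sym (Sum.*-distribˡ-sum {n = suc k} b (λ i → δ (toℕ i) * f (k ∸ toℕ i)))) (*-cong ≈-refl (δ-⊛ f k))))))
    where
    pw : ∀ (i : Fin (suc k)) → φ a b (suc (toℕ i)) * f (k ∸ toℕ i) ≈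
         a * (φ a b (toℕ i) * f (k ∸ toℕ i)) + b * (δ (toℕ i) * f (k ∸ toℕ i))
    pw i = ≈-trans (*-cong (φ-rec a b (toℕ i)) ≈-refl)
      (≈-trans (R.distribʳ (f (k ∸ toℕ i)) (a * φ a b (toℕ i)) (b * δ (toℕ i)))
        (+-cong (R.*-assoc a (φ a b (toℕ i)) (f (k ∸ toℕ i))) (R.*-assoc b (δ (toℕ i)) (f (k ∸ toℕ i)))))

  constant-term : ∀ N → exponential γ 0 ≈ partialProduct P N 0
  constant-term zero    = ≈-refl
  constant-term (suc N) = ≈-trans (constant-term N) (≈-sym
    (≈-trans (R.+-identityʳ _) (≈-trans (*-cong (φ-0 (α N) (β N)) ≈-refl) (R.*-identityˡ (partialProduct P N 0)))))

  coefficients-cauchy : ∀ k → CauchySeq (λ N → partialProduct P N k)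
  coefficients-cauchy zero    = cauchy-cong constant-term (cauchy-const (exponential γ 0))
  coefficients-cauchy (suc k) =
    let K , K>0 , b = cauchy⇒bounded (coefficients-cauchy k)
    in comparison K K>0 (cauchy-+ (convergent⇒cauchy Σα) (convergent⇒cauchy Σβ)) λ N →
    let u = α N * partialProduct P (suc N) k
        v = β N * partialProduct P N k
    in
    ≤-trans (≈⇒≤ (abs-cong (≈-trans (+-cong (⊛-rec (α N) (β N) (partialProduct P N) k) ≈-refl)
               (last-term (partialProduct P N (suc k)) (u + v)))))
    (≤-trans (triangle u v)
    (≤-trans (+-mono (dominated (α≥0 N) (b (suc N))) (dominated (β≥0 N) (b N)))
      (≈⇒≤ (last-terms (fromℚ K) (partialSums α N) (α N) (partialSums β N) (β N)))))

module _ (P : Parameters) where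

  open Parameters P

  abstract

    coefficients-converge : ∀ k → Convergent (λ N → partialProduct P N k)
    coefficients-converge k = ConvergenceLemmas.cauchy⇒convergent (PartialProductLemmas.coefficients-cauchy P k)

  -- The coefficients of e^{γz} ∏_i (1 + β_i z)/(1 - α_i z); the infinite product of power
  -- series is the coefficientwise limit of its partial products.
  h̃ : ℕ → ℝ
  h̃ k = lim (coefficients-converge k)

  h̃ℤ : ℤ → ℝ
  h̃ℤ (+ k)    = h̃ k
  h̃ℤ -[1+ _ ] = 0ℝ

  -- The value at 0 is never used, since the parts of a partition are positive.
  p̃ : ℕ → ℝ
  p̃ 0             = 0ℝ
  p̃ 1             = γ + lim Σα + lim Σβ
  p̃ (suc (suc m)) = lim (powers-summable α≥0 Σα (suc m))
                    + (- 1ℝ) ^ (3 ℕ.+ m) * lim (powers-summable β≥0 Σβ (suc m))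

det : ∀ {m} → (Fin m → Fin m → ℝ) → ℝ
det {zero}  A = 1ℝ
det {suc m} A = sum λ j → (- 1ℝ) ^ toℕ j * A zero j * det λ i k → A (suc i) (punchIn j k)

record Partition : Set where
  field
    parts      : List ℕ
    decreasing : Linked ℕ._≥_ parts
    positive   : All (0 ℕ.<_) parts

open Partition public

S̃[_] : Partition → Parameters → ℝ
S̃[ ƛ ] P = det {length (parts ƛ)} λ i j →
  h̃ℤ P (+ lookup (parts ƛ) i ℤ.- + toℕ i ℤ.+ + toℕ j)

p̃[_] : Partition → Parameters → ℝ
p̃[ ƛ ] P = foldr _*_ 1ℝ (map (p̃ P) (parts ƛ))

count : ℕ → List ℕ → ℕ
count i xs = length (filter (i ℕ.≟_) xs)

-- Sizes i larger than |ƛ| do not occur among the parts and contribute the factor 1.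
z : Partition → ℕ
z ƛ = productℕ (map factor (upTo (sumℕ (parts ƛ))))
  where
  factor : ℕ → ℕ
  factor i = suc i ℕ.^ m ℕ.* m !
    where m = count (suc i) (parts ƛ)

z≢0 : ∀ ƛ → ℕ.NonZero (z ƛ)
z≢0 ƛ = product≢0 (All.map⁺ (All.universal (λ i → factor≢0 (suc i) (count (suc i) (parts ƛ)))
                                          (upTo (sumℕ (parts ƛ)))))
  where
  factor≢0 : ∀ i m .{{_ : ℕ.NonZero i}} → ℕ.NonZero (i ℕ.^ m ℕ.* m !)
  factor≢0 i m = ℕ.m*n≢0 (i ℕ.^ m) (m !) {{ℕ.m^n≢0 i m}} {{m ℕ.!≢0}}

1/z : Partition → ℝ
1/z ƛ = fromℚ ((+ 1 ℚ./ z ƛ) {{z≢0 ƛ}})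

-- [e₁, …, eₙ] stands for x₁^e₁ ⋯ xₙ^eₙ.  Trailing zeros are allowed, and all the series
-- below have the same coefficient at two lists that stand for the same monomial.
Monomial : Set
Monomial = List ℕ

Series : Set
Series = Monomial → ℝ

-- Σ_{i : I} F i = G: every monomial occurs in only finitely many of the F i.
HasSum : {I : Set} → (I → Series) → Series → Set
HasSum {I} F G = ∀ μ → ∃ λ (is : List I) →
  Unique is × (∀ i → i ∉ is → F i μ ≈ 0ℝ) × foldr _+_ 0ℝ (map (λ i → F i μ) is) ≈ G μ

infixr 7 _∙_

_∙_ : ℝ → Series → Series
(c ∙ f) μ = c * f μ

factorizations : Monomial → List (Monomial × Monomial)
factorizations []      = ([] , []) ∷ []
factorizations (e ∷ μ) =
  cartesianProductWith (λ i (ν , ρ) → i ∷ ν , e ∸ i ∷ ρ) (upTo (suc e)) (factorizations μ)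

_⊗_ : Series → Series → Series
(f ⊗ g) μ = foldr _+_ 0ℝ (map (λ (ν , ρ) → f ν * g ρ) (factorizations μ))

indicator : {A : Set} → Dec A → ℝ
indicator (yes _) = 1ℝ
indicator (no  _) = 0ℝ

one : Series
one μ = indicator (all? (ℕ._≟ 0) μ)

-- x₁^m + x₂^m + ⋯ for m ≥ 1, split as x₁^m plus the power sum in x₂, x₃, ….
powerSum : ℕ → Series
powerSum m []      = 0ℝ
powerSum m (e ∷ μ) = indicator (e ℕ.≟ m) * one μ + indicator (e ℕ.≟ 0) * powerSum m μ

p[_] : Partition → Series
p[ ƛ ] = foldr _⊗_ one (map powerSum (parts ƛ))

-- A tableau is given by its rows; the entry i (counted from 0) carries the variable x_{i+1}.
Tableau : Set
Tableau = List (List ℕ)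

Semistandard : Tableau → Set
Semistandard T = All (Linked ℕ._≤_) T × Linked (λ upper lower → Prefix ℕ._>_ lower upper) T

semistandard? : Decidable Semistandard
semistandard? T = all? (linked? ℕ._≤?_) T ×-dec linked? (λ upper lower → prefix? ℕ._>?_ lower upper) T

content : ℕ → Tableau → Monomial
content n T = map (λ i → count i (concat T)) (upTo n)

words : ℕ → ℕ → List (List ℕ)
words n zero    = [] ∷ []
words n (suc k) = cartesianProductWith _∷_ (upTo n) (words n k)

fillings : ℕ → List ℕ → List Tableau
fillings n []       = [] ∷ []
fillings n (r ∷ rs) = cartesianProductWith _∷_ (words n r) (fillings n rs)

-- s_ƛ = Σ_T x^T over semistandard tableaux T of shape ƛ; the coefficient at μ only
-- involves tableaux with entries below the length of μ.
s[_] : Partition → Series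
s[ ƛ ] μ = fromℕ (length (filter (λ T → semistandard? T ×-dec ≡-dec ℕ._≟_ (content (length μ) T) μ)
                              (fillings (length μ) (parts ƛ))))

{-# OPTIONS --safe #-}

-- Both sides equal ∏_r H(x_r), where H(z) = Σ h̃_k z^k: their coefficient at x^μ is ∏_i h̃_{μ_i}.
--
-- Power sums.  Passing to the limit in the logarithmic derivatives of the partial products gives
-- Newton's identity k h̃_k = Σ_i p̃_i h̃_{k-i}, and hence |μ| G_μ = Σ_k p̃_k (p_k G)_μ for
-- G = ∏_r H(x_r).  Since k m_k(λ) / z_λ = 1 / z_ν when ν is λ without one part k, and
-- |λ| = Σ_k k m_k(λ), the series Σ_λ p̃_λ p_λ / z_λ satisfies the same recursion.
--
-- Schur functions.  Deleting the largest letter of a tableau expresses s_λ(x_1, …, x_n) through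
-- the s_ν(x_1, …, x_{n-1}) with λ/ν a horizontal strip, so the claim follows by induction on the
-- number of variables from the Pieri rule Σ_λ S_λ = h̃_e S_ν, over the λ for which λ/ν is a
-- horizontal strip of size e.  In the Pieri rule each row of λ runs independently through the
-- interval [ν_i, ν_{i-1}].  By multilinearity the generating function in e is therefore a single
-- determinant of power series; adding a multiple of the preceding row removes the upper bound
-- ν_{i-1}, and subtracting z times the next column then leaves h̃_{ν_i-i+j} in all columns but
-- the last, where the bottom row ν_{m+1} = 0 has its only nonzero entry, H(z).

module Submission where

open import Algebra.Bundles using (CommutativeRing)
open import Data.Fin.Base using (Fin; zero; suc; toℕ; punchIn)
open import Data.Integer.Base as ℤ using (+_)
import Data.Integer.Properties as ℤ
import Data.Integer.Solver as ℤ
open import Data.List.Base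
  using (List; []; _∷_; _++_; map; foldr; filter; length; concat; concatMap; upTo;
    applyUpTo; lookup; tabulate; replicate; cartesianProductWith; deduplicate)
import Data.List.Properties as List
open import Data.List.Membership.Propositional using (_∈_; _∉_; lose)
import Data.List.Membership.Propositional.Properties as ∈
open import Data.List.Membership.DecPropositional using () renaming (_∈?_ to member?)
open import Data.List.Relation.Binary.Permutation.Propositional as ↭ using (_↭_; prep; swap)
import Data.List.Relation.Binary.Permutation.Propositional.Properties as ↭
open import Data.List.Relation.Binary.Pointwise using (Pointwise; []; _∷_; Pointwise-≡⇒≡)
open import Data.List.Relation.Binary.Prefix.Heterogeneous using (Prefix; []; _∷_)
open import Data.List.Relation.Binary.Prefix.Heterogeneous.Properties using (prefix?)
open import Data.List.Relation.Unary.All as All using (All; []; _∷_; all?)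
import Data.List.Relation.Unary.All.Properties as All
open import Data.List.Relation.Unary.AllPairs using ([]; _∷_)
open import Data.List.Relation.Unary.Any using (here; there)
open import Data.List.Relation.Unary.Linked as Linked using (Linked; []; [-]; _∷_; linked?)
import Data.List.Relation.Unary.Sorted.TotalOrder.Properties as Sorted
open import Data.List.Relation.Unary.Unique.Propositional using (Unique)
import Data.List.Relation.Unary.Unique.Propositional.Properties as Unique
import Data.List.Relation.Unary.Unique.DecPropositional.Properties as UniqueDec
import Data.List.Sort as Sort
open import Data.List.Reverse using (Reverse; reverseView; []; _∶_∶ʳ_)
open import Data.Maybe.Base using (Maybe; nothing; just)
open import Data.Nat.Base as ℕ using (ℕ; zero; suc; z≤n; s≤s; _∸_; _!)
open import Data.Nat.ListAction using () renaming (sum to sumℕ; product to productℕ)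
import Data.Nat.ListAction.Properties as ℕ
import Data.Nat.Properties as ℕ
import Data.Nat.Solver as ℕ
open import Data.Product.Base using (∃; ∃₂; _×_; _,_; proj₁; proj₂)
open import Data.Rational.Base as ℚ using (1ℚ)
import Data.Rational.Properties as ℚ
import Data.Rational.Unnormalised.Base as ℚᵘ
import Data.Rational.Unnormalised.Properties as ℚᵘ
open import Data.Sum.Base using (_⊎_; inj₁; inj₂)
open import Function.Base using (_∘_)
open import Level using (0ℓ)
open import Relation.Binary.Definitions using (DecidableEquality)
open import Relation.Binary.PropositionalEquality as ≡ using (_≡_; _≢_)
import Relation.Binary.Construct.Flip.EqAndOrd as Flip
open import Relation.Nullary.Decidable using (Dec; yes; no; _×-dec_)
open import Relation.Nullary.Negation using (¬_; contradiction)

-- All identities are checked one monomial at a time, where only finite sums occur. On the power sum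
-- side the recursion determines every coefficient of positive degree because the degree is
-- invertible in the reals. On the Schur side two things obstruct a direct induction: shapes have
-- varying lengths, and in the Pieri rule the top row has no upper bound. Both are met by a fixed
-- box. Shapes are padded with zeros to `M` rows, which changes neither Kostka numbers nor
-- determinants; `M` exceeds the degree, so the bottom row of every shape that counts is empty and
-- can receive the strip. Parts are bounded by `B`, and generating functions are compared only
-- modulo `z^(E+1)`, where the cut at `B` cannot be seen. The sums then run over all words in the
-- box; words that are not padded partitions drop out because a Kostka number or an interlacing
-- weight vanishes. For this reason `D` and `kostka` accept arbitrary lists. Determinants are
-- developed over any commutative ring, since they are used over the reals and over power series,
-- and their columns are arbitrary labels, so that a column and its generating function can stand in
-- one matrix.

-- Finite sums over lists.

module FiniteSums (S : CommutativeRing 0ℓ 0ℓ) where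

  open CommutativeRing S
  open import Relation.Binary.Reasoning.Setoid setoid
  open import Algebra.Solver.Ring.NaturalCoefficients.Default commutativeSemiring

  private variable A B C : Set

  ∑ : List A → (A → Carrier) → Carrier
  ∑ xs f = foldr _+_ 0# (map f xs)

  ∑-cong : ∀ (xs : List A) {f g} → (∀ x → x ∈ xs → f x ≈ g x) → ∑ xs f ≈ ∑ xs g
  ∑-cong []       e = refl
  ∑-cong (x ∷ xs) e = +-cong (e x (here ≡.refl)) (∑-cong xs λ y p → e y (there p))

  ∑-zero : ∀ (xs : List A) {f} → (∀ x → x ∈ xs → f x ≈ 0#) → ∑ xs f ≈ 0#
  ∑-zero []       e = refl
  ∑-zero (x ∷ xs) e = trans (+-cong (e x (here ≡.refl)) (∑-zero xs λ y p → e y (there p))) (+-identityˡ 0#)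

  ∑-++ : ∀ (xs ys : List A) f → ∑ (xs ++ ys) f ≈ ∑ xs f + ∑ ys f
  ∑-++ []       ys f = sym (+-identityˡ _)
  ∑-++ (x ∷ xs) ys f = trans (+-congˡ (∑-++ xs ys f)) (sym (+-assoc _ _ _))

  ∑-map : ∀ (g : A → B) xs f → ∑ (map g xs) f ≈ ∑ xs (f ∘ g)
  ∑-map g []       f = refl
  ∑-map g (x ∷ xs) f = +-congˡ (∑-map g xs f)

  ∑-+ : ∀ (xs : List A) f g → ∑ xs (λ x → f x + g x) ≈ ∑ xs f + ∑ xs g
  ∑-+ []       f g = sym (+-identityˡ 0#)
  ∑-+ (x ∷ xs) f g = trans (+-congˡ (∑-+ xs f g))
    (solve 4 (λ a b c d → (a :+ b) :+ (c :+ d) := (a :+ c) :+ (b :+ d)) refl (f x) (g x) (∑ xs f) (∑ xs g))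

  ∑-*ˡ : ∀ (xs : List A) a f → a * ∑ xs f ≈ ∑ xs (λ x → a * f x)
  ∑-*ˡ []       a f = zeroʳ a
  ∑-*ˡ (x ∷ xs) a f = trans (distribˡ a _ _) (+-congˡ (∑-*ˡ xs a f))

  ∑-*ʳ : ∀ (xs : List A) a f → ∑ xs f * a ≈ ∑ xs (λ x → f x * a)
  ∑-*ʳ []       a f = zeroˡ a
  ∑-*ʳ (x ∷ xs) a f = trans (distribʳ a _ _) (+-congˡ (∑-*ʳ xs a f))

  ∑-swap : ∀ (xs : List A) (ys : List B) (f : A → B → Carrier) → ∑ xs (λ x → ∑ ys (f x)) ≈ ∑ ys (λ y → ∑ xs (λ x → f x y))
  ∑-swap []       ys f = sym (∑-zero ys λ _ _ → refl)
  ∑-swap (x ∷ xs) ys f = trans (+-congˡ (∑-swap xs ys f)) (sym (∑-+ ys (f x) _))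

  ∑-cartesianProductWith : ∀ (g : A → B → C) xs ys f →
    ∑ (cartesianProductWith g xs ys) f ≈ ∑ xs (λ x → ∑ ys (λ y → f (g x y)))
  ∑-cartesianProductWith g []       ys f = refl
  ∑-cartesianProductWith g (x ∷ xs) ys f =
    trans (∑-++ (map (g x) ys) _ f) (+-cong (∑-map (g x) ys f) (∑-cartesianProductWith g xs ys f))

  ∑-single : ∀ {x : A} {xs f} → Unique xs → x ∈ xs → (∀ y → y ∈ xs → y ≢ x → f y ≈ 0#) → ∑ xs f ≈ f x
  ∑-single {xs = _ ∷ xs} (x∉ ∷ u) (here ≡.refl) e =
    trans (+-congˡ (∑-zero xs λ y p → e y (there p) λ q → All.lookup x∉ p (≡.sym q))) (+-identityʳ _)
  ∑-single {xs = y ∷ xs} (y∉ ∷ u) (there p) e =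
    trans (+-cong (e y (here ≡.refl) (All.lookup y∉ p)) (∑-single u p λ z q → e z (there q))) (+-identityˡ _)

  -- Each `f x` is spread out as a sum over `ys` of a delta function, and the two sums are
  -- exchanged. This compares sums over different index lists without rearranging either list.
  ∑-⊆ : DecidableEquality A → ∀ {xs ys f} → Unique xs → Unique ys → (∀ {x} → x ∈ xs → x ∈ ys) →
        (∀ y → y ∈ ys → y ∉ xs → f y ≈ 0#) → ∑ xs f ≈ ∑ ys f
  ∑-⊆ {A} _≟_ {xs} {ys} {f} uxs uys sub e = begin
    ∑ xs f                             ≈⟨ ∑-cong xs (λ x p → sym (trans
      (∑-single uys (sub p) (λ y _ y≢x → pick-≢ (λ q → y≢x (≡.sym q)))) (pick-≡ x))) ⟩
    ∑ xs (λ x → ∑ ys (λ y → pick x y)) ≈⟨ ∑-swap xs ys pick ⟩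
    ∑ ys (λ y → ∑ xs (λ x → pick x y)) ≈⟨ ∑-cong ys inner ⟩
    ∑ ys f                             ∎
    where
    pick : A → A → Carrier
    pick x y with x ≟ y
    ... | yes _ = f y
    ... | no  _ = 0#
    pick-≡ : ∀ x → pick x x ≈ f x
    pick-≡ x with x ≟ x
    ... | yes _ = refl
    ... | no ¬p = contradiction ≡.refl ¬p
    pick-≢ : ∀ {x y} → x ≢ y → pick x y ≈ 0#
    pick-≢ {x} {y} x≢y with x ≟ y
    ... | yes p = contradiction p x≢y
    ... | no  _ = refl
    inner : ∀ y → y ∈ ys → ∑ xs (λ x → pick x y) ≈ f y
    inner y y∈ys with member? _≟_ y xs
    ... | yes p = trans (∑-single uxs p λ x _ → pick-≢) (pick-≡ y)
    ... | no ¬p = trans (∑-zero xs λ x q → pick-≢ λ { ≡.refl → ¬p q }) (sym (e y y∈ys ¬p))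

-- Determinants by Laplace expansion.

-- The determinant of the rows, given as functions, at the listed columns.
module Determinants (S : CommutativeRing 0ℓ 0ℓ) where

  open CommutativeRing S
  open FiniteSums S
  open import Algebra.Properties.Ring ring
  open import Relation.Binary.Reasoning.Setoid setoid
  open import Algebra.Solver.Ring.NaturalCoefficients.Default commutativeSemiring

  private variable A X Y : Set

  -- `F` gives the minor as a function of the columns that remain. Passing over a column flips the
  -- sign and hands that column to all later minors, so no indices or explicit signs occur, and
  -- lemmas go by induction on the columns for arbitrary `F`.
  laplace : (X → Carrier) → List X → (List X → Carrier) → Carrier
  laplace r []      F = 0#
  laplace r (c ∷ C) F = r c * F C - laplace r C (λ D → F (c ∷ D))

  -- Data that are not square give zero, so the lemmas need no hypotheses on lengths.
  detL : List (X → Carrier) → List X → Carrier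
  detL []       []      = 1#
  detL []       (_ ∷ _) = 0#
  detL (r ∷ rs) C       = laplace r C (detL rs)

  laplace-cong : ∀ {r r′ : X → Carrier} → (∀ x → r x ≈ r′ x) → ∀ C {F F′} → (∀ D → F D ≈ F′ D) →
                 laplace r C F ≈ laplace r′ C F′
  laplace-cong er []      eF = refl
  laplace-cong er (c ∷ C) eF =
    +-cong (*-cong (er c) (eF C)) (-‿cong (laplace-cong er C λ D → eF (c ∷ D)))

  detL-cong : ∀ {rs rs′ : List (X → Carrier)} → Pointwise (λ r r′ → ∀ x → r x ≈ r′ x) rs rs′ →
              ∀ C → detL rs C ≈ detL rs′ C
  detL-cong []       []      = refl
  detL-cong []       (_ ∷ _) = refl
  detL-cong (e ∷ es) C       = laplace-cong e C (detL-cong es)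

  laplace-linear-row : ∀ (r r′ : X → Carrier) s C F →
    laplace (λ x → r x + s * r′ x) C F ≈ laplace r C F + s * laplace r′ C F
  laplace-linear-row r r′ s []      F = sym (trans (+-identityˡ _) (zeroʳ s))
  laplace-linear-row r r′ s (c ∷ C) F = begin
    (r c + s * r′ c) * F C - laplace _ C F′       ≈⟨ +-congˡ (-‿cong (laplace-linear-row r r′ s C F′)) ⟩
    (r c + s * r′ c) * F C - (L + s * L′)         ≈⟨ +-congˡ (trans (sym (-‿+-comm L _)) (+-congˡ (-‿distribʳ-* s L′))) ⟩
    (r c + s * r′ c) * F C + (- L + s * (- L′))
      ≈⟨ solve 6 (λ a s b f l l′ → (a :+ s :* b) :* f :+ (l :+ s :* l′) := (a :* f :+ l) :+ s :* (b :* f :+ l′)) refl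
           (r c) s (r′ c) (F C) (- L) (- L′) ⟩
    (r c * F C - L) + s * (r′ c * F C - L′)       ∎
    where
    F′ = λ D → F (c ∷ D)
    L  = laplace r C F′
    L′ = laplace r′ C F′

  laplace-linear : ∀ (r : X → Carrier) s C F G →
    laplace r C (λ D → F D + s * G D) ≈ laplace r C F + s * laplace r C G
  laplace-linear r s []      F G = sym (trans (+-identityˡ _) (zeroʳ s))
  laplace-linear r s (c ∷ C) F G = begin
    r c * (F C + s * G C) - laplace r C _         ≈⟨ +-congˡ (-‿cong (laplace-linear r s C F′ G′)) ⟩
    r c * (F C + s * G C) - (L + s * L′)          ≈⟨ +-congˡ (trans (sym (-‿+-comm L _)) (+-congˡ (-‿distribʳ-* s L′))) ⟩
    r c * (F C + s * G C) + (- L + s * (- L′))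
      ≈⟨ solve 6 (λ a s f g l l′ → a :* (f :+ s :* g) :+ (l :+ s :* l′) := (a :* f :+ l) :+ s :* (a :* g :+ l′)) refl
           (r c) s (F C) (G C) (- L) (- L′) ⟩
    (r c * F C - L) + s * (r c * G C - L′)        ∎
    where
    F′ = λ D → F (c ∷ D)
    G′ = λ D → G (c ∷ D)
    L  = laplace r C F′
    L′ = laplace r C G′

  laplace-zero : ∀ (r : X → Carrier) C {F} → (∀ D → F D ≈ 0#) → laplace r C F ≈ 0#
  laplace-zero r []      e = refl
  laplace-zero r (c ∷ C) e = trans (+-cong (trans (*-congˡ (e C)) (zeroʳ _)) (-‿cong (laplace-zero r C λ D → e (c ∷ D))))
    (-‿inverseʳ 0#)

  laplace-scale : ∀ (r : X → Carrier) s C F → laplace r C (λ D → s * F D) ≈ s * laplace r C F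
  laplace-scale r s C F = begin
    laplace r C (λ D → s * F D)                          ≈⟨ laplace-cong (λ _ → refl) C (λ _ → sym (+-identityˡ _)) ⟩
    laplace r C (λ D → 0# + s * F D)                     ≈⟨ laplace-linear r s C (λ _ → 0#) F ⟩
    laplace r C (λ _ → 0#) + s * laplace r C F           ≈⟨ +-congʳ (laplace-zero r C λ _ → refl) ⟩
    0# + s * laplace r C F                               ≈⟨ +-identityˡ _ ⟩
    s * laplace r C F                                    ∎

  -- This says that two equal rows give zero. Deleting `c` in the first expansion or in the second
  -- gives the same product `r c * L` with opposite signs; what remains is the claim for `C`.
  laplace-alternating : ∀ (r : X → Carrier) C F → laplace r C (λ D → laplace r D F) ≈ 0#
  laplace-alternating r []      F = refl
  laplace-alternating r (c ∷ C) F = begin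
    r c * L - laplace r C (λ D → r c * F D - laplace r D F′)
      ≈⟨ +-congˡ (-‿cong (laplace-cong (λ _ → refl) C λ D → trans (+-comm _ _)
           (+-congʳ (sym (-1*x≈-x _))))) ⟩
    r c * L - laplace r C (λ D → - 1# * laplace r D F′ + r c * F D)
      ≈⟨ +-congˡ (-‿cong (trans (laplace-linear r (r c) C _ F) (+-congʳ (trans (laplace-scale r (- 1#) C _)
           (trans (*-congˡ (laplace-alternating r C F′)) (zeroʳ _)))))) ⟩
    r c * L - (0# + r c * L)
      ≈⟨ +-congˡ (-‿cong (+-identityˡ _)) ⟩
    r c * L - r c * L
      ≈⟨ -‿inverseʳ _ ⟩
    0# ∎
    where
    F′ = λ D → F (c ∷ D)
    L  = laplace r C F

  detL-add-row : ∀ (r r′ : X → Carrier) s rs C →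
    detL (r ∷ (λ x → r′ x + s * r x) ∷ rs) C ≈ detL (r ∷ r′ ∷ rs) C
  detL-add-row r r′ s rs C = begin
    laplace r C (λ D → laplace (λ x → r′ x + s * r x) D (detL rs))
      ≈⟨ laplace-cong (λ _ → refl) C (λ D → laplace-linear-row r′ r s D (detL rs)) ⟩
    laplace r C (λ D → laplace r′ D (detL rs) + s * laplace r D (detL rs))
      ≈⟨ laplace-linear r s C _ _ ⟩
    laplace r C (λ D → laplace r′ D (detL rs)) + s * laplace r C (λ D → laplace r D (detL rs))
      ≈⟨ +-congˡ (trans (*-congˡ (laplace-alternating r C (detL rs))) (zeroʳ s)) ⟩
    laplace r C (λ D → laplace r′ D (detL rs)) + 0#
      ≈⟨ +-identityʳ _ ⟩
    detL (r ∷ r′ ∷ rs) C ∎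

  laplace-∑ : ∀ (as : List A) (w : A → Carrier) (r : A → X → Carrier) C F →
    laplace (λ x → ∑ as (λ a → w a * r a x)) C F ≈ ∑ as (λ a → w a * laplace (r a) C F)
  laplace-∑ []       w r C F = zero-row C F
    where
    zero-row : ∀ C F → laplace (λ _ → 0#) C F ≈ 0#
    zero-row []      F = refl
    zero-row (c ∷ C) F = trans (+-cong (zeroˡ _) (-‿cong (zero-row C _))) (-‿inverseʳ 0#)
  laplace-∑ (a ∷ as) w r C F = begin
    laplace (λ x → w a * r a x + ∑ as (λ a → w a * r a x)) C F
      ≈⟨ laplace-cong (λ x → +-comm _ _) C (λ _ → refl) ⟩
    laplace (λ x → ∑ as (λ a → w a * r a x) + w a * r a x) C F
      ≈⟨ laplace-linear-row _ (r a) (w a) C F ⟩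
    laplace (λ x → ∑ as (λ a → w a * r a x)) C F + w a * laplace (r a) C F
      ≈⟨ +-comm _ _ ⟩
    w a * laplace (r a) C F + laplace (λ x → ∑ as (λ a → w a * r a x)) C F
      ≈⟨ +-congˡ (laplace-∑ as w r C F) ⟩
    w a * laplace (r a) C F + ∑ as (λ a → w a * laplace (r a) C F) ∎

  laplace-∑-minors : ∀ (r : X → Carrier) C (as : List A) (w : A → Carrier) (F : A → List X → Carrier) →
    laplace r C (λ D → ∑ as (λ a → w a * F a D)) ≈ ∑ as (λ a → w a * laplace r C (F a))
  laplace-∑-minors r C []       w F = laplace-zero r C λ _ → refl
  laplace-∑-minors r C (a ∷ as) w F = begin
    laplace r C (λ D → w a * F a D + ∑ as (λ a → w a * F a D))
      ≈⟨ laplace-cong (λ _ → refl) C (λ D → +-comm _ _) ⟩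
    laplace r C (λ D → ∑ as (λ a → w a * F a D) + w a * F a D)
      ≈⟨ laplace-linear r (w a) C _ (F a) ⟩
    laplace r C (λ D → ∑ as (λ a → w a * F a D)) + w a * laplace r C (F a)
      ≈⟨ +-comm _ _ ⟩
    w a * laplace r C (F a) + laplace r C (λ D → ∑ as (λ a → w a * F a D))
      ≈⟨ +-congˡ (laplace-∑-minors r C as w F) ⟩
    w a * laplace r C (F a) + ∑ as (λ a → w a * laplace r C (F a)) ∎

  laplace-map : ∀ (f : Y → X) (r : X → Carrier) C {F F′} → (∀ D → F D ≈ F′ (map f D)) →
    laplace (r ∘ f) C F ≈ laplace r (map f C) F′
  laplace-map f r []      e = refl
  laplace-map f r (c ∷ C) e = +-cong (*-congˡ (e C)) (-‿cong (laplace-map f r C λ D → e (c ∷ D)))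

  detL-map : ∀ (f : Y → X) rs C → detL (map (_∘ f) rs) C ≈ detL rs (map f C)
  detL-map f []       []      = refl
  detL-map f []       (_ ∷ _) = refl
  detL-map f (r ∷ rs) C       = laplace-map f r C (detL-map f rs)

  laplace-vanishing : ∀ (r : X → Carrier) {l : X → Carrier} C {F} → All (λ c → l c ≈ 0#) C →
    (∀ D → All (λ c → l c ≈ 0#) D → F D ≈ 0#) → laplace r C F ≈ 0#
  laplace-vanishing r []      []       e = refl
  laplace-vanishing r (c ∷ C) (p ∷ ps) e =
    trans (+-cong (trans (*-congˡ (e C ps)) (zeroʳ _))
                  (-‿cong (laplace-vanishing r C ps λ D qs → e (c ∷ D) (p ∷ qs)))) (-‿inverseʳ 0#)

  detL-zero-row : ∀ rs (l : X → Carrier) C → All (λ c → l c ≈ 0#) C → detL (rs ++ l ∷ []) C ≈ 0#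
  detL-zero-row []       l C ps = zero-row C ps
    where
    zero-row : ∀ C {F} → All (λ c → l c ≈ 0#) C → laplace l C F ≈ 0#
    zero-row []      []       = refl
    zero-row (c ∷ C) (p ∷ ps) = trans (+-cong (trans (*-congʳ p) (zeroˡ _)) (-‿cong (zero-row C ps))) (-‿inverseʳ 0#)
  detL-zero-row (r ∷ rs) l C ps = laplace-vanishing r C ps (detL-zero-row rs l)

  -- If `r` deletes the last column `d`, the columns left are zeros of the bottom row `l`, and the
  -- minor vanishes by `e₀`. Otherwise `d` survives in the minor and `e` applies.
  laplace-last-row : ∀ (r l : X → Carrier) C d {F G} → All (λ c → l c ≈ 0#) C →
    (∀ D → All (λ c → l c ≈ 0#) D → F D ≈ 0#) →
    (∀ D → All (λ c → l c ≈ 0#) D → F (D ++ d ∷ []) ≈ l d * G D) →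
    laplace r (C ++ d ∷ []) F ≈ l d * laplace r C G
  laplace-last-row r l []      d ps e₀ e = begin
    r d * _ - 0#   ≈⟨ +-cong (trans (*-congˡ (e₀ [] [])) (zeroʳ _)) -0#≈0# ⟩
    0# + 0#        ≈⟨ +-identityˡ 0# ⟩
    0#             ≈⟨ zeroʳ _ ⟨
    l d * 0#       ∎
  laplace-last-row r l (c ∷ C) d {F} {G} (p ∷ ps) e₀ e = begin
    r c * F (C ++ d ∷ []) - laplace r (C ++ d ∷ []) (λ D → F (c ∷ D))
      ≈⟨ +-cong (*-congˡ (e C ps)) (-‿cong (laplace-last-row r l C d ps
           (λ D qs → e₀ (c ∷ D) (p ∷ qs)) (λ D qs → e (c ∷ D) (p ∷ qs)))) ⟩
    r c * (l d * G C) - l d * L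
      ≈⟨ +-congˡ (-‿distribʳ-* (l d) L) ⟩
    r c * (l d * G C) + l d * (- L)
      ≈⟨ solve 4 (λ r l g m → r :* (l :* g) :+ l :* m := l :* (r :* g :+ m)) refl (r c) (l d) (G C) (- L) ⟩
    l d * (r c * G C - L) ∎
    where L = laplace r C (λ D → G (c ∷ D))

  detL-last-row : ∀ rs (l : X → Carrier) C d → All (λ c → l c ≈ 0#) C →
    detL (rs ++ l ∷ []) (C ++ d ∷ []) ≈ l d * detL rs C
  detL-last-row []       l []      d ps = trans (+-congˡ -0#≈0#) (+-identityʳ _)
  detL-last-row []       l (c ∷ C) d (p ∷ ps) = trans
    (trans (+-cong (trans (*-congʳ p) (zeroˡ _)) (-‿cong (laplace-zero l (C ++ d ∷ []) λ _ → refl))) (-‿inverseʳ 0#))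
    (sym (zeroʳ _))
  detL-last-row (r ∷ rs) l C d ps =
    laplace-last-row r l C d ps (detL-zero-row rs l) (λ D → detL-last-row rs l D d)

  -- Each s, u adds the s-multiple of the original preceding row to the row u.
  chain : (X → Carrier) → List (Carrier × (X → Carrier)) → List (X → Carrier)
  chain r []              = []
  chain r ((s , u) ∷ sus) = (λ x → u x + s * r x) ∷ chain u sus

  -- The operations are undone from the top: subtracting a multiple of `r` restores `u`, which is
  -- exactly the row from which the rest of the chain was formed.
  detL-chain : ∀ (r : X → Carrier) sus C → detL (r ∷ chain r sus) C ≈ detL (r ∷ map proj₂ sus) C
  detL-chain r []              C = refl
  detL-chain r ((s , u) ∷ sus) C =
    trans (detL-add-row r u s (chain u sus) C) (laplace-cong (λ _ → refl) C (detL-chain u sus))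

  laplace-linear-column : ∀ (r : X → Carrier) s c c′ d B C {F} → r c′ ≈ r c + s * r d →
    (∀ B C → F (B ++ c′ ∷ C) ≈ F (B ++ c ∷ C) + s * F (B ++ d ∷ C)) →
    laplace r (B ++ c′ ∷ C) F ≈ laplace r (B ++ c ∷ C) F + s * laplace r (B ++ d ∷ C) F
  laplace-linear-column r s c c′ d [] C {F} er e = begin
    r c′ * F C - laplace r C (λ D → F (c′ ∷ D))
      ≈⟨ +-cong (*-congʳ er) (-‿cong (trans (laplace-cong (λ _ → refl) C (e [])) (laplace-linear r s C _ _))) ⟩
    (r c + s * r d) * F C - (L + s * L′)
      ≈⟨ +-congˡ (trans (sym (-‿+-comm L _)) (+-congˡ (-‿distribʳ-* s L′))) ⟩
    (r c + s * r d) * F C + (- L + s * (- L′))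
      ≈⟨ solve 6 (λ a s b f l l′ → (a :+ s :* b) :* f :+ (l :+ s :* l′) := (a :* f :+ l) :+ s :* (b :* f :+ l′)) refl
           (r c) s (r d) (F C) (- L) (- L′) ⟩
    (r c * F C - L) + s * (r d * F C - L′) ∎
    where
    L  = laplace r C (λ D → F (c ∷ D))
    L′ = laplace r C (λ D → F (d ∷ D))
  laplace-linear-column r s c c′ d (b ∷ B) C {F} er e = begin
    r b * F (B ++ c′ ∷ C) - laplace r (B ++ c′ ∷ C) F′
      ≈⟨ +-cong (*-congˡ (e B C)) (-‿cong (laplace-linear-column r s c c′ d B C er λ B → e (b ∷ B))) ⟩
    r b * (F (B ++ c ∷ C) + s * F (B ++ d ∷ C)) - (L + s * L′)
      ≈⟨ +-congˡ (trans (sym (-‿+-comm L _)) (+-congˡ (-‿distribʳ-* s L′))) ⟩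
    r b * (F (B ++ c ∷ C) + s * F (B ++ d ∷ C)) + (- L + s * (- L′))
      ≈⟨ solve 6 (λ a s f g l l′ → a :* (f :+ s :* g) :+ (l :+ s :* l′) := (a :* f :+ l) :+ s :* (a :* g :+ l′)) refl
           (r b) s (F (B ++ c ∷ C)) (F (B ++ d ∷ C)) (- L) (- L′) ⟩
    (r b * F (B ++ c ∷ C) - L) + s * (r b * F (B ++ d ∷ C) - L′) ∎
    where
    F′ = λ D → F (b ∷ D)
    L  = laplace r (B ++ c ∷ C) F′
    L′ = laplace r (B ++ d ∷ C) F′

  detL-linear-column : ∀ (rs : List (X → Carrier)) s c c′ d → All (λ r → r c′ ≈ r c + s * r d) rs →
    ∀ B C → detL rs (B ++ c′ ∷ C) ≈ detL rs (B ++ c ∷ C) + s * detL rs (B ++ d ∷ C)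
  detL-linear-column []       s c c′ d []       []      C = sym (trans (+-identityˡ _) (zeroʳ s))
  detL-linear-column []       s c c′ d []       (_ ∷ _) C = sym (trans (+-identityˡ _) (zeroʳ s))
  detL-linear-column (r ∷ rs) s c c′ d (e ∷ es) B       C =
    laplace-linear-column r s c c′ d B C e (detL-linear-column rs s c c′ d es)

  -- For adjacent columns only two extra terms appear: deleting `c′` contributes `s * r d` times the
  -- minor with `d`, and deleting `d` contributes the same with the opposite sign. `lin` serves the
  -- minors without `d`, and the last hypothesis those that keep both columns.
  laplace-add-column : ∀ (r : X → Carrier) s c c′ d B C {F} → r c′ ≈ r c + s * r d →
    (∀ B C → F (B ++ c′ ∷ C) ≈ F (B ++ c ∷ C) + s * F (B ++ d ∷ C)) →
    (∀ B C → F (B ++ c′ ∷ d ∷ C) ≈ F (B ++ c ∷ d ∷ C)) →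
    laplace r (B ++ c′ ∷ d ∷ C) F ≈ laplace r (B ++ c ∷ d ∷ C) F
  laplace-add-column r s c c′ d [] C {F} er lin e = begin
    r c′ * F (d ∷ C) - (r d * F (c′ ∷ C) - laplace r C (λ D → F (c′ ∷ d ∷ D)))
      ≈⟨ +-cong (*-congʳ er) (-‿cong (+-cong (*-congˡ (lin [] C)) (-‿cong (laplace-cong (λ _ → refl) C (e []))))) ⟩
    (r c + s * r d) * g - (r d * (f + s * g) - L)
      ≈⟨ +-congˡ (trans (-‿anti-homo-+ _ _) (+-congˡ (trans (-‿cong (distribˡ (r d) f (s * g))) (sym (-‿+-comm _ _))))) ⟩
    (r c + s * r d) * g + (- - L + (- (r d * f) + - (r d * (s * g))))
      ≈⟨ solve 7 (λ a s b g l u v → (a :+ s :* b) :* g :+ (l :+ (u :+ v)) := (a :* g :+ (l :+ u)) :+ (b :* (s :* g) :+ v)) refl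
           (r c) s (r d) g (- - L) (- (r d * f)) (- (r d * (s * g))) ⟩
    (r c * g + (- - L + - (r d * f))) + (r d * (s * g) + - (r d * (s * g)))
      ≈⟨ +-cong (+-congˡ (sym (-‿anti-homo-+ _ _))) (-‿inverseʳ _) ⟩
    (r c * g - (r d * f - L)) + 0#
      ≈⟨ +-identityʳ _ ⟩
    r c * g - (r d * f - L) ∎
    where
    f = F (c ∷ C)
    g = F (d ∷ C)
    L = laplace r C (λ D → F (c ∷ d ∷ D))
  laplace-add-column r s c c′ d (b ∷ B) C er lin e =
    +-cong (*-congˡ (e B C)) (-‿cong (laplace-add-column r s c c′ d B C er (λ B → lin (b ∷ B)) (λ B → e (b ∷ B))))

  detL-add-column : ∀ (rs : List (X → Carrier)) s c c′ d → All (λ r → r c′ ≈ r c + s * r d) rs →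
    ∀ B C → detL rs (B ++ c′ ∷ d ∷ C) ≈ detL rs (B ++ c ∷ d ∷ C)
  detL-add-column []       s c c′ d []       []      C = refl
  detL-add-column []       s c c′ d []       (_ ∷ _) C = refl
  detL-add-column (r ∷ rs) s c c′ d (e ∷ es) B       C =
    laplace-add-column r s c c′ d B C e (detL-linear-column rs s c c′ d es) (detL-add-column rs s c c′ d es)

open import Defs

private module R = CommutativeRing ℝ-commutativeRing

open FiniteSums ℝ-commutativeRing
open import Algebra.Properties.Ring R.ring using (-0#≈0#; -‿distribˡ-*; -‿distribʳ-*; -1*x≈-x; -‿involutive)
import Algebra.Properties.Semiring.Sum R.semiring as Sum
open import Algebra.Solver.Ring.NaturalCoefficients.Default R.commutativeSemiring
open import Relation.Binary.Reasoning.Setoid R.setoid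

-- Power series over ℝ

infix 4 _≈[_]_

-- Congruence of power series modulo z^{E+1}.
record _≈[_]_ (f : ℕ → ℝ) (E : ℕ) (g : ℕ → ℝ) : Set where
  constructor mk≈[]
  field coefficient : ∀ k → k ℕ.≤ E → f k ≈ g k

open _≈[_]_

infixl 6 _⊕_
infix 8 ⊖_

_⊕_ : (ℕ → ℝ) → (ℕ → ℝ) → ℕ → ℝ
(f ⊕ g) k = f k + g k

⊖_ : (ℕ → ℝ) → ℕ → ℝ
(⊖ f) k = - f k

0ₛ : ℕ → ℝ
0ₛ _ = 0ℝ

const : ℝ → ℕ → ℝ
const a zero    = a
const a (suc _) = 0ℝ

⊛-cong : ∀ {f f′ g g′} k → (∀ i → i ℕ.≤ k → f i ≈ f′ i) → (∀ i → i ℕ.≤ k → g i ≈ g′ i) → (f ⊛ g) k ≈ (f′ ⊛ g′) k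
⊛-cong zero    ef eg = R.+-congʳ (R.*-cong (ef 0 z≤n) (eg 0 z≤n))
⊛-cong (suc k) ef eg = R.+-cong (R.*-cong (ef 0 z≤n) (eg (suc k) ℕ.≤-refl))
  (⊛-cong k (λ i le → ef (suc i) (s≤s le)) (λ i le → eg i (ℕ.m≤n⇒m≤1+n le)))

⊛-congˡ : ∀ f {g g′} k → (∀ i → g i ≈ g′ i) → (f ⊛ g) k ≈ (f ⊛ g′) k
⊛-congˡ f k e = ⊛-cong {f} {f} k (λ _ _ → R.refl) (λ i _ → e i)

⊛-congʳ : ∀ g {f f′} k → (∀ i → f i ≈ f′ i) → (f ⊛ g) k ≈ (f′ ⊛ g) k
⊛-congʳ g k e = ⊛-cong {g = g} {g} k (λ i _ → e i) (λ _ _ → R.refl)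

-- `⊛` unfolds at its first index, replacing `f` by `f ∘ suc`, and most identities follow by
-- induction along this. Commutativity also needs the last index split off.
⊛-sucʳ : ∀ f g k → (f ⊛ g) (suc k) ≈ (f ⊛ (g ∘ suc)) k + f (suc k) * g 0
⊛-sucʳ f g zero    = solve 4 (λ a b c d → a :* b :+ (c :* d :+ con 0) := (a :* b :+ con 0) :+ c :* d) R.refl (f 0) (g 1) (f 1) (g 0)
⊛-sucʳ f g (suc k) = R.trans (R.+-congˡ (⊛-sucʳ (f ∘ suc) g k)) (R.sym (R.+-assoc _ _ _))

⊛-comm : ∀ f g k → (f ⊛ g) k ≈ (g ⊛ f) k
⊛-comm f g zero    = R.+-congʳ (R.*-comm _ _)
⊛-comm f g (suc k) = begin
  f 0 * g (suc k) + ((f ∘ suc) ⊛ g) k ≈⟨ R.+-cong (R.*-comm _ _) (⊛-comm (f ∘ suc) g k) ⟩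
  g (suc k) * f 0 + (g ⊛ (f ∘ suc)) k ≈⟨ R.+-comm _ _ ⟩
  (g ⊛ (f ∘ suc)) k + g (suc k) * f 0 ≈⟨ ⊛-sucʳ g f k ⟨
  (g ⊛ f) (suc k)                     ∎

⊛-distribʳ : ∀ h f g k → ((f ⊕ g) ⊛ h) k ≈ (f ⊛ h) k + (g ⊛ h) k
⊛-distribʳ h f g zero    = solve 3 (λ h f g → (f :+ g) :* h :+ con 0 := (f :* h :+ con 0) :+ (g :* h :+ con 0)) R.refl (h 0) (f 0) (g 0)
⊛-distribʳ h f g (suc k) = R.trans (R.+-congˡ (⊛-distribʳ h (f ∘ suc) (g ∘ suc) k))
  (solve 5 (λ h f g u v → (f :+ g) :* h :+ (u :+ v) := (f :* h :+ u) :+ (g :* h :+ v)) R.refl (h (suc k)) (f 0) (g 0) _ _)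

⊛-distribˡ : ∀ h f g k → (h ⊛ (f ⊕ g)) k ≈ (h ⊛ f) k + (h ⊛ g) k
⊛-distribˡ h f g k = R.trans (⊛-comm h (f ⊕ g) k)
  (R.trans (⊛-distribʳ h f g k) (R.+-cong (⊛-comm f h k) (⊛-comm g h k)))

⊛-scale : ∀ a f g k → ((λ i → a * f i) ⊛ g) k ≈ a * (f ⊛ g) k
⊛-scale a f g zero    = solve 3 (λ a f g → a :* f :* g :+ con 0 := a :* (f :* g :+ con 0)) R.refl a (f 0) (g 0)
⊛-scale a f g (suc k) = R.trans (R.+-congˡ (⊛-scale a (f ∘ suc) g k))
  (solve 4 (λ a f g u → a :* f :* g :+ a :* u := a :* (f :* g :+ u)) R.refl a (f 0) (g (suc k)) _)

⊛-assoc : ∀ f g h k → ((f ⊛ g) ⊛ h) k ≈ (f ⊛ (g ⊛ h)) k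
⊛-assoc f g h zero    = solve 3 (λ f g h → (f :* g :+ con 0) :* h :+ con 0 := f :* (g :* h :+ con 0) :+ con 0) R.refl (f 0) (g 0) (h 0)
⊛-assoc f g h (suc k) = begin
  (f 0 * g 0 + 0ℝ) * h (suc k) + (((λ i → f 0 * g (suc i)) ⊕ ((f ∘ suc) ⊛ g)) ⊛ h) k
    ≈⟨ R.+-congˡ (R.trans (⊛-distribʳ h (λ i → f 0 * g (suc i)) ((f ∘ suc) ⊛ g) k) (R.+-cong (⊛-scale (f 0) (g ∘ suc) h k) (⊛-assoc (f ∘ suc) g h k))) ⟩
  (f 0 * g 0 + 0ℝ) * h (suc k) + (f 0 * ((g ∘ suc) ⊛ h) k + ((f ∘ suc) ⊛ (g ⊛ h)) k)
    ≈⟨ solve 5 (λ f g h u v → (f :* g :+ con 0) :* h :+ (f :* u :+ v) := f :* (g :* h :+ u) :+ v) R.refl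
         (f 0) (g 0) (h (suc k)) _ _ ⟩
  f 0 * (g ⊛ h) (suc k) + ((f ∘ suc) ⊛ (g ⊛ h)) k ∎

0⊛ : ∀ f k → (0ₛ ⊛ f) k ≈ 0ℝ
0⊛ f zero    = R.trans (R.+-congʳ (R.zeroˡ _)) (R.+-identityʳ 0ℝ)
0⊛ f (suc k) = R.trans (R.+-cong (R.zeroˡ _) (0⊛ f k)) (R.+-identityʳ 0ℝ)

const-⊛ : ∀ a f k → (const a ⊛ f) k ≈ a * f k
const-⊛ a f zero    = R.+-identityʳ _
const-⊛ a f (suc k) = R.trans (R.+-congˡ (0⊛ f k)) (R.+-identityʳ _)

⊛-const : ∀ f a k → (f ⊛ const a) k ≈ f k * a
⊛-const f a k = R.trans (⊛-comm f (const a) k) (R.trans (const-⊛ a f k) (R.*-comm a (f k)))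

const-* : ∀ a b k → (const a ⊛ const b) k ≈ const (a * b) k
const-* a b zero    = R.+-identityʳ _
const-* a b (suc k) = R.trans (const-⊛ a (const b) (suc k)) (R.zeroʳ a)

PowerSeries : ℕ → CommutativeRing 0ℓ 0ℓ
PowerSeries E = record
  { Carrier = ℕ → ℝ
  ; _≈_ = _≈[ E ]_
  ; _+_ = _⊕_
  ; _*_ = _⊛_
  ; -_ = ⊖_
  ; 0# = 0ₛ
  ; 1# = const 1ℝ
  ; isCommutativeRing = record
    { isRing = record
      { +-isAbelianGroup = record
        { isGroup = record
          { isMonoid = record
            { isSemigroup = record
              { isMagma = record
                { isEquivalence = record
                  { refl  = mk≈[] λ _ _ → R.refl
                  ; sym   = λ e → mk≈[] λ k le → R.sym (coefficient e k le)
                  ; trans = λ e e′ → mk≈[] λ k le → R.trans (coefficient e k le) (coefficient e′ k le)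
                  }
                ; ∙-cong = λ e e′ → mk≈[] λ k le → R.+-cong (coefficient e k le) (coefficient e′ k le)
                }
              ; assoc = λ f g h → mk≈[] λ k _ → R.+-assoc (f k) (g k) (h k)
              }
            ; identity = (λ f → mk≈[] λ k _ → R.+-identityˡ (f k)) , (λ f → mk≈[] λ k _ → R.+-identityʳ (f k))
            }
          ; inverse = (λ f → mk≈[] λ k _ → R.-‿inverseˡ (f k)) , (λ f → mk≈[] λ k _ → R.-‿inverseʳ (f k))
          ; ⁻¹-cong = λ e → mk≈[] λ k le → R.-‿cong (coefficient e k le)
          }
        ; comm = λ f g → mk≈[] λ k _ → R.+-comm (f k) (g k)
        }
      ; *-cong = λ e e′ → mk≈[] λ k le → ⊛-cong k (λ i le′ → coefficient e i (ℕ.≤-trans le′ le))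
                                                 (λ i le′ → coefficient e′ i (ℕ.≤-trans le′ le))
      ; *-assoc = λ f g h → mk≈[] λ k _ → ⊛-assoc f g h k
      ; *-identity = (λ f → mk≈[] λ k _ → R.trans (const-⊛ 1ℝ f k) (R.*-identityˡ (f k)))
                   , (λ f → mk≈[] λ k _ → R.trans (⊛-const f 1ℝ k) (R.*-identityʳ (f k)))
      ; distrib = (λ h f g → mk≈[] λ k _ → ⊛-distribˡ h f g k) , (λ h f g → mk≈[] λ k _ → ⊛-distribʳ h f g k)
      }
    ; *-comm = λ f g → mk≈[] λ k _ → ⊛-comm f g k
    }
  }

-- Multiplication by z^d.
shift : ℕ → (ℕ → ℝ) → ℕ → ℝ
shift zero    f k       = f k
shift (suc d) f zero    = 0ℝ
shift (suc d) f (suc k) = shift d f k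

monomial : ℕ → ℕ → ℝ
monomial d = shift d (const 1ℝ)

monomial-⊛ : ∀ d f k → (monomial d ⊛ f) k ≈ shift d f k
monomial-⊛ zero    f k       = R.trans (const-⊛ 1ℝ f k) (R.*-identityˡ (f k))
monomial-⊛ (suc d) f zero    = R.trans (R.+-congʳ (R.zeroˡ _)) (R.+-identityʳ 0ℝ)
monomial-⊛ (suc d) f (suc k) = R.trans (R.+-cong (R.zeroˡ _) (monomial-⊛ d f k)) (R.+-identityˡ _)

-- Newton's identity for h̃ and p̃

ℚ-suc : ∀ n → + suc n ℚ./ 1 ≡ 1ℚ ℚ.+ + n ℚ./ 1
ℚ-suc n = ℚ.toℚᵘ-injective (ℚᵘ.≃-trans (ℚ.toℚᵘ-fromℚᵘ (ℚᵘ.mkℚᵘ (+ suc n) 0))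
  (ℚᵘ.≃-sym (ℚᵘ.≃-trans (ℚ.toℚᵘ-homo-+ 1ℚ (+ n ℚ./ 1))
    (ℚᵘ.≃-trans (ℚᵘ.+-congʳ ℚᵘ.1ℚᵘ (ℚ.toℚᵘ-fromℚᵘ (ℚᵘ.mkℚᵘ (+ n) 0)))
      (ℚᵘ.*≡* (≡.cong (λ i → i ℤ.* (+ 1)) (≡.cong (λ i → (+ 1) ℤ.+ i) (ℤ.*-identityʳ (+ n)))))))))

ℚ-inverse : ∀ n .{{_ : ℕ.NonZero n}} → (+ n ℚ./ 1) ℚ.* (+ 1 ℚ./ n) ≡ 1ℚ
ℚ-inverse (suc n) = ℚ.toℚᵘ-injective (ℚᵘ.≃-trans (ℚ.toℚᵘ-homo-* (+ suc n ℚ./ 1) (+ 1 ℚ./ suc n))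
  (ℚᵘ.≃-trans (ℚᵘ.*-cong (ℚ.toℚᵘ-fromℚᵘ (ℚᵘ.mkℚᵘ (+ suc n) 0)) (ℚ.toℚᵘ-fromℚᵘ (ℚᵘ.mkℚᵘ (+ 1) n)))
    (ℚᵘ.*≡* (≡.trans (ℤ.*-identityʳ ((+ suc n) ℤ.* (+ 1))) (≡.trans (ℤ.*-identityʳ (+ suc n))
      (≡.sym (≡.trans (ℤ.*-identityˡ (+ suc (n ℕ.+ 0))) (≡.cong (λ k → + suc k) (ℕ.+-identityʳ n)))))))))

fromℕ-suc : ∀ n → fromℕ (suc n) ≈ 1ℝ + fromℕ n
fromℕ-suc n = R.trans (R.reflexive (≡.cong fromℚ (ℚ-suc n))) (R.sym (ConvergenceLemmas.fromℚ-+ 1ℚ _))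

fromℕ-+ : ∀ m n → fromℕ (m ℕ.+ n) ≈ fromℕ m + fromℕ n
fromℕ-+ zero    n = R.sym (R.+-identityˡ _)
fromℕ-+ (suc m) n = R.trans (fromℕ-suc (m ℕ.+ n)) (R.trans (R.+-congˡ (fromℕ-+ m n))
  (R.trans (R.sym (R.+-assoc _ _ _)) (R.+-congʳ (R.sym (fromℕ-suc m)))))

fromℕ-* : ∀ m n → fromℕ (m ℕ.* n) ≈ fromℕ m * fromℕ n
fromℕ-* zero    n = R.sym (R.zeroˡ _)
fromℕ-* (suc m) n = R.trans (fromℕ-+ n (m ℕ.* n)) (R.trans (R.+-congˡ (fromℕ-* m n))
  (R.trans (solve 2 (λ m n → n :+ m :* n := (con 1 :+ m) :* n) R.refl (fromℕ m) (fromℕ n)) (R.*-congʳ (R.sym (fromℕ-suc m)))))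

reciprocal : ∀ n .{{_ : ℕ.NonZero n}} → ℝ
reciprocal n = fromℚ (+ 1 ℚ./ n)

fromℕ-reciprocal : ∀ n .{{_ : ℕ.NonZero n}} → fromℕ n * reciprocal n ≈ 1ℝ
fromℕ-reciprocal n = R.trans (ConvergenceLemmas.fromℚ-* _ _) (R.reflexive (≡.cong fromℚ (ℚ-inverse n)))

fromℕ-cancelˡ : ∀ n .{{_ : ℕ.NonZero n}} {x y} → fromℕ n * x ≈ fromℕ n * y → x ≈ y
fromℕ-cancelˡ n {x} {y} e = begin
  x                                ≈⟨ unit x ⟨
  reciprocal n * (fromℕ n * x)     ≈⟨ R.*-congˡ e ⟩
  reciprocal n * (fromℕ n * y)     ≈⟨ unit y ⟩
  y                                ∎
  where
  unit : ∀ x → reciprocal n * (fromℕ n * x) ≈ x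
  unit x = R.trans (R.sym (R.*-assoc _ _ _))
    (R.trans (R.*-congʳ (R.trans (R.*-comm _ _) (fromℕ-reciprocal n))) (R.*-identityˡ x))

reciprocal-* : ∀ m n .{{_ : ℕ.NonZero n}} .{{_ : ℕ.NonZero (m ℕ.* n)}} →
               fromℕ m * reciprocal (m ℕ.* n) ≈ reciprocal n
reciprocal-* m n = fromℕ-cancelˡ n (begin
  fromℕ n * (fromℕ m * reciprocal (m ℕ.* n)) ≈⟨ solve 3 (λ n m r → n :* (m :* r) := m :* n :* r) R.refl _ _ _ ⟩
  fromℕ m * fromℕ n * reciprocal (m ℕ.* n)   ≈⟨ R.*-congʳ (fromℕ-* m n) ⟨
  fromℕ (m ℕ.* n) * reciprocal (m ℕ.* n)     ≈⟨ fromℕ-reciprocal (m ℕ.* n) ⟩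
  1ℝ                                         ≈⟨ fromℕ-reciprocal n ⟨
  fromℕ n * reciprocal n                     ∎)

-- Limits of real sequences and coefficientwise limits of power series.

module Limits where

  open ConvergenceLemmas
  open RationalLemmas

  ⟶-cong : ∀ {s t L} → (∀ n → s n ≈ t n) → s ⟶ L → t ⟶ L
  ⟶-cong {s} {t} {L} e c ε ε>0 = eventually
    (λ n le → ≤-trans (≈⇒≤ (EqualityLemmas.abs-cong (R.+-congʳ (R.sym (e n))))) le) (c ε ε>0)

  ⟶-const : ∀ x → (λ _ → x) ⟶ x
  ⟶-const x ε ε>0 = always λ _ → ≤-trans (≈⇒≤ (EqualityLemmas.abs-cong (R.-‿inverseʳ x)))
    (≤-trans (≈⇒≤ (nonneg-abs ≤-refl)) (fromℚ-nonneg ε>0))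

  ⟶-unique : ∀ {s L M} → s ⟶ L → s ⟶ M → L ≈ M
  ⟶-unique {s} {L} {M} c d = mk≈ λ ε ε>0 → close⇒ {L} {M} ε>0
    (let A , a = c (half (half ε)) (half>0 (half>0 ε>0))
         B , b = d (half (half ε)) (half>0 (half>0 ε>0))
         n = A ℕ.⊔ B
     in ≤-trans (triangle-- L (s n) M)
          (fromℚ-halves (≤-trans (≈⇒≤ (∣-∣-sym L (s n))) (a n (ℕ.m≤m⊔n A B))) (b n (ℕ.m≤n⊔m A B))))

  ⟶-+ : ∀ {s t L M} → s ⟶ L → t ⟶ M → (λ n → s n + t n) ⟶ (L + M)
  ⟶-+ {s} {t} {L} {M} c d ε ε>0 = eventually
    (λ n (p , q) → ≤-trans (∣-∣-+ (s n) (t n) L M) (fromℚ-halves p q))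
    (both (c (half ε) (half>0 ε>0)) (d (half ε) (half>0 ε>0)))

  difference-of-products : ∀ x y L M → x * y - L * M ≈ x * (y - M) + M * (x - L)
  difference-of-products x y L M = R.sym (begin
    x * (y - M) + M * (x - L)
      ≈⟨ solve 5 (λ x y m M l → x :* (y :+ m) :+ M :* (x :+ l) := (x :* y :+ M :* l) :+ (x :* m :+ x :* M)) R.refl x y (- M) M (- L) ⟩
    (x * y + M * (- L)) + (x * (- M) + x * M)
      ≈⟨ R.+-cong (R.+-congˡ (R.trans (R.sym (-‿distribʳ-* M L)) (R.-‿cong (R.*-comm M L))))
           (R.trans (R.sym (R.distribˡ x _ _)) (R.trans (R.*-congˡ (R.-‿inverseˡ M)) (R.zeroʳ x))) ⟩
    (x * y - L * M) + 0ℝ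
      ≈⟨ R.+-identityʳ _ ⟩
    x * y - L * M ∎)

  ⟶-* : ∀ {s t L M} → s ⟶ L → t ⟶ M → (λ n → s n * t n) ⟶ (L * M)
  ⟶-* {s} {t} {L} {M} c d ε ε>0 =
    -- `K` bounds all `s n` and `J` bounds `M`; `δ` and `η` then make each product in
    -- `difference-of-products` at most half of `ε`.
    let K , K>0 , bs = cauchy⇒bounded (convergent⇒cauchy (L , c))
        J , J>0 , bM = ℝ-bounded M
        δ , δ>0 , Kδ = divide K>0 (half>0 ε>0)
        η , η>0 , Jη = divide J>0 (half>0 ε>0)
    in eventually (λ n (p , q) → ≤-trans (≈⇒≤ (EqualityLemmas.abs-cong (difference-of-products (s n) (t n) L M)))
         (≤-trans (triangle _ _) (fromℚ-halves
           (≡.subst (λ ξ → ∣ s n * (t n - M) ∣ ≤ fromℚ ξ) Kδ (product (bs n) q))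
           (≡.subst (λ ξ → ∣ M * (s n - L) ∣ ≤ fromℚ ξ) Jη (product bM p)))))
       (both (c η η>0) (d δ δ>0))
    where
    product : ∀ {x y p q} → ∣ x ∣ ≤ fromℚ p → ∣ y ∣ ≤ fromℚ q → ∣ x * y ∣ ≤ fromℚ (p ℚ.* q)
    product {x} {y} {p} {q} a b = ≤-trans (≈⇒≤ (∣∣-* x y)) (≤-trans (*-monoˡ 0≤∣ x ∣ b)
      (≤-trans (*-monoʳ (≤-trans 0≤∣ y ∣ b) a) (≈⇒≤ (fromℚ-* p q))))

  ⟶-⊛ : ∀ {f g : ℕ → ℕ → ℝ} {F G} → (∀ k → (λ N → f N k) ⟶ F k) → (∀ k → (λ N → g N k) ⟶ G k) →
        ∀ k → (λ N → (f N ⊛ g N) k) ⟶ (F ⊛ G) k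
  ⟶-⊛ c d zero    = ⟶-+ (⟶-* (c 0) (d 0)) (⟶-const 0ℝ)
  ⟶-⊛ c d (suc k) = ⟶-+ (⟶-* (c 0) (d (suc k))) (⟶-⊛ (λ i → c (suc i)) d k)

-- Logarithmic derivatives of the factors of the generating function.

-- z f' = p f
LogDerivative : (ℕ → ℝ) → (ℕ → ℝ) → Set
LogDerivative f p = ∀ k → fromℕ k * f k ≈ (p ⊛ f) k

euler : (ℕ → ℝ) → ℕ → ℝ
euler f k = fromℕ k * f k

-- The Leibniz rule for the derivation `z d/dz`. Splitting `fromℕ (suc k)` as `1ℝ + fromℕ k` yields
-- one additional copy of `u`, which is what turns `euler (f ∘ suc)` into the tail of `euler f`.
euler-⊛ : ∀ f g k → fromℕ k * (f ⊛ g) k ≈ (euler f ⊛ g) k + (f ⊛ euler g) k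
euler-⊛ f g zero = solve 3 (λ n f g → n :* (f :* g :+ con 0) := (n :* f :* g :+ con 0) :+ (f :* (con 0 :* g) :+ con 0)) R.refl 0ℝ (f 0) (g 0)
euler-⊛ f g (suc k) = begin
  fromℕ (suc k) * (f 0 * g (suc k) + u)
    ≈⟨ solve 4 (λ n f g u → n :* (f :* g :+ u) := f :* (n :* g) :+ n :* u) R.refl (fromℕ (suc k)) (f 0) (g (suc k)) u ⟩
  f 0 * (fromℕ (suc k) * g (suc k)) + fromℕ (suc k) * u
    ≈⟨ R.+-congˡ (R.*-congʳ (fromℕ-suc k)) ⟩
  f 0 * (fromℕ (suc k) * g (suc k)) + (1ℝ + fromℕ k) * u
    ≈⟨ R.+-congˡ (R.trans (R.distribʳ u _ _) (R.+-cong (R.*-identityˡ u) (euler-⊛ (f ∘ suc) g k))) ⟩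
  f 0 * (fromℕ (suc k) * g (suc k)) + (u + ((euler (f ∘ suc) ⊛ g) k + ((f ∘ suc) ⊛ euler g) k))
    ≈⟨ solve 7 (λ a u v w n f g → a :+ (u :+ (v :+ w)) := (con 0 :* f :* g :+ (u :+ v)) :+ (a :+ w)) R.refl _ u _ _ 0ℝ (f 0) (g (suc k)) ⟩
  (0ℝ * f 0 * g (suc k) + (u + (euler (f ∘ suc) ⊛ g) k)) + (f 0 * (fromℕ (suc k) * g (suc k)) + ((f ∘ suc) ⊛ euler g) k)
    ≈⟨ R.+-congʳ (R.+-congˡ (⊛-distribʳ g (f ∘ suc) (euler (f ∘ suc)) k)) ⟨
  (0ℝ * f 0 * g (suc k) + (((f ∘ suc) ⊕ euler (f ∘ suc)) ⊛ g) k) + (f 0 * (fromℕ (suc k) * g (suc k)) + ((f ∘ suc) ⊛ euler g) k)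
    ≈⟨ R.+-congʳ (R.+-congˡ (⊛-congʳ g k λ i → R.trans (R.+-congʳ (R.sym (R.*-identityˡ (f (suc i)))))
         (R.trans (R.sym (R.distribʳ (f (suc i)) 1ℝ (fromℕ i))) (R.*-congʳ (R.sym (fromℕ-suc i)))))) ⟩
  (euler f ⊛ g) (suc k) + (f ⊛ euler g) (suc k) ∎
  where u = ((f ∘ suc) ⊛ g) k

logDerivative-⊛ : ∀ f g p q → LogDerivative f p → LogDerivative g q → LogDerivative (f ⊛ g) (p ⊕ q)
logDerivative-⊛ f g p q df dg k = begin
  fromℕ k * (f ⊛ g) k                   ≈⟨ euler-⊛ f g k ⟩
  (euler f ⊛ g) k + (f ⊛ euler g) k     ≈⟨ R.+-cong (⊛-congʳ g k df) (⊛-congˡ f k dg) ⟩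
  ((p ⊛ f) ⊛ g) k + (f ⊛ (q ⊛ g)) k     ≈⟨ R.+-cong (⊛-assoc p f g k) (R.sym (⊛-assoc f q g k)) ⟩
  (p ⊛ (f ⊛ g)) k + ((f ⊛ q) ⊛ g) k     ≈⟨ R.+-congˡ (⊛-congʳ g k (⊛-comm f q)) ⟩
  (p ⊛ (f ⊛ g)) k + ((q ⊛ f) ⊛ g) k     ≈⟨ R.+-congˡ (⊛-assoc q f g k) ⟩
  (p ⊛ (f ⊛ g)) k + (q ⊛ (f ⊛ g)) k     ≈⟨ ⊛-distribʳ (f ⊛ g) p q k ⟨
  ((p ⊕ q) ⊛ (f ⊛ g)) k                 ∎

-- The series `cz`, `bz/(1 + bz)` and `az/(1 - az)`. The exponent `2 + k` of the sign matches the
-- convention of `p̃`.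
exponentialLog linearLog geometricLog : ℝ → ℕ → ℝ
exponentialLog c zero    = 0ℝ
exponentialLog c (suc k) = const c k
linearLog b zero    = 0ℝ
linearLog b (suc k) = (- 1ℝ) ^ (2 ℕ.+ k) * b ^ suc k
geometricLog a zero    = 0ℝ
geometricLog a (suc k) = a ^ suc k

⊛-suc₀ : ∀ p f k → p 0 ≈ 0ℝ → (p ⊛ f) (suc k) ≈ ((p ∘ suc) ⊛ f) k
⊛-suc₀ p f k e = R.trans (R.+-congʳ (R.trans (R.*-congʳ e) (R.zeroˡ _))) (R.+-identityˡ _)

log-zero : ∀ p f → p 0 ≈ 0ℝ → fromℕ 0 * f 0 ≈ (p ⊛ f) 0
log-zero p f e = R.trans (R.*-congʳ (R.sym e)) (R.sym (R.+-identityʳ _))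

exponential-log : ∀ c → LogDerivative (exponential c) (exponentialLog c)
exponential-log c zero    = log-zero (exponentialLog c) (exponential c) R.refl
exponential-log c (suc k) = begin
  fromℕ (suc k) * (reciprocal (suc k !) {{suc k ℕ.!≢0}} * (c * c ^ k))
    ≈⟨ R.*-assoc _ _ _ ⟨
  fromℕ (suc k) * reciprocal (suc k !) {{suc k ℕ.!≢0}} * (c * c ^ k)
    ≈⟨ R.*-congʳ (reciprocal-* (suc k) (k !) {{k ℕ.!≢0}} {{suc k ℕ.!≢0}}) ⟩
  reciprocal (k !) {{k ℕ.!≢0}} * (c * c ^ k)
    ≈⟨ solve 3 (λ r c d → r :* (c :* d) := c :* (r :* d)) R.refl _ _ _ ⟩
  c * exponential c k
    ≈⟨ const-⊛ c (exponential c) k ⟨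
  (const c ⊛ exponential c) k
    ≈⟨ ⊛-suc₀ (exponentialLog c) (exponential c) k R.refl ⟨
  (exponentialLog c ⊛ exponential c) (suc k) ∎

geometric-⊛-geometric : ∀ a k → (geometric a ⊛ geometric a) k ≈ fromℕ (suc k) * a ^ k
geometric-⊛-geometric a zero    = R.+-identityʳ _
geometric-⊛-geometric a (suc k) = begin
  1ℝ * (a * a ^ k) + ((λ i → a * a ^ i) ⊛ geometric a) k
    ≈⟨ R.+-congˡ (R.trans (⊛-scale a (geometric a) (geometric a) k) (R.*-congˡ (geometric-⊛-geometric a k))) ⟩
  1ℝ * (a * a ^ k) + a * (fromℕ (suc k) * a ^ k)
    ≈⟨ solve 3 (λ a b n → con 1 :* (a :* b) :+ a :* (n :* b) := (con 1 :+ n) :* (a :* b)) R.refl _ _ _ ⟩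
  (1ℝ + fromℕ (suc k)) * (a * a ^ k)
    ≈⟨ R.*-congʳ (fromℕ-suc (suc k)) ⟨
  fromℕ (2 ℕ.+ k) * a ^ suc k ∎

geometric-log : ∀ a → LogDerivative (geometric a) (geometricLog a)
geometric-log a zero    = log-zero (geometricLog a) (geometric a) R.refl
geometric-log a (suc k) = R.sym (begin
  (geometricLog a ⊛ geometric a) (suc k)      ≈⟨ ⊛-suc₀ (geometricLog a) (geometric a) k R.refl ⟩
  ((λ i → a * a ^ i) ⊛ geometric a) k         ≈⟨ ⊛-scale a (geometric a) (geometric a) k ⟩
  a * (geometric a ⊛ geometric a) k           ≈⟨ R.*-congˡ (geometric-⊛-geometric a k) ⟩
  a * (fromℕ (suc k) * a ^ k)                 ≈⟨ solve 3 (λ a b n → a :* (n :* b) := n :* (a :* b)) R.refl _ _ _ ⟩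
  fromℕ (suc k) * (a * a ^ k)                 ∎)

-1*-1≈1 : - 1ℝ * (- 1ℝ) ≈ 1ℝ
-1*-1≈1 = R.trans (R.sym (-‿distribˡ-* 1ℝ (- 1ℝ))) (R.trans (R.-‿cong (R.*-identityˡ _)) (-‿involutive 1ℝ))

linear-log : ∀ b → LogDerivative (linear b) (linearLog b)
linear-log b zero    = log-zero (linearLog b) (linear b) R.refl
linear-log b (suc k) = R.sym (begin
  (linearLog b ⊛ linear b) (suc k)                   ≈⟨ ⊛-comm (linearLog b) (linear b) (suc k) ⟩
  1ℝ * linearLog b (suc k) + ((linear b ∘ suc) ⊛ linearLog b) k
    ≈⟨ R.+-cong (R.*-identityˡ _) (R.trans (⊛-congʳ (linearLog b) k tail) (const-⊛ b (linearLog b) k)) ⟩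
  linearLog b (suc k) + b * linearLog b k            ≈⟨ step k ⟩
  fromℕ (suc k) * linear b (suc k)                   ∎)
  where
  tail : ∀ i → linear b (suc i) ≈ const b i
  tail zero    = R.refl
  tail (suc i) = R.refl
  -- Multiplying `bz/(1 + bz)` by `1 + bz` cancels neighbouring terms; only the coefficient of `z`
  -- survives.
  step : ∀ k → linearLog b (suc k) + b * linearLog b k ≈ fromℕ (suc k) * linear b (suc k)
  step zero = begin
    (- 1ℝ * (- 1ℝ * 1ℝ)) * (b * 1ℝ) + b * 0ℝ
      ≈⟨ solve 2 (λ m b → (m :* (m :* con 1)) :* (b :* con 1) :+ b :* con 0 := m :* m :* b) R.refl (- 1ℝ) b ⟩
    - 1ℝ * (- 1ℝ) * b
      ≈⟨ R.*-congʳ -1*-1≈1 ⟩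
    1ℝ * b ∎
  step (suc k) = begin
    (- 1ℝ * s) * (b * c) + b * (s * c)
      ≈⟨ solve 4 (λ m s b c → (m :* s) :* (b :* c) :+ b :* (s :* c) := (m :+ con 1) :* (s :* (b :* c))) R.refl (- 1ℝ) s b c ⟩
    (- 1ℝ + 1ℝ) * (s * (b * c))
      ≈⟨ R.trans (R.*-congʳ (R.-‿inverseˡ 1ℝ)) (R.zeroˡ _) ⟩
    0ℝ
      ≈⟨ R.zeroʳ _ ⟨
    fromℕ (2 ℕ.+ k) * 0ℝ ∎
    where
    s = (- 1ℝ) ^ (2 ℕ.+ k)
    c = b ^ suc k

module Newton (P : Parameters) where

  open Parameters P
  open Limits

  partialLog : ℕ → ℕ → ℝ
  partialLog zero    = exponentialLog γ
  partialLog (suc N) = (linearLog (β N) ⊕ geometricLog (α N)) ⊕ partialLog N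

  partialProduct-log : ∀ N → LogDerivative (partialProduct P N) (partialLog N)
  partialProduct-log zero    = exponential-log γ
  partialProduct-log (suc N) =
    logDerivative-⊛ (linear (β N) ⊛ geometric (α N)) (partialProduct P N) (linearLog (β N) ⊕ geometricLog (α N)) (partialLog N)
      (logDerivative-⊛ (linear (β N)) (geometric (α N)) (linearLog (β N)) (geometricLog (α N))
        (linear-log (β N)) (geometric-log (α N)))
      (partialProduct-log N)

  partialLog-0 : ∀ N → partialLog N 0 ≈ 0ℝ
  partialLog-0 zero    = R.refl
  partialLog-0 (suc N) = R.trans (R.+-cong (R.+-identityˡ 0ℝ) (partialLog-0 N)) (R.+-identityˡ 0ℝ)

  partialLog-1 : ∀ N → γ + partialSums α N + partialSums β N ≈ partialLog N 1
  partialLog-1 zero    = R.trans (R.+-identityʳ _) (R.+-identityʳ γ)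
  partialLog-1 (suc N) = begin
    γ + (A + a) + (B + b)
      ≈⟨ solve 5 (λ g A a B b → g :+ (A :+ a) :+ (B :+ b) := (b :+ a :* con 1) :+ (g :+ A :+ B)) R.refl γ A a B b ⟩
    (b + a * 1ℝ) + (γ + A + B)
      ≈⟨ R.+-cong (R.+-congʳ (R.sym (R.trans (R.*-congʳ (R.trans (R.*-congˡ (R.*-identityʳ _)) -1*-1≈1)) (R.trans (R.*-identityˡ _) (R.*-identityʳ b)))))
           (partialLog-1 N) ⟩
    partialLog (suc N) 1 ∎
    where
    A = partialSums α N
    a = α N
    B = partialSums β N
    b = β N

  partialLog-≥2 : ∀ m N → partialSums (λ i → α i ^ (2 ℕ.+ m)) N + (- 1ℝ) ^ (3 ℕ.+ m) * partialSums (λ i → β i ^ (2 ℕ.+ m)) N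
                          ≈ partialLog N (2 ℕ.+ m)
  partialLog-≥2 m zero    = R.trans (R.+-identityˡ _) (R.zeroʳ _)
  partialLog-≥2 m (suc N) = begin
    (A + a) + s * (B + b)
      ≈⟨ solve 5 (λ A a s B b → (A :+ a) :+ s :* (B :+ b) := (s :* b :+ a) :+ (A :+ s :* B)) R.refl A a s B b ⟩
    (s * b + a) + (A + s * B)
      ≈⟨ R.+-congˡ (partialLog-≥2 m N) ⟩
    partialLog (suc N) (2 ℕ.+ m) ∎
    where
    A = partialSums (λ i → α i ^ (2 ℕ.+ m)) N
    a = α N ^ (2 ℕ.+ m)
    B = partialSums (λ i → β i ^ (2 ℕ.+ m)) N
    b = β N ^ (2 ℕ.+ m)
    s = (- 1ℝ) ^ (3 ℕ.+ m)

  partialLog⟶p̃ : ∀ k → (λ N → partialLog N k) ⟶ p̃ P k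
  partialLog⟶p̃ 0             = ⟶-cong (λ N → R.sym (partialLog-0 N)) (⟶-const 0ℝ)
  partialLog⟶p̃ 1             = ⟶-cong partialLog-1 (⟶-+ (⟶-+ (⟶-const γ) (proj₂ Σα)) (proj₂ Σβ))
  partialLog⟶p̃ (suc (suc m)) = ⟶-cong (partialLog-≥2 m)
    (⟶-+ (proj₂ (powers-summable α≥0 Σα (suc m)))
         (⟶-* (⟶-const _) (proj₂ (powers-summable β≥0 Σβ (suc m)))))

  -- Both sides are limits of one sequence, `k` times the coefficients of the partial products.
  -- Limits pass through `⊛` because each of its coefficients is a finite sum.
  newton : LogDerivative (h̃ P) (p̃ P)
  newton k = ⟶-unique
    (⟶-* (⟶-const (fromℕ k)) (proj₂ (coefficients-converge P k)))
    (⟶-cong (λ N → R.sym (partialProduct-log N k))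
      (⟶-⊛ partialLog⟶p̃ (λ k → proj₂ (coefficients-converge P k)) k))

  h̃-0 : h̃ P 0 ≈ 1ℝ
  h̃-0 = ⟶-unique (proj₂ (coefficients-converge P 0))
    (⟶-cong (λ N → R.trans (R.sym (R.*-identityʳ 1ℝ)) (PartialProductLemmas.constant-term P N)) (⟶-const 1ℝ))

-- Multiplication by power sums

private variable
  A B : Set

indicator-yes : ∀ (d : Dec A) → A → indicator d ≈ 1ℝ
indicator-yes (yes _) a = R.refl
indicator-yes (no ¬a) a = contradiction a ¬a

indicator-no : ∀ (d : Dec A) → ¬ A → indicator d ≈ 0ℝ
indicator-no (yes a) ¬a = contradiction a ¬a
indicator-no (no _)  ¬a = R.refl

indicator-⇔ : ∀ (d : Dec A) (d′ : Dec B) → (A → B) → (B → A) → indicator d ≈ indicator d′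
indicator-⇔ (yes a) d′ to from = R.sym (indicator-yes d′ (to a))
indicator-⇔ (no ¬a) d′ to from = R.sym (indicator-no d′ (¬a ∘ from))

indicator-× : ∀ (d : Dec A) (d′ : Dec B) → indicator (d ×-dec d′) ≈ indicator d * indicator d′
indicator-× (yes a) (yes b) = R.sym (R.*-identityˡ 1ℝ)
indicator-× (yes a) (no ¬b) = R.sym (R.zeroʳ _)
indicator-× (no ¬a) d′      = R.sym (R.zeroˡ _)

indicator-*-cong : ∀ (d : Dec A) {x y} → (A → x ≈ y) → indicator d * x ≈ indicator d * y
indicator-*-cong (yes a) e = R.*-congˡ (e a)
indicator-*-cong (no ¬a) e = R.trans (R.zeroˡ _) (R.sym (R.zeroˡ _))

∑-upTo-sucˡ : ∀ n f → ∑ (upTo (suc n)) f ≈ f 0 + ∑ (upTo n) (f ∘ suc)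
∑-upTo-sucˡ n f = R.+-congˡ (R.trans (R.reflexive (≡.cong (λ xs → ∑ xs f) (≡.sym (List.map-upTo suc n)))) (∑-map suc (upTo n) f))

∑-upTo-sucʳ : ∀ n f → ∑ (upTo (suc n)) f ≈ ∑ (upTo n) f + f n
∑-upTo-sucʳ n f = R.trans (R.reflexive (≡.cong (λ xs → ∑ xs f) (≡.sym (List.upTo-∷ʳ n))))
  (R.trans (∑-++ (upTo n) (n ∷ []) f) (R.+-congˡ (R.+-identityʳ (f n))))

∑-indicator : ∀ {n k} (f : ℕ → ℝ) → k ℕ.< n → ∑ (upTo n) (λ i → indicator (i ℕ.≟ k) * f i) ≈ f k
∑-indicator {n} {k} f k<n = R.trans
  (∑-single (Unique.upTo⁺ n) (∈.∈-upTo⁺ k<n) λ i _ i≢k → R.trans (R.*-congʳ (indicator-no (i ℕ.≟ k) i≢k)) (R.zeroˡ _))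
  (R.trans (R.*-congʳ (indicator-yes (k ℕ.≟ k) ≡.refl)) (R.*-identityˡ _))

⊛-as-∑ : ∀ f g k → (f ⊛ g) k ≈ ∑ (upTo (suc k)) (λ i → f i * g (k ∸ i))
⊛-as-∑ f g zero    = R.refl
⊛-as-∑ f g (suc k) = R.trans (R.+-congˡ (⊛-as-∑ (f ∘ suc) g k)) (R.sym (∑-upTo-sucˡ (suc k) _))

∑-shift : ∀ k g e → ∑ (upTo (suc e)) (λ i → indicator (i ℕ.≟ k) * g (e ∸ i)) ≈ shift k g e
∑-shift zero    g e       = ∑-indicator {suc e} (λ i → g (e ∸ i)) (s≤s z≤n)
∑-shift (suc k) g zero    = R.trans (R.+-identityʳ _) (R.zeroˡ _)
∑-shift (suc k) g (suc e) = R.trans (∑-upTo-sucˡ (suc e) _) (R.trans (R.+-cong (R.zeroˡ _)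
  (R.trans (∑-cong (upTo (suc e)) λ i _ → R.*-congʳ (indicator-⇔ (suc i ℕ.≟ suc k) (i ℕ.≟ k) ℕ.suc-injective (≡.cong suc)))
    (∑-shift k g e))) (R.+-identityˡ _))

shift-shift : ∀ k l g e → shift k (shift l g) e ≡ shift (k ℕ.+ l) g e
shift-shift zero    l g e       = ≡.refl
shift-shift (suc k) l g zero    = ≡.refl
shift-shift (suc k) l g (suc e) = shift-shift k l g e

shift-cong : ∀ k {f g} e → (∀ i → i ℕ.+ k ≡ e → f i ≈ g i) → shift k f e ≈ shift k g e
shift-cong zero    e       eq = eq e (ℕ.+-identityʳ e)
shift-cong (suc k) zero    eq = R.refl
shift-cong (suc k) (suc e) eq = shift-cong k e λ i p → eq i (≡.trans (ℕ.+-suc i k) (≡.cong suc p))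

shift-+ : ∀ k f g e → shift k (f ⊕ g) e ≈ shift k f e + shift k g e
shift-+ zero    f g e       = R.refl
shift-+ (suc k) f g zero    = R.sym (R.+-identityˡ _)
shift-+ (suc k) f g (suc e) = shift-+ k f g e

shift-* : ∀ k c f e → shift k (λ i → c * f i) e ≈ c * shift k f e
shift-* zero    c f e       = R.refl
shift-* (suc k) c f zero    = R.sym (R.zeroʳ c)
shift-* (suc k) c f (suc e) = shift-* k c f e

shift-0 : ∀ k e → shift k 0ₛ e ≈ 0ℝ
shift-0 zero    e       = R.refl
shift-0 (suc k) zero    = R.refl
shift-0 (suc k) (suc e) = shift-0 k e

-- Multiplication by the power sum x₁^k + x₂^k + ⋯.
times-p : ℕ → Series → Series
times-p k f []      = 0ℝ
times-p k f (e ∷ μ) = shift k (λ i → f (i ∷ μ)) e + times-p k (λ ρ → f (e ∷ ρ)) μ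

-- Only monomials whose degree is lower by `k` are consulted. This lets an induction on the degree
-- pass through `times-p`, and it fixes the size of the partitions over which `expansion` sums.
times-p-cong : ∀ k {f g} μ → (∀ ρ → sumℕ ρ ℕ.+ k ≡ sumℕ μ → f ρ ≈ g ρ) → times-p k f μ ≈ times-p k g μ
times-p-cong k []      eq = R.refl
times-p-cong k (e ∷ μ) eq = R.+-cong
  (shift-cong k e λ i p → eq (i ∷ μ) (≡.trans (rearrange i (sumℕ μ) k) (≡.cong (ℕ._+ sumℕ μ) p)))
  (times-p-cong k μ λ ρ p → eq (e ∷ ρ) (≡.trans (ℕ.+-assoc e (sumℕ ρ) k) (≡.cong (e ℕ.+_) p)))
  where
  open ℕ.+-*-Solver renaming (solve to solveℕ; _:+_ to _⊞_; _:=_ to _≔_)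
  rearrange : ∀ i s k → i ℕ.+ s ℕ.+ k ≡ i ℕ.+ k ℕ.+ s
  rearrange = solveℕ 3 (λ i s k → i ⊞ s ⊞ k ≔ i ⊞ k ⊞ s) ≡.refl

times-p-+ : ∀ k f g μ → times-p k (λ ρ → f ρ + g ρ) μ ≈ times-p k f μ + times-p k g μ
times-p-+ k f g []      = R.sym (R.+-identityˡ _)
times-p-+ k f g (e ∷ μ) = R.trans
  (R.+-cong (shift-+ k (λ i → f (i ∷ μ)) (λ i → g (i ∷ μ)) e) (times-p-+ k (λ ρ → f (e ∷ ρ)) (λ ρ → g (e ∷ ρ)) μ))
  (solve 4 (λ a b c d → (a :+ b) :+ (c :+ d) := (a :+ c) :+ (b :+ d)) R.refl _ _ _ _)

times-p-* : ∀ k c f μ → times-p k (λ ρ → c * f ρ) μ ≈ c * times-p k f μ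
times-p-* k c f []      = R.sym (R.zeroʳ c)
times-p-* k c f (e ∷ μ) = R.trans
  (R.+-cong (shift-* k c (λ i → f (i ∷ μ)) e) (times-p-* k c (λ ρ → f (e ∷ ρ)) μ)) (R.sym (R.distribˡ c _ _))

times-p-0 : ∀ k μ → times-p k (λ _ → 0ℝ) μ ≈ 0ℝ
times-p-0 k []      = R.refl
times-p-0 k (e ∷ μ) = R.trans (R.+-cong (shift-0 k e) (times-p-0 k μ)) (R.+-identityˡ _)

times-p-∑ : ∀ k (xs : List A) (f : A → Series) μ → times-p k (λ ρ → ∑ xs (λ x → f x ρ)) μ ≈ ∑ xs (λ x → times-p k (f x) μ)
times-p-∑ k []       f μ = times-p-0 k μ
times-p-∑ k (x ∷ xs) f μ = R.trans (times-p-+ k (f x) (λ ρ → ∑ xs (λ x → f x ρ)) μ) (R.+-congˡ (times-p-∑ k xs f μ))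

times-p-shift : ∀ k l (f : ℕ → Series) e μ →
  times-p k (λ ρ → shift l (λ i → f i ρ) e) μ ≈ shift l (λ i → times-p k (f i) μ) e
times-p-shift k zero    f e       μ = R.refl
times-p-shift k (suc l) f zero    μ = times-p-0 k μ
times-p-shift k (suc l) f (suc e) μ = times-p-shift k l f e μ

-- Two shifts of the first exponent add up, the mixed terms `X k l` and `X l k` change places, and
-- the remaining variables are handled by induction. This makes `powerSums` independent of the order
-- of the parts without any algebra of `⊗`.
times-p-comm : ∀ k l f μ → times-p k (times-p l f) μ ≈ times-p l (times-p k f) μ
times-p-comm k l f []      = R.refl
times-p-comm k l f (e ∷ μ) = begin
  shift k (λ i → shift l g i + times-p l (λ ρ → f (i ∷ ρ)) μ) e + times-p k (λ ρ → shift l (λ i → f (i ∷ ρ)) e + times-p l f′ ρ) μ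
    ≈⟨ expand k l ⟩
  (shift k (shift l g) e + X k l) + (X l k + times-p k (times-p l f′) μ)
    ≈⟨ R.+-cong (R.+-congʳ (R.reflexive (≡.trans (shift-shift k l g e)
         (≡.trans (≡.cong (λ n → shift n g e) (ℕ.+-comm k l)) (≡.sym (shift-shift l k g e))))))
         (R.+-congˡ (times-p-comm k l f′ μ)) ⟩
  (shift l (shift k g) e + X k l) + (X l k + times-p l (times-p k f′) μ)
    ≈⟨ solve 4 (λ a b c d → (a :+ b) :+ (c :+ d) := (a :+ c) :+ (b :+ d)) R.refl _ _ _ _ ⟩
  (shift l (shift k g) e + X l k) + (X k l + times-p l (times-p k f′) μ)
    ≈⟨ expand l k ⟨
  times-p l (times-p k f) (e ∷ μ) ∎
  where
  g : ℕ → ℝ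
  g i = f (i ∷ μ)
  f′ : Series
  f′ ρ = f (e ∷ ρ)
  X : ℕ → ℕ → ℝ
  X k l = shift k (λ i → times-p l (λ ρ → f (i ∷ ρ)) μ) e
  expand : ∀ k l → times-p k (times-p l f) (e ∷ μ) ≈
    (shift k (shift l g) e + X k l) + (X l k + times-p k (times-p l f′) μ)
  expand k l = R.+-cong (shift-+ k (shift l g) (λ i → times-p l (λ ρ → f (i ∷ ρ)) μ) e)
    (R.trans (times-p-+ k (λ ρ → shift l (λ i → f (i ∷ ρ)) e) (times-p l f′) μ)
      (R.+-congʳ (times-p-shift k l (λ i ρ → f (i ∷ ρ)) e μ)))

⊗-∷ : ∀ f g e μ → (f ⊗ g) (e ∷ μ) ≈ ∑ (upTo (suc e)) (λ i → ((λ ν → f (i ∷ ν)) ⊗ (λ ρ → g (e ∸ i ∷ ρ))) μ)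
⊗-∷ f g e μ = ∑-cartesianProductWith _ (upTo (suc e)) (factorizations μ) (λ (ν , ρ) → f ν * g ρ)

⊗-linearˡ : ∀ a f b g h μ → ((λ ν → a * f ν + b * g ν) ⊗ h) μ ≈ a * (f ⊗ h) μ + b * (g ⊗ h) μ
⊗-linearˡ a f b g h μ = R.trans
  (∑-cong (factorizations μ) λ (ν , ρ) _ →
    solve 5 (λ a f b g h → (a :* f :+ b :* g) :* h := a :* (f :* h) :+ b :* (g :* h)) R.refl a (f ν) b (g ν) (h ρ))
  (R.trans (∑-+ (factorizations μ) _ _)
    (R.+-cong (R.sym (∑-*ˡ (factorizations μ) a _)) (R.sym (∑-*ˡ (factorizations μ) b _))))

one-∷ : ∀ e μ → one (e ∷ μ) ≈ indicator (e ℕ.≟ 0) * one μ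
one-∷ e μ = R.trans
  (indicator-⇔ (all? (ℕ._≟ 0) (e ∷ μ)) ((e ℕ.≟ 0) ×-dec all? (ℕ._≟ 0) μ) (λ { (p ∷ ps) → p , ps }) (λ (p , ps) → p ∷ ps))
  (indicator-× (e ℕ.≟ 0) (all? (ℕ._≟ 0) μ))

one-⊗ : ∀ f μ → (one ⊗ f) μ ≈ f μ
one-⊗ f []      = R.trans (R.+-identityʳ _) (R.*-identityˡ _)
one-⊗ f (e ∷ μ) = begin
  (one ⊗ f) (e ∷ μ)
    ≈⟨ ⊗-∷ one f e μ ⟩
  ∑ (upTo (suc e)) (λ i → ((λ ν → one (i ∷ ν)) ⊗ (λ ρ → f (e ∸ i ∷ ρ))) μ)
    ≈⟨ ∑-cong (upTo (suc e)) (λ i _ → R.trans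
         (∑-cong (factorizations μ) λ (ν , ρ) _ → R.trans (R.*-congʳ (one-∷ i ν)) (R.*-assoc _ _ _))
         (R.trans (R.sym (∑-*ˡ (factorizations μ) (indicator (i ℕ.≟ 0)) _))
           (R.*-congˡ (one-⊗ (λ ρ → f (e ∸ i ∷ ρ)) μ)))) ⟩
  ∑ (upTo (suc e)) (λ i → indicator (i ℕ.≟ 0) * f (e ∸ i ∷ μ))
    ≈⟨ ∑-shift 0 (λ i → f (i ∷ μ)) e ⟩
  f (e ∷ μ) ∎

-- From here on `⊗` is replaced by the operators `times-p`, one for each part.
powerSum-⊗ : ∀ k f μ → (powerSum k ⊗ f) μ ≈ times-p k f μ
powerSum-⊗ k f []      = R.trans (R.+-identityʳ _) (R.zeroˡ _)
powerSum-⊗ k f (e ∷ μ) = begin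
  (powerSum k ⊗ f) (e ∷ μ)
    ≈⟨ ⊗-∷ (powerSum k) f e μ ⟩
  ∑ (upTo (suc e)) (λ i → ((λ ν → indicator (i ℕ.≟ k) * one ν + indicator (i ℕ.≟ 0) * powerSum k ν) ⊗ (λ ρ → f (e ∸ i ∷ ρ))) μ)
    ≈⟨ ∑-cong (upTo (suc e)) (λ i _ → R.trans (⊗-linearˡ _ one _ (powerSum k) (λ ρ → f (e ∸ i ∷ ρ)) μ)
         (R.+-cong (R.*-congˡ (one-⊗ (λ ρ → f (e ∸ i ∷ ρ)) μ)) (R.*-congˡ (powerSum-⊗ k (λ ρ → f (e ∸ i ∷ ρ)) μ)))) ⟩
  ∑ (upTo (suc e)) (λ i → indicator (i ℕ.≟ k) * f (e ∸ i ∷ μ) + indicator (i ℕ.≟ 0) * times-p k (λ ρ → f (e ∸ i ∷ ρ)) μ)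
    ≈⟨ ∑-+ (upTo (suc e)) _ _ ⟩
  ∑ (upTo (suc e)) (λ i → indicator (i ℕ.≟ k) * f (e ∸ i ∷ μ)) + ∑ (upTo (suc e)) (λ i → indicator (i ℕ.≟ 0) * times-p k (λ ρ → f (e ∸ i ∷ ρ)) μ)
    ≈⟨ R.+-cong (∑-shift k (λ i → f (i ∷ μ)) e) (∑-shift 0 (λ i → times-p k (λ ρ → f (i ∷ ρ)) μ) e) ⟩
  times-p k f (e ∷ μ) ∎

powerSums : List ℕ → Series
powerSums xs = foldr _⊗_ one (map powerSum xs)

powerSums-∷ : ∀ k xs μ → powerSums (k ∷ xs) μ ≈ times-p k (powerSums xs) μ
powerSums-∷ k xs μ = powerSum-⊗ k (powerSums xs) μ

powerSums-↭ : ∀ {xs ys} → xs ↭ ys → ∀ μ → powerSums xs μ ≈ powerSums ys μ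
powerSums-↭ ↭.refl         μ = R.refl
powerSums-↭ {_ ∷ xs} {_ ∷ ys} (prep x p) μ = R.trans (powerSums-∷ x xs μ)
  (R.trans (times-p-cong x μ λ ρ _ → powerSums-↭ p ρ) (R.sym (powerSums-∷ x ys μ)))
powerSums-↭ {_ ∷ _ ∷ xs} {_ ∷ _ ∷ ys} (swap x y p) μ = begin
  powerSums (x ∷ y ∷ xs) μ            ≈⟨ powerSums-∷ x (y ∷ xs) μ ⟩
  times-p x (powerSums (y ∷ xs)) μ    ≈⟨ times-p-cong x μ (λ ρ _ → powerSums-∷ y xs ρ) ⟩
  times-p x (times-p y (powerSums xs)) μ ≈⟨ times-p-comm x y (powerSums xs) μ ⟩
  times-p y (times-p x (powerSums xs)) μ
    ≈⟨ times-p-cong y μ (λ ρ _ → times-p-cong x ρ λ σ _ → powerSums-↭ p σ) ⟩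
  times-p y (times-p x (powerSums ys)) μ ≈⟨ times-p-cong y μ (λ ρ _ → powerSums-∷ x ys ρ) ⟨
  times-p y (powerSums (x ∷ ys)) μ    ≈⟨ powerSums-∷ y (x ∷ ys) μ ⟨
  powerSums (y ∷ x ∷ ys) μ            ∎
powerSums-↭ (↭.trans p q)  μ = R.trans (powerSums-↭ p μ) (powerSums-↭ q μ)

sum-zeros : ∀ {μ} → All (_≡ 0) μ → sumℕ μ ≡ 0
sum-zeros []       = ≡.refl
sum-zeros (p ∷ ps) = ≡.cong₂ ℕ._+_ p (sum-zeros ps)

powerSums-degree : ∀ xs μ → sumℕ μ ≢ sumℕ xs → powerSums xs μ ≈ 0ℝ
powerSums-degree []       μ ne = indicator-no (all? (ℕ._≟ 0) μ) (ne ∘ sum-zeros)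
powerSums-degree (x ∷ xs) μ ne = R.trans (powerSums-∷ x xs μ) (R.trans
  (times-p-cong x μ λ ρ p → powerSums-degree xs ρ λ q → ne (≡.trans (≡.sym p) (≡.trans (ℕ.+-comm _ x) (≡.cong (x ℕ.+_) q))))
  (times-p-0 x μ))

-- The expansion in power sums

partition-≡ : ∀ {ƛ κ} → parts ƛ ≡ parts κ → ƛ ≡ κ
partition-≡ {record { parts = xs ; decreasing = d ; positive = p }} {record { decreasing = d′ ; positive = p′ }} ≡.refl =
  ≡.cong₂ (λ d p → record { parts = xs ; decreasing = d ; positive = p })
    (Linked.irrelevant ℕ.≤-irrelevant d d′) (All.irrelevant ℕ.≤-irrelevant p p′)

_≟ₚ_ : DecidableEquality Partition
ƛ ≟ₚ κ with List.≡-dec ℕ._≟_ (parts ƛ) (parts κ)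
... | yes p = yes (partition-≡ p)
... | no ¬p = no λ { ≡.refl → ¬p ≡.refl }

∣_∣ₚ : Partition → ℕ
∣ ƛ ∣ₚ = sumℕ (parts ƛ)

empty : Partition
empty = record { parts = [] ; decreasing = [] ; positive = [] }

-- The value on a list that is not a partition is junk.
toPartition : List ℕ → Partition
toPartition xs with linked? ℕ._≥?_ xs | all? (0 ℕ.<?_) xs
... | yes d | yes p = record { parts = xs ; decreasing = d ; positive = p }
... | yes _ | no  _ = empty
... | no  _ | _     = empty

parts-toPartition : ∀ {xs} → Linked ℕ._≥_ xs → All (0 ℕ.<_) xs → parts (toPartition xs) ≡ xs
parts-toPartition {xs} d p with linked? ℕ._≥?_ xs | all? (0 ℕ.<?_) xs
... | yes _ | yes _ = ≡.refl
... | yes _ | no ¬p = contradiction p ¬p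
... | no ¬d | _     = contradiction d ¬d

toPartition-parts : ∀ ƛ → toPartition (parts ƛ) ≡ ƛ
toPartition-parts ƛ = partition-≡ (parts-toPartition (decreasing ƛ) (positive ƛ))

-- A partition of `N` has at most `N` parts, each at most `N`. Junk values and partitions of other
-- sizes also occur; `partitions` filters by size and removes repetitions.
candidates : ℕ → List Partition
candidates N = map toPartition (concatMap (words (suc N)) (upTo (suc N)))

∈-words : ∀ {n xs} → All (ℕ._< n) xs → xs ∈ words n (length xs)
∈-words []       = here ≡.refl
∈-words (p ∷ ps) = ∈.∈-cartesianProductWith⁺ _∷_ (∈.∈-upTo⁺ p) (∈-words ps)

words-∈ : ∀ {n} k {xs} → xs ∈ words n k → length xs ≡ k × All (ℕ._< n) xs
words-∈ zero    (here ≡.refl) = ≡.refl , []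
words-∈ {n} (suc k) m with ∈.∈-cartesianProductWith⁻ _∷_ (upTo n) (words n k) m
... | a , xs , a∈ , xs∈ , ≡.refl = let l , b = words-∈ k xs∈ in ≡.cong suc l , ∈.∈-upTo⁻ a∈ ∷ b

parts≤sum : ∀ xs → All (ℕ._≤ sumℕ xs) xs
parts≤sum []       = []
parts≤sum (x ∷ xs) = ℕ.m≤m+n x _ ∷ All.map (λ le → ℕ.≤-trans le (ℕ.m≤n+m _ x)) (parts≤sum xs)

length≤sum : ∀ {xs} → All (0 ℕ.<_) xs → length xs ℕ.≤ sumℕ xs
length≤sum []       = z≤n
length≤sum (p ∷ ps) = ℕ.+-mono-≤ p (length≤sum ps)

abstract

  partitions : ℕ → List Partition
  partitions N = deduplicate _≟ₚ_ (filter (λ ƛ → ∣ ƛ ∣ₚ ℕ.≟ N) (candidates N))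

  partitions-unique : ∀ N → Unique (partitions N)
  partitions-unique N = UniqueDec.deduplicate-! _≟ₚ_ _

  ∈-partitions⁺ : ∀ {N ƛ} → ∣ ƛ ∣ₚ ≡ N → ƛ ∈ partitions N
  ∈-partitions⁺ {N} {ƛ} ≡.refl = ∈.∈-deduplicate⁺ _≟ₚ_ {xs = filter (λ κ → ∣ κ ∣ₚ ℕ.≟ N) (candidates N)}
    (∈.∈-filter⁺ (λ κ → ∣ κ ∣ₚ ℕ.≟ N) {xs = candidates N}
      (≡.subst (_∈ candidates N) (toPartition-parts ƛ) (∈.∈-map⁺ toPartition
        (∈.∈-concatMap⁺ (words (suc N)) {xs = upTo (suc N)} (lose (∈.∈-upTo⁺ (s≤s (length≤sum (positive ƛ))))
          (∈-words (All.map s≤s (parts≤sum (parts ƛ)))))))) ≡.refl)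

  ∈-partitions⁻ : ∀ {N ƛ} → ƛ ∈ partitions N → ∣ ƛ ∣ₚ ≡ N
  ∈-partitions⁻ {N} m = proj₂ (∈.∈-filter⁻ (λ κ → ∣ κ ∣ₚ ℕ.≟ N) {xs = candidates N}
    (∈.∈-deduplicate⁻ _≟ₚ_ (filter (λ κ → ∣ κ ∣ₚ ℕ.≟ N) (candidates N)) m))

-- Inserting a part, and its effect on `z`.

≥-decTotalOrder = Flip.decTotalOrder ℕ.≤-decTotalOrder

module Descending = Sort ≥-decTotalOrder

decreasing-unique : ∀ {xs ys} → Linked ℕ._≥_ xs → Linked ℕ._≥_ ys → xs ↭ ys → xs ≡ ys
decreasing-unique d d′ p = Pointwise-≡⇒≡ (Sorted.↗↭↗⇒≋ (Flip.totalOrder ℕ.≤-totalOrder) d d′ (↭.↭⇒↭ₛ p))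

-- The inserted part is `suc k`, hence positive. For fixed `k` this is a bijection onto the
-- partitions that have a part `suc k`, the reindexing behind `expansion-part`.
insertPart : (k : ℕ) → Partition → Partition
insertPart k ƛ = record
  { parts      = Descending.sort (suc k ∷ parts ƛ)
  ; decreasing = Descending.sort-↗ (suc k ∷ parts ƛ)
  ; positive   = ↭.All-resp-↭ (↭.↭-sym (Descending.sort-↭ (suc k ∷ parts ƛ))) (s≤s z≤n ∷ positive ƛ)
  }

insertPart-↭ : ∀ k ƛ → parts (insertPart k ƛ) ↭ suc k ∷ parts ƛ
insertPart-↭ k ƛ = Descending.sort-↭ (suc k ∷ parts ƛ)

insertPart-injective : ∀ {k ƛ κ} → insertPart k ƛ ≡ insertPart k κ → ƛ ≡ κ
insertPart-injective {k} {ƛ} {κ} e = partition-≡ (decreasing-unique (decreasing ƛ) (decreasing κ) (↭.drop-∷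
  (↭.trans (↭.↭-sym (insertPart-↭ k ƛ)) (↭.trans (↭.↭-reflexive (≡.cong parts e)) (insertPart-↭ k κ)))))

insertPart-surjective : ∀ {k ƛ} → suc k ∈ parts ƛ → ∃ λ κ → insertPart k κ ≡ ƛ
insertPart-surjective {k} {ƛ} m with ∈.∈-∃++ m
... | as , bs , e = κ , partition-≡ (decreasing-unique (decreasing (insertPart k κ)) (decreasing ƛ)
      (↭.trans (insertPart-↭ k κ) (↭.trans (prep (suc k) (Descending.sort-↭ (as ++ bs)))
        (↭.trans (↭.↭-sym (↭.shift (suc k) as bs)) (↭.↭-reflexive (≡.sym e))))))
  where
  positive′ : All (0 ℕ.<_) (suc k ∷ as ++ bs)
  positive′ = ↭.All-resp-↭ (↭.trans (↭.↭-reflexive e) (↭.shift (suc k) as bs)) (positive ƛ)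
  κ : Partition
  κ = record
    { parts      = Descending.sort (as ++ bs)
    ; decreasing = Descending.sort-↗ (as ++ bs)
    ; positive   = ↭.All-resp-↭ (↭.↭-sym (Descending.sort-↭ (as ++ bs))) (All.tail positive′)
    }

count-↭ : ∀ i {xs ys} → xs ↭ ys → count i xs ≡ count i ys
count-↭ i p = ↭.↭-length (↭.filter-↭ (i ℕ.≟_) p)

count-∷-≡ : ∀ i xs → count i (i ∷ xs) ≡ suc (count i xs)
count-∷-≡ i xs = ≡.cong length (List.filter-accept (i ℕ.≟_) {xs = xs} ≡.refl)

count-∷-≢ : ∀ {i x} xs → i ≢ x → count i (x ∷ xs) ≡ count i xs
count-∷-≢ xs i≢x = ≡.cong length (List.filter-reject (_ ℕ.≟_) {xs = xs} i≢x)

count-absent : ∀ {i xs} → i ∉ xs → count i xs ≡ 0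
count-absent {i} {[]}     i∉ = ≡.refl
count-absent {i} {x ∷ xs} i∉ = ≡.trans (count-∷-≢ xs (i∉ ∘ here)) (count-absent (i∉ ∘ there))

zFactor : List ℕ → ℕ → ℕ
zFactor xs i = suc i ℕ.^ count (suc i) xs ℕ.* count (suc i) xs !

-- The range `N` is decoupled from the size of the partition, so that the products before and after
-- an insertion can be compared factor by factor.
zProduct : ℕ → List ℕ → ℕ
zProduct N xs = productℕ (map (zFactor xs) (upTo N))

zProduct-suc : ∀ N xs → zProduct (suc N) xs ≡ zProduct N xs ℕ.* zFactor xs N
zProduct-suc N xs = ≡.trans (≡.cong (productℕ ∘ map (zFactor xs)) (≡.sym (List.upTo-∷ʳ N)))
  (≡.trans (≡.cong productℕ (List.map-++ (zFactor xs) (upTo N) (N ∷ [])))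
    (≡.trans (ℕ.product-++ (map (zFactor xs) (upTo N)) (zFactor xs N ∷ [])) (≡.cong (zProduct N xs ℕ.*_) (ℕ.*-identityʳ _))))

zFactor-↭ : ∀ {xs ys} → xs ↭ ys → ∀ i → zFactor xs i ≡ zFactor ys i
zFactor-↭ p i = ≡.cong (λ m → suc i ℕ.^ m ℕ.* m !) (count-↭ (suc i) p)

zProduct-↭ : ∀ N {xs ys} → xs ↭ ys → zProduct N xs ≡ zProduct N ys
zProduct-↭ N p = ≡.cong productℕ (List.map-cong (zFactor-↭ p) (upTo N))

zFactor-≢ : ∀ {k} xs i → i ≢ k → zFactor (suc k ∷ xs) i ≡ zFactor xs i
zFactor-≢ xs i i≢k = ≡.cong (λ m → suc i ℕ.^ m ℕ.* m !) (count-∷-≢ xs (i≢k ∘ ℕ.suc-injective))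

zProduct-below : ∀ {k} N xs → N ℕ.≤ k → zProduct N (suc k ∷ xs) ≡ zProduct N xs
zProduct-below zero    xs le = ≡.refl
zProduct-below {k} (suc N) xs le = ≡.trans (zProduct-suc N (suc k ∷ xs)) (≡.trans
  (≡.cong₂ ℕ._*_ (zProduct-below N xs (ℕ.<⇒≤ le)) (zFactor-≢ xs N (ℕ.<⇒≢ le)))
  (≡.sym (zProduct-suc N xs)))

-- Insertion affects only the factor of the size `suc k`: with `m` such parts before, the power
-- gains one `suc k` and the factorial gains `suc m`.
zProduct-above : ∀ {k} N xs → k ℕ.< N → zProduct N (suc k ∷ xs) ≡ suc k ℕ.* suc (count (suc k) xs) ℕ.* zProduct N xs
zProduct-above {k} (suc N) xs (s≤s k≤N) with ℕ.m≤n⇒m<n∨m≡n k≤N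
... | inj₁ k<N = ≡.trans (zProduct-suc N (suc k ∷ xs)) (≡.trans
  (≡.cong₂ ℕ._*_ (zProduct-above N xs k<N) (zFactor-≢ xs N (≡.≢-sym (ℕ.<⇒≢ k<N))))
  (≡.trans (ℕ.*-assoc (suc k ℕ.* suc (count (suc k) xs)) (zProduct N xs) (zFactor xs N))
    (≡.cong (suc k ℕ.* suc (count (suc k) xs) ℕ.*_) (≡.sym (zProduct-suc N xs)))))
... | inj₂ ≡.refl = ≡.trans (zProduct-suc N (suc N ∷ xs)) (≡.trans
  (≡.cong₂ ℕ._*_ (zProduct-below N xs ℕ.≤-refl) (≡.cong (λ m → suc N ℕ.^ m ℕ.* m !) (count-∷-≡ (suc N) xs)))
  (≡.trans (rearrange (zProduct N xs) (suc N) (suc N ℕ.^ m) (suc m) (m !))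
    (≡.cong (suc N ℕ.* suc m ℕ.*_) (≡.sym (zProduct-suc N xs)))))
  where
  m = count (suc N) xs
  open ℕ.+-*-Solver renaming (solve to solveℕ; _:*_ to _⊠_; _:=_ to _≔_)
  rearrange : ∀ z n p c f → z ℕ.* (n ℕ.* p ℕ.* (c ℕ.* f)) ≡ n ℕ.* c ℕ.* (z ℕ.* (p ℕ.* f))
  rearrange = solveℕ 5 (λ z n p c f → z ⊠ (n ⊠ p ⊠ (c ⊠ f)) ≔ n ⊠ c ⊠ (z ⊠ (p ⊠ f))) ≡.refl

zProduct-extend : ∀ d ƛ → zProduct (d ℕ.+ ∣ ƛ ∣ₚ) (parts ƛ) ≡ z ƛ
zProduct-extend zero    ƛ = ≡.refl
zProduct-extend (suc d) ƛ = ≡.trans (zProduct-suc (d ℕ.+ ∣ ƛ ∣ₚ) (parts ƛ)) (≡.trans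
  (≡.cong₂ ℕ._*_ (zProduct-extend d ƛ) (≡.cong (λ m → suc (d ℕ.+ ∣ ƛ ∣ₚ) ℕ.^ m ℕ.* m !)
    (count-absent λ m → ℕ.<⇒≱ (s≤s (ℕ.m≤n+m ∣ ƛ ∣ₚ d)) (All.lookup (parts≤sum (parts ƛ)) m))))
  (ℕ.*-identityʳ (z ƛ)))

z-insertPart : ∀ k ƛ → z (insertPart k ƛ) ≡ suc k ℕ.* suc (count (suc k) (parts ƛ)) ℕ.* z ƛ
z-insertPart k ƛ = ≡.trans (zProduct-↭ ∣ insertPart k ƛ ∣ₚ (insertPart-↭ k ƛ)) (≡.trans
  (≡.cong (λ N → zProduct N (suc k ∷ parts ƛ)) (ℕ.sum-↭ (insertPart-↭ k ƛ)))
  (≡.trans (zProduct-above (suc k ℕ.+ ∣ ƛ ∣ₚ) (parts ƛ) (s≤s (ℕ.m≤m+n k ∣ ƛ ∣ₚ)))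
    (≡.cong (suc k ℕ.* suc (count (suc k) (parts ƛ)) ℕ.*_) (zProduct-extend (suc k) ƛ))))

reciprocal-cong : ∀ {m n} .{{_ : ℕ.NonZero m}} .{{_ : ℕ.NonZero n}} → m ≡ n → reciprocal m ≈ reciprocal n
reciprocal-cong ≡.refl = R.refl

1/z-insertPart : ∀ k ƛ → fromℕ (suc k ℕ.* suc (count (suc k) (parts ƛ))) * 1/z (insertPart k ƛ) ≈ 1/z ƛ
1/z-insertPart k ƛ = R.trans
  (R.*-congˡ (reciprocal-cong {{z≢0 (insertPart k ƛ)}} {{nonzero}} (z-insertPart k ƛ)))
  (reciprocal-* (suc k ℕ.* suc (count (suc k) (parts ƛ))) (z ƛ) {{z≢0 ƛ}} {{nonzero}})
  where
  nonzero : ℕ.NonZero (suc k ℕ.* suc (count (suc k) (parts ƛ)) ℕ.* z ƛ)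
  nonzero = ℕ.m*n≢0 _ (z ƛ) {{ℕ.m*n≢0 (suc k) (suc (count (suc k) (parts ƛ)))}} {{z≢0 ƛ}}

product-↭ : ∀ (f : ℕ → ℝ) {xs ys} → xs ↭ ys → foldr _*_ 1ℝ (map f xs) ≈ foldr _*_ 1ℝ (map f ys)
product-↭ f ↭.refl        = R.refl
product-↭ f (prep x p)    = R.*-congˡ (product-↭ f p)
product-↭ f (swap x y p)  = R.trans (R.*-congˡ (R.*-congˡ (product-↭ f p)))
  (solve 3 (λ a b c → a :* (b :* c) := b :* (a :* c)) R.refl _ _ _)
product-↭ f (↭.trans p q) = R.trans (product-↭ f p) (product-↭ f q)

sum-as-counts : ∀ N xs → All (ℕ._≤ N) xs → fromℕ (sumℕ xs) ≈ ∑ (upTo (suc N)) (λ k → fromℕ (k ℕ.* count k xs))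
sum-as-counts N []       []       = R.sym (∑-zero (upTo (suc N)) λ k _ → R.reflexive (≡.cong fromℕ (ℕ.*-zeroʳ k)))
sum-as-counts N (x ∷ xs) (p ∷ ps) = begin
  fromℕ (x ℕ.+ sumℕ xs)
    ≈⟨ fromℕ-+ x (sumℕ xs) ⟩
  fromℕ x + fromℕ (sumℕ xs)
    ≈⟨ R.+-cong (R.sym (∑-indicator fromℕ (s≤s p))) (sum-as-counts N xs ps) ⟩
  ∑ (upTo (suc N)) (λ k → indicator (k ℕ.≟ x) * fromℕ k) + ∑ (upTo (suc N)) (λ k → fromℕ (k ℕ.* count k xs))
    ≈⟨ ∑-+ (upTo (suc N)) _ _ ⟨
  ∑ (upTo (suc N)) (λ k → indicator (k ℕ.≟ x) * fromℕ k + fromℕ (k ℕ.* count k xs))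
    ≈⟨ ∑-cong (upTo (suc N)) (λ k _ → step k) ⟩
  ∑ (upTo (suc N)) (λ k → fromℕ (k ℕ.* count k (x ∷ xs))) ∎
  where
  step : ∀ k → indicator (k ℕ.≟ x) * fromℕ k + fromℕ (k ℕ.* count k xs) ≈ fromℕ (k ℕ.* count k (x ∷ xs))
  step k = decide (k ℕ.≟ x)
    where
    decide : Dec (k ≡ x) → indicator (k ℕ.≟ x) * fromℕ k + fromℕ (k ℕ.* count k xs) ≈ fromℕ (k ℕ.* count k (x ∷ xs))
    decide (yes k≡x) = R.trans (R.+-congʳ (R.trans (R.*-congʳ (indicator-yes (k ℕ.≟ x) k≡x)) (R.*-identityˡ _)))
      (R.trans (R.sym (fromℕ-+ k (k ℕ.* count k xs))) (R.reflexive (≡.cong fromℕ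
        (≡.trans (≡.sym (ℕ.*-suc k (count k xs))) (≡.cong (k ℕ.*_)
          (≡.sym (≡.trans (≡.cong (λ y → count k (y ∷ xs)) (≡.sym k≡x)) (count-∷-≡ k xs))))))))
    decide (no k≢x) = R.trans (R.+-congʳ (R.trans (R.*-congʳ (indicator-no (k ℕ.≟ x) k≢x)) (R.zeroˡ _)))
      (R.trans (R.+-identityˡ _) (R.reflexive (≡.cong (λ m → fromℕ (k ℕ.* m)) (≡.sym (count-∷-≢ xs k≢x)))))

-- The recursion on the degree.

module PowerSumExpansion (P : Parameters) where

  open Newton P

  G : Series
  G μ = foldr _*_ 1ℝ (map (h̃ P) μ)

  term : Partition → Series
  term ƛ = (1/z ƛ * p̃[ ƛ ] P) ∙ p[ ƛ ]

  expansion : Series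
  expansion μ = ∑ (partitions (sumℕ μ)) (λ ƛ → term ƛ μ)

  term-degree : ∀ ƛ μ → sumℕ μ ≢ ∣ ƛ ∣ₚ → term ƛ μ ≈ 0ℝ
  term-degree ƛ μ ne = R.trans (R.*-congˡ (powerSums-degree (parts ƛ) μ ne)) (R.zeroʳ _)

  -- The degree `e + sumℕ μ` splits by the Leibniz rule: `newton` serves the first variable and
  -- induction the others. `N` is merely an upper bound of the degree, so that all variables share
  -- one range of summation.
  G-newton : ∀ N μ → sumℕ μ ℕ.≤ N → fromℕ (sumℕ μ) * G μ ≈ ∑ (upTo (suc N)) (λ k → p̃ P k * times-p k G μ)
  G-newton N []      le = R.trans (R.zeroˡ _) (R.sym (∑-zero (upTo (suc N)) λ k _ → R.zeroʳ _))
  G-newton N (e ∷ μ) le = begin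
    fromℕ (e ℕ.+ sumℕ μ) * (h̃ P e * G μ)
      ≈⟨ R.*-congʳ (fromℕ-+ e (sumℕ μ)) ⟩
    (fromℕ e + fromℕ (sumℕ μ)) * (h̃ P e * G μ)
      ≈⟨ solve 4 (λ a b h g → (a :+ b) :* (h :* g) := a :* h :* g :+ h :* (b :* g)) R.refl _ _ _ _ ⟩
    fromℕ e * h̃ P e * G μ + h̃ P e * (fromℕ (sumℕ μ) * G μ)
      ≈⟨ R.+-cong (R.*-congʳ first) (R.*-congˡ (G-newton N μ (ℕ.≤-trans (ℕ.m≤n+m _ e) le))) ⟩
    ∑ (upTo (suc N)) (λ k → p̃ P k * shift k (h̃ P) e) * G μ + h̃ P e * ∑ (upTo (suc N)) (λ k → p̃ P k * times-p k G μ)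
      ≈⟨ R.+-cong (∑-*ʳ (upTo (suc N)) (G μ) _) (∑-*ˡ (upTo (suc N)) (h̃ P e) _) ⟩
    ∑ (upTo (suc N)) (λ k → p̃ P k * shift k (h̃ P) e * G μ) + ∑ (upTo (suc N)) (λ k → h̃ P e * (p̃ P k * times-p k G μ))
      ≈⟨ ∑-+ (upTo (suc N)) _ _ ⟨
    ∑ (upTo (suc N)) (λ k → p̃ P k * shift k (h̃ P) e * G μ + h̃ P e * (p̃ P k * times-p k G μ))
      ≈⟨ ∑-cong (upTo (suc N)) (λ k _ → R.trans
           (solve 5 (λ p s g h t → p :* s :* g :+ h :* (p :* t) := p :* (g :* s :+ h :* t)) R.refl _ _ _ _ _)
           (R.*-congˡ (R.+-cong
             (R.trans (R.sym (shift-* k (G μ) (h̃ P) e)) (shift-cong k e λ i _ → R.*-comm _ _))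
             (R.sym (times-p-* k (h̃ P e) G μ))))) ⟩
    ∑ (upTo (suc N)) (λ k → p̃ P k * times-p k G (e ∷ μ)) ∎
    where
    -- A delta function and an exchange of sums replace the subtraction `e ∸ i`, meaningful only for
    -- `i ≤ e`, by `shift`, which vanishes for `k > e`; the range can then reach up to `N`.
    first : fromℕ e * h̃ P e ≈ ∑ (upTo (suc N)) (λ k → p̃ P k * shift k (h̃ P) e)
    first = begin
      fromℕ e * h̃ P e
        ≈⟨ newton e ⟩
      (p̃ P ⊛ h̃ P) e
        ≈⟨ ⊛-as-∑ (p̃ P) (h̃ P) e ⟩
      ∑ (upTo (suc e)) (λ i → p̃ P i * h̃ P (e ∸ i))
        ≈⟨ ∑-cong (upTo (suc e)) (λ i m → R.sym (R.trans
             (∑-cong (upTo (suc N)) λ k _ → solve 3 (λ a b c → a :* (b :* c) := b :* (a :* c)) R.refl (p̃ P k) (indicator (k ℕ.≟ i)) (h̃ P (e ∸ i)))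
             (∑-indicator (λ k → p̃ P k * h̃ P (e ∸ i)) (ℕ.<-≤-trans (∈.∈-upTo⁻ m) (s≤s (ℕ.≤-trans (ℕ.m≤m+n e _) le)))))) ⟩
      ∑ (upTo (suc e)) (λ i → ∑ (upTo (suc N)) (λ k → p̃ P k * (indicator (k ℕ.≟ i) * h̃ P (e ∸ i))))
        ≈⟨ ∑-swap (upTo (suc e)) (upTo (suc N)) _ ⟩
      ∑ (upTo (suc N)) (λ k → ∑ (upTo (suc e)) (λ i → p̃ P k * (indicator (k ℕ.≟ i) * h̃ P (e ∸ i))))
        ≈⟨ ∑-cong (upTo (suc N)) (λ k _ → R.trans (R.sym (∑-*ˡ (upTo (suc e)) (p̃ P k) _)) (R.*-congˡ (R.trans
             (∑-cong (upTo (suc e)) λ i _ → R.*-congʳ (indicator-⇔ (k ℕ.≟ i) (i ℕ.≟ k) ≡.sym ≡.sym))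
             (∑-shift k (h̃ P) e)))) ⟩
      ∑ (upTo (suc N)) (λ k → p̃ P k * shift k (h̃ P) e) ∎

  term-insertPart : ∀ k ƛ μ → fromℕ (suc k ℕ.* count (suc k) (parts (insertPart k ƛ))) * term (insertPart k ƛ) μ
                            ≈ p̃ P (suc k) * times-p (suc k) (term ƛ) μ
  term-insertPart k ƛ μ = begin
    fromℕ (suc k ℕ.* count (suc k) (parts ƛ⁺)) * (1/z ƛ⁺ * p̃[ ƛ⁺ ] P * p[ ƛ⁺ ] μ)
      ≈⟨ R.*-cong (R.reflexive (≡.cong (λ m → fromℕ (suc k ℕ.* m))
           (≡.trans (count-↭ (suc k) (insertPart-↭ k ƛ)) (count-∷-≡ (suc k) (parts ƛ)))))
           (R.*-cong (R.*-congˡ (product-↭ (p̃ P) (insertPart-↭ k ƛ)))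
             (R.trans (powerSums-↭ (insertPart-↭ k ƛ) μ) (powerSums-∷ (suc k) (parts ƛ) μ))) ⟩
    fromℕ (suc k ℕ.* suc (count (suc k) (parts ƛ))) * (1/z ƛ⁺ * (p̃ P (suc k) * p̃[ ƛ ] P) * times-p (suc k) p[ ƛ ] μ)
      ≈⟨ solve 5 (λ n r p q t → n :* (r :* (p :* q) :* t) := p :* (n :* r :* q :* t)) R.refl _ _ _ _ _ ⟩
    p̃ P (suc k) * (fromℕ (suc k ℕ.* suc (count (suc k) (parts ƛ))) * 1/z ƛ⁺ * p̃[ ƛ ] P * times-p (suc k) p[ ƛ ] μ)
      ≈⟨ R.*-congˡ (R.*-congʳ (R.*-congʳ (1/z-insertPart k ƛ))) ⟩
    p̃ P (suc k) * (1/z ƛ * p̃[ ƛ ] P * times-p (suc k) p[ ƛ ] μ)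
      ≈⟨ R.*-congˡ (times-p-* (suc k) _ p[ ƛ ] μ) ⟨
    p̃ P (suc k) * times-p (suc k) (term ƛ) μ ∎
    where ƛ⁺ = insertPart k ƛ

  -- Partitions without a part `suc k` have multiplicity zero and drop out. The others are the
  -- images of `insertPart k`, to which `term-insertPart` applies.
  expansion-part : ∀ k μ → k ℕ.≤ sumℕ μ →
    ∑ (partitions (sumℕ μ)) (λ ƛ → fromℕ (k ℕ.* count k (parts ƛ)) * term ƛ μ) ≈ p̃ P k * times-p k expansion μ
  expansion-part zero    μ _  = R.trans (∑-zero (partitions (sumℕ μ)) λ ƛ _ → R.zeroˡ _) (R.sym (R.zeroˡ _))
  expansion-part (suc k) μ le = begin
    ∑ (partitions (sumℕ μ)) (λ ƛ → fromℕ (suc k ℕ.* count (suc k) (parts ƛ)) * term ƛ μ)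
      ≈⟨ ∑-⊆ _≟ₚ_ {f = λ ƛ → fromℕ (suc k ℕ.* count (suc k) (parts ƛ)) * term ƛ μ} (Unique.map⁺ insertPart-injective (partitions-unique N)) (partitions-unique (sumℕ μ)) inclusion vanish ⟨
    ∑ (map (insertPart k) (partitions N)) (λ ƛ → fromℕ (suc k ℕ.* count (suc k) (parts ƛ)) * term ƛ μ)
      ≈⟨ ∑-map (insertPart k) (partitions N) _ ⟩
    ∑ (partitions N) (λ ƛ → fromℕ (suc k ℕ.* count (suc k) (parts (insertPart k ƛ))) * term (insertPart k ƛ) μ)
      ≈⟨ ∑-cong (partitions N) (λ ƛ _ → term-insertPart k ƛ μ) ⟩
    ∑ (partitions N) (λ ƛ → p̃ P (suc k) * times-p (suc k) (term ƛ) μ)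
      ≈⟨ ∑-*ˡ (partitions N) _ _ ⟨
    p̃ P (suc k) * ∑ (partitions N) (λ ƛ → times-p (suc k) (term ƛ) μ)
      ≈⟨ R.*-congˡ (times-p-∑ (suc k) (partitions N) term μ) ⟨
    p̃ P (suc k) * times-p (suc k) (λ ρ → ∑ (partitions N) (λ ƛ → term ƛ ρ)) μ
      ≈⟨ R.*-congˡ (times-p-cong (suc k) μ λ ρ p → R.reflexive (≡.cong (λ n → ∑ (partitions n) (λ ƛ → term ƛ ρ))
           (≡.trans (≡.cong (_∸ suc k) (≡.sym p)) (ℕ.m+n∸n≡m (sumℕ ρ) (suc k))))) ⟩
    p̃ P (suc k) * times-p (suc k) expansion μ ∎
    where
    N = sumℕ μ ∸ suc k
    size : ∀ ƛ → ∣ insertPart k ƛ ∣ₚ ≡ suc k ℕ.+ ∣ ƛ ∣ₚ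
    size ƛ = ℕ.sum-↭ (insertPart-↭ k ƛ)
    inclusion : ∀ {ƛ} → ƛ ∈ map (insertPart k) (partitions N) → ƛ ∈ partitions (sumℕ μ)
    inclusion m with ∈.∈-map⁻ (insertPart k) m
    ... | ƛ , m′ , ≡.refl = ∈-partitions⁺ (≡.trans (size ƛ)
            (≡.trans (≡.cong (suc k ℕ.+_) (∈-partitions⁻ m′)) (ℕ.m+[n∸m]≡n le)))
    vanish : ∀ ƛ → ƛ ∈ partitions (sumℕ μ) → ƛ ∉ map (insertPart k) (partitions N) →
             fromℕ (suc k ℕ.* count (suc k) (parts ƛ)) * term ƛ μ ≈ 0ℝ
    vanish ƛ m ƛ∉ = R.trans (R.*-congʳ (R.reflexive (≡.cong fromℕ (≡.trans
      (≡.cong (suc k ℕ.*_) (count-absent absent)) (ℕ.*-zeroʳ (suc k)))))) (R.zeroˡ _)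
      where
      absent : suc k ∉ parts ƛ
      absent p with insertPart-surjective {k} {ƛ} p
      ... | κ , ≡.refl = ƛ∉ (∈.∈-map⁺ (insertPart k) (∈-partitions⁺ {ƛ = κ} (≡.sym (≡.trans
              (≡.cong (_∸ suc k) (≡.trans (≡.sym (∈-partitions⁻ m)) (size κ))) (ℕ.m+n∸m≡n (suc k) ∣ κ ∣ₚ)))))

  expansion-newton : ∀ μ → fromℕ (sumℕ μ) * expansion μ ≈ ∑ (upTo (suc (sumℕ μ))) (λ k → p̃ P k * times-p k expansion μ)
  expansion-newton μ = begin
    fromℕ N * expansion μ
      ≈⟨ ∑-*ˡ (partitions N) (fromℕ N) _ ⟩
    ∑ (partitions N) (λ ƛ → fromℕ N * term ƛ μ)
      ≈⟨ ∑-cong (partitions N) (λ ƛ m → R.trans (R.*-congʳ (R.trans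
           (R.reflexive (≡.cong fromℕ (≡.sym (∈-partitions⁻ m))))
           (sum-as-counts N (parts ƛ) (≡.subst (λ n → All (ℕ._≤ n) (parts ƛ)) (∈-partitions⁻ m) (parts≤sum (parts ƛ))))))
           (∑-*ʳ (upTo (suc N)) (term ƛ μ) _)) ⟩
    ∑ (partitions N) (λ ƛ → ∑ (upTo (suc N)) (λ k → fromℕ (k ℕ.* count k (parts ƛ)) * term ƛ μ))
      ≈⟨ ∑-swap (partitions N) (upTo (suc N)) _ ⟩
    ∑ (upTo (suc N)) (λ k → ∑ (partitions N) (λ ƛ → fromℕ (k ℕ.* count k (parts ƛ)) * term ƛ μ))
      ≈⟨ ∑-cong (upTo (suc N)) (λ k m → expansion-part k μ (ℕ.s≤s⁻¹ (∈.∈-upTo⁻ m))) ⟩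
    ∑ (upTo (suc N)) (λ k → p̃ P k * times-p k expansion μ) ∎
    where N = sumℕ μ

  expansion-zero : ∀ μ → sumℕ μ ≡ 0 → expansion μ ≈ G μ
  expansion-zero μ e = begin
    expansion μ
      ≈⟨ ∑-⊆ _≟ₚ_ {xs = empty ∷ []} {f = λ ƛ → term ƛ μ} ([] ∷ []) (partitions-unique (sumℕ μ)) (λ { (here ≡.refl) → ∈-partitions⁺ (≡.sym e) })
           (λ ƛ m ƛ∉ → contradiction (here (only ƛ (≡.trans (∈-partitions⁻ m) e))) ƛ∉) ⟨
    1/z empty * 1ℝ * one μ + 0ℝ
      ≈⟨ R.+-identityʳ _ ⟩
    1/z empty * 1ℝ * one μ
      ≈⟨ R.*-cong (R.trans (R.*-identityʳ _) (R.trans (R.sym (R.*-identityˡ _)) (fromℕ-reciprocal 1)))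
           (indicator-yes (all? (ℕ._≟ 0) μ) (zeros μ e)) ⟩
    1ℝ * 1ℝ
      ≈⟨ R.*-identityˡ 1ℝ ⟩
    1ℝ
      ≈⟨ product (zeros μ e) ⟨
    G μ ∎
    where
    zeros : ∀ μ → sumℕ μ ≡ 0 → All (_≡ 0) μ
    zeros []      e = []
    zeros (x ∷ μ) e = ℕ.m+n≡0⇒m≡0 x e ∷ zeros μ (ℕ.m+n≡0⇒n≡0 x e)
    only : ∀ ƛ → ∣ ƛ ∣ₚ ≡ 0 → ƛ ≡ empty
    only record { parts = []     ; decreasing = [] ; positive = [] } _ = ≡.refl
    only record { parts = suc x ∷ xs ; positive = s≤s z≤n ∷ _ } ()
    product : ∀ {μ} → All (_≡ 0) μ → G μ ≈ 1ℝ
    product []            = R.refl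
    product (≡.refl ∷ ps) = R.trans (R.*-cong h̃-0 (product ps)) (R.*-identityˡ 1ℝ)

  -- Strong induction on the degree: both series satisfy the same recursion, whose right side
  -- involves smaller degrees only, and the degree on the left can be cancelled unless it is zero.
  expansion≈G : ∀ μ → expansion μ ≈ G μ
  expansion≈G μ = bounded (suc (sumℕ μ)) μ ℕ.≤-refl
    where
    bounded : ∀ n μ → sumℕ μ ℕ.< n → expansion μ ≈ G μ
    by-degree : ∀ n μ m → sumℕ μ ≡ m → sumℕ μ ℕ.≤ n → expansion μ ≈ G μ
    bounded (suc n) μ (s≤s le) = by-degree n μ (sumℕ μ) ≡.refl le
    by-degree n μ zero    eq le = expansion-zero μ eq
    by-degree n μ (suc m) eq le = fromℕ-cancelˡ (suc m) (begin
      fromℕ (suc m) * expansion μ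
        ≡⟨ ≡.cong (λ k → fromℕ k * expansion μ) eq ⟨
      fromℕ (sumℕ μ) * expansion μ
        ≈⟨ expansion-newton μ ⟩
      ∑ (upTo (suc (sumℕ μ))) (λ k → p̃ P k * times-p k expansion μ)
        -- The index `k = 0` would not lower the degree; its term vanishes because `p̃ P 0` is `0ℝ`.
        ≈⟨ ∑-cong (upTo (suc (sumℕ μ))) (λ { zero _ → R.trans (R.zeroˡ _) (R.sym (R.zeroˡ _))
             ; (suc k) _ → R.*-congˡ (times-p-cong (suc k) μ λ ρ p → bounded n ρ
                 (ℕ.<-≤-trans (ℕ.<-≤-trans (ℕ.m<m+n (sumℕ ρ) (s≤s z≤n)) (ℕ.≤-reflexive p)) le)) }) ⟩
      ∑ (upTo (suc (sumℕ μ))) (λ k → p̃ P k * times-p k G μ)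
        ≈⟨ G-newton (sumℕ μ) μ ℕ.≤-refl ⟨
      fromℕ (sumℕ μ) * G μ
        ≡⟨ ≡.cong (λ k → fromℕ k * G μ) eq ⟩
      fromℕ (suc m) * G μ ∎)

  hasSum : HasSum term G
  hasSum μ = partitions (sumℕ μ) , partitions-unique (sumℕ μ) ,
    (λ ƛ ƛ∉ → term-degree ƛ μ λ e → ƛ∉ (∈-partitions⁺ (≡.sym e))) , expansion≈G μ

-- The Pieri rule for Jacobi–Trudi determinants

module Det = Determinants ℝ-commutativeRing

module JacobiTrudi (P : Parameters) where

  row : ℕ → ℕ → ℕ → ℝ
  row i a j = h̃ℤ P (+ a ℤ.- + i ℤ.+ + j)

  row-diagonal : ∀ i a j → row (suc i) (suc a) j ≡ row i a j
  row-diagonal i a j = ≡.cong (h̃ℤ P) (lemma (+ a) (+ i) (+ j))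
    where
    open ℤ.+-*-Solver renaming (solve to solveℤ; _:+_ to _⊞_; _:-_ to _⊟_; _:=_ to _≔_; con to conℤ)
    lemma : ∀ a i j → ((+ 1) ℤ.+ a) ℤ.- ((+ 1) ℤ.+ i) ℤ.+ j ≡ a ℤ.- i ℤ.+ j
    lemma = solveℤ 3 (λ a i j → (conℤ (+ 1) ⊞ a) ⊟ (conℤ (+ 1) ⊞ i) ⊞ j ≔ a ⊟ i ⊞ j) ≡.refl

  row-shift : ∀ i a j → row i (suc a) j ≡ row i a (suc j)
  row-shift i a j = ≡.cong (h̃ℤ P) (lemma (+ a) (+ i) (+ j))
    where
    open ℤ.+-*-Solver renaming (solve to solveℤ; _:+_ to _⊞_; _:-_ to _⊟_; _:=_ to _≔_; con to conℤ)
    lemma : ∀ a i j → ((+ 1) ℤ.+ a) ℤ.- i ℤ.+ j ≡ a ℤ.- i ℤ.+ ((+ 1) ℤ.+ j)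
    lemma = solveℤ 3 (λ a i j → (conℤ (+ 1) ⊞ a) ⊟ i ⊞ j ≔ a ⊟ i ⊞ (conℤ (+ 1) ⊞ j)) ≡.refl

  row-h̃ : ∀ i a → row i a i ≡ h̃ P a
  row-h̃ i a = ≡.cong (h̃ℤ P) (lemma (+ a) (+ i))
    where
    open ℤ.+-*-Solver renaming (solve to solveℤ; _:+_ to _⊞_; _:-_ to _⊟_; _:=_ to _≔_; con to conℤ)
    lemma : ∀ a i → a ℤ.- i ℤ.+ i ≡ a
    lemma = solveℤ 2 (λ a i → a ⊟ i ⊞ i ≔ a) ≡.refl

  row-zero : ∀ {i j} → j ℕ.< i → row i 0 j ≡ 0ℝ
  row-zero {suc i} {j} (s≤s le) = negative le
    where
    negative : ∀ {i j} → j ℕ.≤ i → h̃ℤ P (j ℤ.⊖ suc i) ≡ 0ℝ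
    negative z≤n            = ≡.refl
    negative (s≤s {j} {i} le) = ≡.trans (≡.cong (h̃ℤ P) (ℤ.[1+m]⊖[1+n]≡m⊖n j (suc i))) (negative le)

  rows : ℕ → List ℕ → List (ℕ → ℝ)
  rows i []      = []
  rows i (a ∷ ƛ) = row i a ∷ rows (suc i) ƛ

  -- The Jacobi-Trudi determinant for any list, since expanding a determinant row by row produces
  -- lists that need not be partitions.
  D : List ℕ → ℝ
  D ƛ = Det.detL (rows 0 ƛ) (upTo (length ƛ))

  rows-++ : ∀ i ƛ κ → rows i (ƛ ++ κ) ≡ rows i ƛ ++ rows (i ℕ.+ length ƛ) κ
  rows-++ i []      κ = ≡.cong (λ k → rows k κ) (≡.sym (ℕ.+-identityʳ i))
  rows-++ i (a ∷ ƛ) κ = ≡.cong (row i a ∷_) (≡.trans (rows-++ (suc i) ƛ κ)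
    (≡.cong (λ k → rows (suc i) ƛ ++ rows k κ) (≡.sym (ℕ.+-suc i (length ƛ)))))

  upTo-All : ∀ n → All (ℕ._< n) (upTo n)
  upTo-All n = All.tabulate ∈.∈-upTo⁻

  length-snoc : ∀ (ƛ : List ℕ) a → length (ƛ ++ a ∷ []) ≡ suc (length ƛ)
  length-snoc ƛ a = ≡.trans (List.length-++ ƛ) (ℕ.+-comm (length ƛ) 1)

  -- A part zero adds the bottom row `0, …, 0, h̃ 0`, and `h̃ 0` is 1. Padding a shape with zeros is
  -- therefore harmless.
  D-snoc-zero : ∀ ƛ → D (ƛ ++ 0 ∷ []) ≈ D ƛ
  D-snoc-zero ƛ = begin
    D (ƛ ++ 0 ∷ [])
      ≡⟨ ≡.cong₂ Det.detL (rows-++ 0 ƛ (0 ∷ [])) (≡.trans (≡.cong upTo (length-snoc ƛ 0)) (≡.sym (List.upTo-∷ʳ m))) ⟩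
    Det.detL (rows 0 ƛ ++ row m 0 ∷ []) (upTo m ++ m ∷ [])
      ≈⟨ Det.detL-last-row (rows 0 ƛ) (row m 0) (upTo m) m (All.map (λ lt → R.reflexive (row-zero lt)) (upTo-All m)) ⟩
    row m 0 m * D ƛ
      ≈⟨ R.*-congʳ (R.trans (R.reflexive (row-h̃ m 0)) (Newton.h̃-0 P)) ⟩
    1ℝ * D ƛ
      ≈⟨ R.*-identityˡ _ ⟩
    D ƛ ∎
    where m = length ƛ

-- The weight is 1 if b ≥ λ₁ ≥ ν₁ ≥ λ₂ ≥ ν₂ ≥ ⋯, and 0 otherwise.
interlacing : ℕ → List ℕ → List ℕ → ℝ
interlacing b []      []      = 1ℝ
interlacing b (v ∷ ν) (a ∷ ƛ) = indicator (v ℕ.≤? a) * indicator (a ℕ.≤? b) * interlacing v ν ƛ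
interlacing b _       _       = 0ℝ

gap : List ℕ → List ℕ → ℕ
gap (v ∷ ν) (a ∷ ƛ) = (a ∸ v) ℕ.+ gap ν ƛ
gap _       _       = 0

shift-< : ∀ d f {c} → c ℕ.< d → shift d f c ≡ 0ℝ
shift-< (suc d) f {zero}  lt       = ≡.refl
shift-< (suc d) f {suc c} (s≤s lt) = shift-< d f lt

shift-≥ : ∀ d f c → shift d f (d ℕ.+ c) ≡ f c
shift-≥ zero    f c = ≡.refl
shift-≥ (suc d) f c = shift-≥ d f c

monomial-indicator : ∀ d c → monomial d c ≈ indicator (d ℕ.≟ c)
monomial-indicator zero    zero    = R.refl
monomial-indicator zero    (suc c) = R.refl
monomial-indicator (suc d) zero    = R.refl
monomial-indicator (suc d) (suc c) = R.trans (monomial-indicator d c) (indicator-⇔ (d ℕ.≟ c) (suc d ℕ.≟ suc c) (≡.cong suc) ℕ.suc-injective)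

-- `E` is both the size of the strip and the precision of the power series; `B` bounds the parts of
-- the larger shapes.
module Pieri (P : Parameters) (B E : ℕ) where

  open JacobiTrudi P

  module S = CommutativeRing (PowerSeries E)
  module ∑ₛ = FiniteSums (PowerSeries E)
  module Detₛ = Determinants (PowerSeries E)

  infixr 2 _≈ₛ⟨_⟩_ _≡ₛ⟨_⟩_
  infix  3 _∎ₛ

  _≈ₛ⟨_⟩_ : ∀ f {g h} → f S.≈ g → g S.≈ h → f S.≈ h
  f ≈ₛ⟨ e ⟩ e′ = S.trans e e′

  _≡ₛ⟨_⟩_ : ∀ f {g h} → f ≡ g → g S.≈ h → f S.≈ h
  f ≡ₛ⟨ ≡.refl ⟩ e′ = e′

  _∎ₛ : ∀ f → f S.≈ f
  f ∎ₛ = S.refl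

  pointwise : ∀ {f g : ℕ → ℝ} → (∀ k → f k ≈ g k) → f S.≈ g
  pointwise e = mk≈[] λ k _ → e k

  ∑-coefficient : ∀ {A : Set} (xs : List A) (f : A → ℕ → ℝ) k → ∑ₛ.∑ xs f k ≈ ∑ xs (λ x → f x k)
  ∑-coefficient []       f k = R.refl
  ∑-coefficient (x ∷ xs) f k = R.+-congˡ (∑-coefficient xs f k)

  const-cong : ∀ {a b} → a ≈ b → const a S.≈ const b
  const-cong e = pointwise λ { zero → e ; (suc _) → R.refl }

  const-0 : const 0ℝ S.≈ 0ₛ
  const-0 = pointwise λ { zero → R.refl ; (suc _) → R.refl }

  laplace-const : ∀ {X : Set} (r : X → ℝ) C {F F′} → (∀ D → F D S.≈ const (F′ D)) →
    Detₛ.laplace (const ∘ r) C F S.≈ const (Det.laplace r C F′)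
  laplace-const r []      e = S.sym const-0
  laplace-const r (c ∷ C) {F} {F′} e = S.trans
    (S.+-cong (S.trans (S.*-congˡ {const (r c)} (e C)) (pointwise (const-* (r c) (F′ C))))
              (S.-‿cong (laplace-const r C λ D → e (c ∷ D))))
    (pointwise λ { zero → R.refl ; (suc _) → R.trans (R.+-congˡ -0#≈0#) (R.+-identityˡ 0ℝ) })

  detL-const : ∀ {X : Set} (rs : List (X → ℝ)) C → Detₛ.detL (map (const ∘_) rs) C S.≈ const (Det.detL rs C)
  detL-const []       []      = S.refl
  detL-const []       (_ ∷ _) = S.sym const-0
  detL-const (r ∷ rs) C       = laplace-const r C (detL-const rs)

  weight : ℕ → ℕ → ℕ → ℕ → ℝ
  weight b v a c = indicator (v ℕ.≤? a) * indicator (a ℕ.≤? b) * monomial (a ∸ v) c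

  weights : ℕ → List ℕ → List ℕ → ℕ → ℝ
  weights b []      []      = const 1ℝ
  weights b (v ∷ ν) (a ∷ ƛ) = weight b v a ⊛ weights v ν ƛ
  weights b _       _       = 0ₛ

  weights-coefficient : ∀ b ν ƛ c → weights b ν ƛ c ≈ interlacing b ν ƛ * monomial (gap ν ƛ) c
  weights-coefficient b []      []      c = R.sym (R.*-identityˡ _)
  weights-coefficient b []      (_ ∷ _) c = R.sym (R.zeroˡ _)
  weights-coefficient b (_ ∷ _) []      c = R.sym (R.zeroˡ _)
  weights-coefficient b (v ∷ ν) (a ∷ ƛ) c = begin
    (weight b v a ⊛ weights v ν ƛ) c
      ≈⟨ ⊛-scale x (monomial (a ∸ v)) (weights v ν ƛ) c ⟩
    x * (monomial (a ∸ v) ⊛ weights v ν ƛ) c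
      ≈⟨ R.*-congˡ (R.trans (monomial-⊛ (a ∸ v) (weights v ν ƛ) c)
           (R.trans (shift-cong (a ∸ v) c λ i _ → weights-coefficient v ν ƛ i)
             (R.trans (shift-* (a ∸ v) _ (monomial (gap ν ƛ)) c)
               (R.*-congˡ (R.reflexive (shift-shift (a ∸ v) (gap ν ƛ) (const 1ℝ) c)))))) ⟩
    x * (interlacing v ν ƛ * monomial (gap (v ∷ ν) (a ∷ ƛ)) c)
      ≈⟨ R.*-assoc _ _ _ ⟨
    x * interlacing v ν ƛ * monomial (gap (v ∷ ν) (a ∷ ƛ)) c ∎
    where x = indicator (v ℕ.≤? a) * indicator (a ℕ.≤? b)

  -- The generating function of the rows a with v ≤ a ≤ b, where z marks a - v.
  truncated : ℕ → ℕ → ℕ → ℕ → ℕ → ℝ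
  truncated i b v j = ∑ₛ.∑ (upTo (suc B)) (λ a → weight b v a ⊛ const (row i a j))

  truncatedRows : ℕ → ℕ → List ℕ → List (ℕ → ℕ → ℝ)
  truncatedRows i b []      = []
  truncatedRows i b (v ∷ ν) = truncated i b v ∷ truncatedRows (suc i) v ν

  -- The generating function of the rows `a ≥ v` with no upper bound; coefficient `c` belongs to
  -- `a = v + c`.
  full : ℕ → ℕ → ℕ → ℕ → ℝ
  full i v j c = row i (v ℕ.+ c) j

  truncated-coefficient : ∀ i {b} v j c → b ℕ.≤ B → truncated i b v j c ≈ indicator (v ℕ.+ c ℕ.≤? b) * row i (v ℕ.+ c) j
  truncated-coefficient i {b} v j c b≤B = begin
    truncated i b v j c
      ≈⟨ ∑-coefficient (upTo (suc B)) (λ a → weight b v a ⊛ const (row i a j)) c ⟩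
    ∑ (upTo (suc B)) (λ a → (weight b v a ⊛ const (row i a j)) c)
      ≈⟨ ∑-cong (upTo (suc B)) (λ a _ → R.trans (⊛-const (weight b v a) (row i a j) c) (select a)) ⟩
    ∑ (upTo (suc B)) (λ a → indicator (a ℕ.≟ v ℕ.+ c) * (indicator (a ℕ.≤? b) * row i a j))
      ≈⟨ evaluate (v ℕ.+ c ℕ.≤? B) ⟩
    indicator (v ℕ.+ c ℕ.≤? b) * row i (v ℕ.+ c) j ∎
    where
    select : ∀ a → weight b v a c * row i a j ≈ indicator (a ℕ.≟ v ℕ.+ c) * (indicator (a ℕ.≤? b) * row i a j)
    select a = begin
      indicator (v ℕ.≤? a) * indicator (a ℕ.≤? b) * monomial (a ∸ v) c * row i a j
        ≈⟨ R.*-congʳ (R.*-congˡ (monomial-indicator (a ∸ v) c)) ⟩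
      indicator (v ℕ.≤? a) * indicator (a ℕ.≤? b) * indicator (a ∸ v ℕ.≟ c) * row i a j
        ≈⟨ solve 4 (λ x y z r → x :* y :* z :* r := x :* z :* (y :* r)) R.refl _ _ _ _ ⟩
      indicator (v ℕ.≤? a) * indicator (a ∸ v ℕ.≟ c) * (indicator (a ℕ.≤? b) * row i a j)
        ≈⟨ R.*-congʳ (R.trans (R.sym (indicator-× (v ℕ.≤? a) (a ∸ v ℕ.≟ c)))
             (indicator-⇔ ((v ℕ.≤? a) ×-dec (a ∸ v ℕ.≟ c)) (a ℕ.≟ v ℕ.+ c)
               (λ (le , e) → ≡.trans (≡.sym (ℕ.m+[n∸m]≡n le)) (≡.cong (v ℕ.+_) e))
               (λ { ≡.refl → ℕ.m≤m+n v c , ℕ.m+n∸m≡n v c }))) ⟩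
      indicator (a ℕ.≟ v ℕ.+ c) * (indicator (a ℕ.≤? b) * row i a j) ∎
    evaluate : Dec (v ℕ.+ c ℕ.≤ B) →
      ∑ (upTo (suc B)) (λ a → indicator (a ℕ.≟ v ℕ.+ c) * (indicator (a ℕ.≤? b) * row i a j)) ≈ indicator (v ℕ.+ c ℕ.≤? b) * row i (v ℕ.+ c) j
    evaluate (yes le) = ∑-indicator (λ a → indicator (a ℕ.≤? b) * row i a j) (s≤s le)
    evaluate (no ¬le) = R.trans
      (∑-zero (upTo (suc B)) λ a m → R.trans (R.*-congʳ (indicator-no (a ℕ.≟ v ℕ.+ c) λ { ≡.refl → ¬le (ℕ.s≤s⁻¹ (∈.∈-upTo⁻ m)) })) (R.zeroˡ _))
      (R.sym (R.trans (R.*-congʳ (indicator-no (v ℕ.+ c ℕ.≤? b) λ le → ¬le (ℕ.≤-trans le b≤B))) (R.zeroˡ _)))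

  -- The truncation at B is invisible modulo z^{E+1}.
  truncated-top : ∀ i v j → v ℕ.+ E ℕ.≤ B → truncated i B v j S.≈ full i v j
  truncated-top i v j le = mk≈[] λ c c≤E → R.trans (truncated-coefficient i v j c ℕ.≤-refl)
    (R.trans (R.*-congʳ (indicator-yes (v ℕ.+ c ℕ.≤? B) (ℕ.≤-trans (ℕ.+-monoʳ-≤ v c≤E) le))) (R.*-identityˡ _))

  -- The rows cut off are those with `a = b + 1 + c′`. By `row-diagonal`, such a row in position
  -- `suc i` is the row `b + c′` in position `i`. The missing tail is thus `z^(b+1-v)` times the
  -- full preceding row.
  truncated-difference : ∀ i {b v} j → b ℕ.≤ B → v ℕ.≤ b →
    truncated (suc i) b v j S.≈ full (suc i) v j ⊕ ((⊖ monomial (suc b ∸ v)) ⊛ full i b j)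
  truncated-difference i {b} {v} j b≤B v≤b = pointwise λ c → R.trans (truncated-coefficient (suc i) v j c b≤B)
    (R.trans (cases c (v ℕ.+ c ℕ.≤? b)) (R.+-congˡ (R.sym (R.trans
      (⊛-congʳ (full i b j) c (λ k → R.sym (-1*x≈-x (monomial (suc b ∸ v) k))))
      (R.trans (⊛-scale (- 1ℝ) (monomial (suc b ∸ v)) (full i b j) c)
        (R.trans (-1*x≈-x _) (R.-‿cong (monomial-⊛ (suc b ∸ v) (full i b j) c))))))))
    where
    cases : ∀ c → Dec (v ℕ.+ c ℕ.≤ b) → indicator (v ℕ.+ c ℕ.≤? b) * row (suc i) (v ℕ.+ c) j ≈
            full (suc i) v j c + - shift (suc b ∸ v) (full i b j) c
    cases c (yes le) = R.trans (R.*-congʳ (indicator-yes (v ℕ.+ c ℕ.≤? b) le)) (R.trans (R.*-identityˡ _)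
      (R.sym (R.trans (R.+-congˡ (R.trans (R.-‿cong (R.reflexive (shift-< (suc b ∸ v) (full i b j)
        (ℕ.m+n≤o⇒m≤o∸n (suc c) (≡.subst (ℕ._≤ suc b) (≡.cong suc (ℕ.+-comm v c)) (s≤s le)))))) -0#≈0#)) (R.+-identityʳ _))))
    cases c (no ¬le) = R.trans (R.*-congʳ (indicator-no (v ℕ.+ c ℕ.≤? b) ¬le)) (R.trans (R.zeroˡ _)
      (R.sym (R.trans (R.+-congˡ (R.-‿cong (R.reflexive same))) (R.-‿inverseʳ _))))
      where
      d = suc b ∸ v
      c′ = c ∸ d
      d≤c : d ℕ.≤ c
      d≤c = ℕ.m≤n+o⇒m∸n≤o (suc b) v (ℕ.≰⇒> ¬le)
      same : shift d (full i b j) c ≡ row (suc i) (v ℕ.+ c) j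
      same = ≡.trans (≡.cong (shift d (full i b j)) (≡.sym (ℕ.m+[n∸m]≡n d≤c)))
        (≡.trans (shift-≥ d (full i b j) c′)
        (≡.trans (≡.sym (row-diagonal i (b ℕ.+ c′) j))
          (≡.cong (λ a → row (suc i) a j) (≡.trans (≡.cong (ℕ._+ c′) (≡.sym (ℕ.m+[n∸m]≡n (ℕ.m≤n⇒m≤1+n v≤b))))
            (≡.trans (ℕ.+-assoc v d c′) (≡.cong (v ℕ.+_) (ℕ.m+[n∸m]≡n d≤c)))))))

  operations : ℕ → ℕ → List ℕ → List ((ℕ → ℝ) × (ℕ → ℕ → ℝ))
  operations i b []      = []
  operations i b (v ∷ ν) = (⊖ monomial (suc b ∸ v) , full (suc i) v) ∷ operations (suc i) v ν

  -- The multiples subtracted are those of the full preceding row and not of its truncation, which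
  -- is why `chain` refers to the original rows.
  truncated-chain : ∀ i b ν → b ℕ.≤ B → Linked ℕ._≥_ (b ∷ ν) →
    Pointwise (λ r r′ → ∀ j → r j S.≈ r′ j) (truncatedRows (suc i) b ν) (Detₛ.chain (full i b) (operations i b ν))
  truncated-chain i b []      b≤B l       = []
  truncated-chain i b (v ∷ ν) b≤B (le ∷ l) =
    (λ j → truncated-difference i j b≤B le) ∷ truncated-chain (suc i) v ν (ℕ.≤-trans le b≤B) l

  -- Column j of Jacobi–Trudi, and its generating function over the rows.
  tagged : ℕ → ℕ → ℕ ⊎ ℕ → ℕ → ℝ
  tagged i v (inj₁ j) = const (row i v j)
  tagged i v (inj₂ j) = full i v j

  taggedRows : ℕ → List ℕ → List (ℕ ⊎ ℕ → ℕ → ℝ)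
  taggedRows i []      = []
  taggedRows i (v ∷ ν) = tagged i v ∷ taggedRows (suc i) ν

  -- Splitting off the constant term leaves rows with the part raised by one, and by `row-shift`
  -- raising the part amounts to moving one column to the right.
  tagged-step : ∀ i v j → tagged i v (inj₂ j) S.≈ tagged i v (inj₁ j) ⊕ (monomial 1 ⊛ tagged i v (inj₂ (suc j)))
  tagged-step i v j = pointwise λ
    { zero    → R.trans (R.reflexive (≡.cong (λ a → row i a j) (ℕ.+-identityʳ v)))
                  (R.sym (R.trans (R.+-congˡ (monomial-⊛ 1 (full i v (suc j)) 0)) (R.+-identityʳ _)))
    ; (suc c) → R.trans (R.reflexive (≡.trans (≡.cong (λ a → row i a j) (ℕ.+-suc v c)) (row-shift i (v ℕ.+ c) j)))
                  (R.sym (R.trans (R.+-congˡ (monomial-⊛ 1 (full i v (suc j)) (suc c))) (R.+-identityˡ _)))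
    }

  tagged-steps : ∀ i ν j → All (λ r → r (inj₂ j) S.≈ r (inj₁ j) ⊕ (monomial 1 ⊛ r (inj₂ (suc j)))) (taggedRows i ν)
  tagged-steps i []      j = []
  tagged-steps i (v ∷ ν) j = tagged-step i v j ∷ tagged-steps (suc i) ν j

  laterFull : ℕ → ℕ → List (ℕ ⊎ ℕ)
  laterFull j zero    = []
  laterFull j (suc n) = inj₂ (suc j) ∷ laterFull (suc j) n

  mixed : ℕ → ℕ → List (ℕ ⊎ ℕ)
  mixed j zero    = inj₂ j ∷ []
  mixed j (suc n) = inj₁ j ∷ mixed (suc j) n

  -- Columns are treated from left to right, so that the next column, a multiple of which is
  -- subtracted, is still a full one. The last column has no successor and stays full; `C` collects
  -- the finished columns.
  column-operations : ∀ i ν C j n →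
    Detₛ.detL (taggedRows i ν) (C ++ inj₂ j ∷ laterFull j n) S.≈ Detₛ.detL (taggedRows i ν) (C ++ mixed j n)
  column-operations i ν C j zero    = S.refl
  column-operations i ν C j (suc n) =
    Detₛ.detL (taggedRows i ν) (C ++ inj₂ j ∷ inj₂ (suc j) ∷ laterFull (suc j) n)
      ≈ₛ⟨ Detₛ.detL-add-column (taggedRows i ν) (monomial 1) (inj₁ j) (inj₂ j) (inj₂ (suc j)) (tagged-steps i ν j) C (laterFull (suc j) n) ⟩
    Detₛ.detL (taggedRows i ν) (C ++ inj₁ j ∷ inj₂ (suc j) ∷ laterFull (suc j) n)
      ≡ₛ⟨ ≡.sym (≡.cong (Detₛ.detL (taggedRows i ν)) (List.++-assoc C (inj₁ j ∷ []) (inj₂ (suc j) ∷ laterFull (suc j) n))) ⟩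
    Detₛ.detL (taggedRows i ν) ((C ++ inj₁ j ∷ []) ++ inj₂ (suc j) ∷ laterFull (suc j) n)
      ≈ₛ⟨ column-operations i ν (C ++ inj₁ j ∷ []) (suc j) n ⟩
    Detₛ.detL (taggedRows i ν) ((C ++ inj₁ j ∷ []) ++ mixed (suc j) n)
      ≡ₛ⟨ ≡.cong (Detₛ.detL (taggedRows i ν)) (List.++-assoc C (inj₁ j ∷ []) (mixed (suc j) n)) ⟩
    Detₛ.detL (taggedRows i ν) (C ++ mixed j (suc n)) ∎ₛ

  laterFull-upTo : ∀ n → map inj₂ (upTo (suc n)) ≡ inj₂ 0 ∷ laterFull 0 n
  laterFull-upTo n = ≡.cong (inj₂ 0 ∷_) (≡.trans (≡.cong (map inj₂) (≡.sym (List.map-upTo suc n)))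
    (≡.trans (≡.sym (List.map-∘ (upTo n))) (≡.trans (List.map-upTo _ n) (from 0 n _ λ _ → ≡.refl))))
    where
    from : ∀ j n f → (∀ i → f i ≡ inj₂ (suc (j ℕ.+ i))) → applyUpTo f n ≡ laterFull j n
    from j zero    f e = ≡.refl
    from j (suc n) f e = ≡.cong₂ _∷_ (≡.trans (e 0) (≡.cong (inj₂ ∘ suc) (ℕ.+-identityʳ j)))
      (from (suc j) n (f ∘ suc) λ i → ≡.trans (e (suc i)) (≡.cong (inj₂ ∘ suc) (ℕ.+-suc j i)))

  mixed-upTo : ∀ n → map inj₁ (upTo n) ++ inj₂ n ∷ [] ≡ mixed 0 n
  mixed-upTo n = ≡.trans (≡.cong (_++ inj₂ n ∷ []) (List.map-upTo inj₁ n)) (from 0 n inj₁ λ _ → ≡.refl)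
    where
    from : ∀ j n f → (∀ i → f i ≡ inj₁ (j ℕ.+ i)) → applyUpTo f n ++ inj₂ (j ℕ.+ n) ∷ [] ≡ mixed j n
    from j zero    f e = ≡.cong (λ k → inj₂ k ∷ []) (ℕ.+-identityʳ j)
    from j (suc n) f e = ≡.cong₂ _∷_ (≡.trans (e 0) (≡.cong inj₁ (ℕ.+-identityʳ j)))
      (≡.trans (≡.cong (λ k → applyUpTo (f ∘ suc) n ++ inj₂ k ∷ []) (ℕ.+-suc j n))
        (from (suc j) n (f ∘ suc) λ i → ≡.trans (e (suc i)) (≡.cong inj₁ (ℕ.+-suc j i))))

  truncated-multilinear : ∀ i b ν C →
    Detₛ.detL (truncatedRows i b ν) C S.≈
    ∑ₛ.∑ (words (suc B) (length ν)) (λ ƛ → weights b ν ƛ ⊛ Detₛ.detL (map (const ∘_) (rows i ƛ)) C)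
  truncated-multilinear i b []      C = S.sym (S.trans (S.+-identityʳ _) (S.*-identityˡ _))
  truncated-multilinear i b (v ∷ ν) C =
    Detₛ.laplace (truncated i b v) C (Detₛ.detL (truncatedRows (suc i) v ν))
      ≈ₛ⟨ Detₛ.laplace-∑ (upTo (suc B)) (weight b v) (λ a j → const (row i a j)) C _ ⟩
    ∑ₛ.∑ (upTo (suc B)) (λ a → weight b v a ⊛ Detₛ.laplace (const ∘ row i a) C (Detₛ.detL (truncatedRows (suc i) v ν)))
      ≈ₛ⟨ ∑ₛ.∑-cong (upTo (suc B)) (λ a _ → S.trans (S.*-congˡ {weight b v a} (S.trans
            (Detₛ.laplace-cong (λ _ → S.refl) C (truncated-multilinear (suc i) v ν))
            (Detₛ.laplace-∑-minors (const ∘ row i a) C (words (suc B) (length ν)) (weights v ν) _)))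
            (S.trans (∑ₛ.∑-*ˡ (words (suc B) (length ν)) (weight b v a) _)
              (∑ₛ.∑-cong (words (suc B) (length ν)) λ ƛ _ → S.sym (S.*-assoc (weight b v a) (weights v ν ƛ) _)))) ⟩
    ∑ₛ.∑ (upTo (suc B)) (λ a → ∑ₛ.∑ (words (suc B) (length ν)) (λ ƛ → weights b (v ∷ ν) (a ∷ ƛ) ⊛ Detₛ.detL (map (const ∘_) (rows i (a ∷ ƛ))) C))
      ≈ₛ⟨ S.sym (∑ₛ.∑-cartesianProductWith _∷_ (upTo (suc B)) (words (suc B) (length ν)) _) ⟩
    ∑ₛ.∑ (words (suc B) (length (v ∷ ν))) (λ ƛ → weights b (v ∷ ν) ƛ ⊛ Detₛ.detL (map (const ∘_) (rows i ƛ)) C) ∎ₛ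

  taggedRows-inj₁ : ∀ i ν → map (_∘ inj₁) (taggedRows i ν) ≡ map (const ∘_) (rows i ν)
  taggedRows-inj₁ i []      = ≡.refl
  taggedRows-inj₁ i (v ∷ ν) = ≡.cong (_ ∷_) (taggedRows-inj₁ (suc i) ν)

  taggedRows-inj₂ : ∀ i b ν → full i b ∷ map proj₂ (operations i b ν) ≡ map (_∘ inj₂) (taggedRows i (b ∷ ν))
  taggedRows-inj₂ i b []      = ≡.refl
  taggedRows-inj₂ i b (v ∷ ν) = ≡.cong (full i b ∷_) (taggedRows-inj₂ (suc i) v ν)

  taggedRows-snoc : ∀ i ν a → taggedRows i (ν ++ a ∷ []) ≡ taggedRows i ν ++ tagged (i ℕ.+ length ν) a ∷ []
  taggedRows-snoc i []      a = ≡.cong (λ k → tagged k a ∷ []) (≡.sym (ℕ.+-identityʳ i))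
  taggedRows-snoc i (v ∷ ν) a = ≡.cong (tagged i v ∷_) (≡.trans (taggedRows-snoc (suc i) ν a)
    (≡.cong (λ k → taggedRows (suc i) ν ++ tagged k a ∷ []) (≡.sym (ℕ.+-suc i (length ν)))))

  determinant-full : ∀ ν → Detₛ.detL (taggedRows 0 (ν ++ 0 ∷ [])) (map inj₂ (upTo (suc (length ν)))) S.≈
                           tagged (length ν) 0 (inj₂ (length ν)) ⊛ const (D ν)
  determinant-full ν =
    Detₛ.detL (taggedRows 0 (ν ++ 0 ∷ [])) (map inj₂ (upTo (suc m)))
      ≡ₛ⟨ ≡.cong (Detₛ.detL (taggedRows 0 (ν ++ 0 ∷ []))) (laterFull-upTo m) ⟩
    Detₛ.detL (taggedRows 0 (ν ++ 0 ∷ [])) (inj₂ 0 ∷ laterFull 0 m)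
      ≈ₛ⟨ column-operations 0 (ν ++ 0 ∷ []) [] 0 m ⟩
    Detₛ.detL (taggedRows 0 (ν ++ 0 ∷ [])) (mixed 0 m)
      ≡ₛ⟨ ≡.cong₂ Detₛ.detL (taggedRows-snoc 0 ν 0) (≡.sym (mixed-upTo m)) ⟩
    Detₛ.detL (taggedRows 0 ν ++ tagged m 0 ∷ []) (map inj₁ (upTo m) ++ inj₂ m ∷ [])
      ≈ₛ⟨ Detₛ.detL-last-row (taggedRows 0 ν) (tagged m 0) (map inj₁ (upTo m)) (inj₂ m)
            (All.map⁺ (All.map (λ lt → S.trans (const-cong (R.reflexive (row-zero lt))) const-0) (upTo-All m))) ⟩
    tagged m 0 (inj₂ m) ⊛ Detₛ.detL (taggedRows 0 ν) (map inj₁ (upTo m))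
      ≈ₛ⟨ S.sym (S.*-congˡ {tagged m 0 (inj₂ m)} (Detₛ.detL-map inj₁ (taggedRows 0 ν) (upTo m))) ⟩
    tagged m 0 (inj₂ m) ⊛ Detₛ.detL (map (_∘ inj₁) (taggedRows 0 ν)) (upTo m)
      ≡ₛ⟨ ≡.cong (λ rs → tagged m 0 (inj₂ m) ⊛ Detₛ.detL rs (upTo m)) (taggedRows-inj₁ 0 ν) ⟩
    tagged m 0 (inj₂ m) ⊛ Detₛ.detL (map (const ∘_) (rows 0 ν)) (upTo m)
      ≈ₛ⟨ S.*-congˡ {tagged m 0 (inj₂ m)} (detL-const (rows 0 ν) (upTo m)) ⟩
    tagged m 0 (inj₂ m) ⊛ const (D ν) ∎ₛ
    where m = length ν

  determinant-truncated : ∀ v ν C → Linked ℕ._≥_ (v ∷ ν) → v ℕ.+ E ℕ.≤ B →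
    Detₛ.detL (truncatedRows 0 B (v ∷ ν)) C S.≈ Detₛ.detL (taggedRows 0 (v ∷ ν)) (map inj₂ C)
  determinant-truncated v ν C l le =
    Detₛ.detL (truncated 0 B v ∷ truncatedRows 1 v ν) C
      ≈ₛ⟨ Detₛ.detL-cong ((λ j → truncated-top 0 v j le) ∷ truncated-chain 0 v ν (ℕ.≤-trans (ℕ.m≤m+n v E) le) l) C ⟩
    Detₛ.detL (full 0 v ∷ Detₛ.chain (full 0 v) (operations 0 v ν)) C
      ≈ₛ⟨ Detₛ.detL-chain (full 0 v) (operations 0 v ν) C ⟩
    Detₛ.detL (full 0 v ∷ map proj₂ (operations 0 v ν)) C
      ≡ₛ⟨ ≡.cong (λ rs → Detₛ.detL rs C) (taggedRows-inj₂ 0 v ν) ⟩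
    Detₛ.detL (map (_∘ inj₂) (taggedRows 0 (v ∷ ν))) C
      ≈ₛ⟨ Detₛ.detL-map inj₂ (taggedRows 0 (v ∷ ν)) C ⟩
    Detₛ.detL (taggedRows 0 (v ∷ ν)) (map inj₂ C) ∎ₛ

  -- The trailing zero of `v ∷ κ` is the empty row that a horizontal strip may start to fill, so all
  -- `ƛ` can have the length of `v ∷ κ`. The first row grows by at most `E`, whence the bound on
  -- `B`. The equation is the coefficient of `z^E` in the determinant identity.
  pieri : ∀ v κ ν → v ∷ κ ≡ ν ++ 0 ∷ [] → Linked ℕ._≥_ (v ∷ κ) → v ℕ.+ E ℕ.≤ B →
    ∑ (words (suc B) (length (v ∷ κ))) (λ ƛ → interlacing B (v ∷ κ) ƛ * indicator (gap (v ∷ κ) ƛ ℕ.≟ E) * D ƛ)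
      ≈ h̃ P E * D ν
  pieri v κ ν e l le = begin
    ∑ ws (λ ƛ → interlacing B (v ∷ κ) ƛ * indicator (gap (v ∷ κ) ƛ ℕ.≟ E) * D ƛ)
      ≈⟨ ∑-cong ws summand ⟩
    ∑ ws (λ ƛ → (weights B (v ∷ κ) ƛ ⊛ Detₛ.detL (map (const ∘_) (rows 0 ƛ)) (upTo m)) E)
      ≈⟨ ∑-coefficient ws (λ ƛ → weights B (v ∷ κ) ƛ ⊛ Detₛ.detL (map (const ∘_) (rows 0 ƛ)) (upTo m)) E ⟨
    ∑ₛ.∑ ws (λ ƛ → weights B (v ∷ κ) ƛ ⊛ Detₛ.detL (map (const ∘_) (rows 0 ƛ)) (upTo m)) E
      ≈⟨ at-E series ⟩
    (tagged (length ν) 0 (inj₂ (length ν)) ⊛ const (D ν)) E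
      ≈⟨ ⊛-const (tagged (length ν) 0 (inj₂ (length ν))) (D ν) E ⟩
    row (length ν) E (length ν) * D ν
      ≈⟨ R.*-congʳ (R.reflexive (row-h̃ (length ν) E)) ⟩
    h̃ P E * D ν ∎
    where
    m = length (v ∷ κ)
    ws = words (suc B) m
    at-E : ∀ {f g} → f S.≈ g → f E ≈ g E
    at-E e = _≈[_]_.coefficient e E ℕ.≤-refl
    m≡ : m ≡ suc (length ν)
    m≡ = ≡.trans (≡.cong length e) (length-snoc ν 0)
    series : ∑ₛ.∑ ws (λ ƛ → weights B (v ∷ κ) ƛ ⊛ Detₛ.detL (map (const ∘_) (rows 0 ƛ)) (upTo m)) S.≈
             tagged (length ν) 0 (inj₂ (length ν)) ⊛ const (D ν)
    series =
      ∑ₛ.∑ ws (λ ƛ → weights B (v ∷ κ) ƛ ⊛ Detₛ.detL (map (const ∘_) (rows 0 ƛ)) (upTo m))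
        ≈ₛ⟨ S.sym (truncated-multilinear 0 B (v ∷ κ) (upTo m)) ⟩
      Detₛ.detL (truncatedRows 0 B (v ∷ κ)) (upTo m)
        ≈ₛ⟨ determinant-truncated v κ (upTo m) l le ⟩
      Detₛ.detL (taggedRows 0 (v ∷ κ)) (map inj₂ (upTo m))
        ≡ₛ⟨ ≡.cong₂ (λ xs n → Detₛ.detL (taggedRows 0 xs) (map inj₂ (upTo n))) e m≡ ⟩
      Detₛ.detL (taggedRows 0 (ν ++ 0 ∷ [])) (map inj₂ (upTo (suc (length ν))))
        ≈ₛ⟨ determinant-full ν ⟩
      tagged (length ν) 0 (inj₂ (length ν)) ⊛ const (D ν) ∎ₛ
    summand : ∀ ƛ → ƛ ∈ ws → interlacing B (v ∷ κ) ƛ * indicator (gap (v ∷ κ) ƛ ℕ.≟ E) * D ƛ ≈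
              (weights B (v ∷ κ) ƛ ⊛ Detₛ.detL (map (const ∘_) (rows 0 ƛ)) (upTo m)) E
    summand ƛ ƛ∈ = begin
      interlacing B (v ∷ κ) ƛ * indicator (gap (v ∷ κ) ƛ ℕ.≟ E) * D ƛ
        ≈⟨ R.*-cong (R.*-congˡ (R.sym (monomial-indicator (gap (v ∷ κ) ƛ) E)))
             (R.reflexive (≡.cong (λ n → Det.detL (rows 0 ƛ) (upTo n)) (proj₁ (words-∈ m ƛ∈)))) ⟩
      interlacing B (v ∷ κ) ƛ * monomial (gap (v ∷ κ) ƛ) E * Det.detL (rows 0 ƛ) (upTo m)
        ≈⟨ R.*-congʳ (weights-coefficient B (v ∷ κ) ƛ E) ⟨
      weights B (v ∷ κ) ƛ E * Det.detL (rows 0 ƛ) (upTo m)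
        ≈⟨ ⊛-const (weights B (v ∷ κ) ƛ) _ E ⟨
      (weights B (v ∷ κ) ƛ ⊛ const (Det.detL (rows 0 ƛ) (upTo m))) E
        ≈⟨ at-E (S.*-congˡ {weights B (v ∷ κ) ƛ} (detL-const (rows 0 ƛ) (upTo m))) ⟨
      (weights B (v ∷ κ) ƛ ⊛ Detₛ.detL (map (const ∘_) (rows 0 ƛ)) (upTo m)) E ∎

-- Semistandard tableaux

length-filter : ∀ {Q : A → Set} (Q? : ∀ x → Dec (Q x)) xs → fromℕ (length (filter Q? xs)) ≈ ∑ xs (λ x → indicator (Q? x))
length-filter Q? []       = R.refl
length-filter Q? (x ∷ xs) = decide (Q? x)
  where
  decide : Dec _ → fromℕ (length (filter Q? (x ∷ xs))) ≈ indicator (Q? x) + ∑ xs (λ x → indicator (Q? x))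
  decide (yes q) = R.trans (R.reflexive (≡.cong (fromℕ ∘ length) (List.filter-accept Q? q)))
    (R.trans (fromℕ-suc (length (filter Q? xs))) (R.+-cong (R.sym (indicator-yes (Q? x) q)) (length-filter Q? xs)))
  decide (no ¬q) = R.trans (R.reflexive (≡.cong (fromℕ ∘ length) (List.filter-reject Q? ¬q)))
    (R.trans (length-filter Q? xs) (R.sym (R.trans (R.+-congʳ (indicator-no (Q? x) ¬q)) (R.+-identityˡ _))))

increasing : List ℕ → ℝ
increasing w = indicator (linked? ℕ._≤?_ w)

below? : Maybe (List ℕ) → List ℕ → ℝ
below? nothing  w = 1ℝ
below? (just u) w = indicator (prefix? ℕ._>?_ w u)

-- Whether T, placed below the given row if there is one, is semistandard.
semistandard : Maybe (List ℕ) → Tableau → ℝ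
semistandard up []      = 1ℝ
semistandard up (w ∷ T) = increasing w * below? up w * semistandard (just w) T

increasingRows : Tableau → ℝ
increasingRows T = indicator (all? (linked? ℕ._≤?_) T)

strictColumns : Tableau → ℝ
strictColumns T = indicator (linked? (λ upper lower → prefix? ℕ._>?_ lower upper) T)

increasingRows-∷ : ∀ w T → increasingRows (w ∷ T) ≈ increasing w * increasingRows T
increasingRows-∷ w T = R.trans
  (indicator-⇔ (all? (linked? ℕ._≤?_) (w ∷ T)) (linked? ℕ._≤?_ w ×-dec all? (linked? ℕ._≤?_) T)
    (λ { (p ∷ ps) → p , ps }) (λ (p , ps) → p ∷ ps))
  (indicator-× (linked? ℕ._≤?_ w) (all? (linked? ℕ._≤?_) T))

strictColumns-∷∷ : ∀ u w T → strictColumns (u ∷ w ∷ T) ≈ below? (just u) w * strictColumns (w ∷ T)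
strictColumns-∷∷ u w T = R.trans
  (indicator-⇔ (linked? over? (u ∷ w ∷ T)) (prefix? ℕ._>?_ w u ×-dec linked? over? (w ∷ T))
    (λ { (p ∷ ps) → p , ps }) (λ (p , ps) → p ∷ ps))
  (indicator-× (prefix? ℕ._>?_ w u) (linked? over? (w ∷ T)))
  where
  over? : (upper lower : List ℕ) → Dec (Prefix ℕ._>_ lower upper)
  over? upper lower = prefix? ℕ._>?_ lower upper

semistandard-below : ∀ u T → increasingRows T * strictColumns (u ∷ T) ≈ semistandard (just u) T
semistandard-below u []      = R.*-identityˡ 1ℝ
semistandard-below u (w ∷ T) = begin
  increasingRows (w ∷ T) * strictColumns (u ∷ w ∷ T)
    ≈⟨ R.*-cong (increasingRows-∷ w T) (strictColumns-∷∷ u w T) ⟩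
  increasing w * increasingRows T * (below? (just u) w * strictColumns (w ∷ T))
    ≈⟨ solve 4 (λ i r b c → i :* r :* (b :* c) := i :* b :* (r :* c)) R.refl _ _ _ _ ⟩
  increasing w * below? (just u) w * (increasingRows T * strictColumns (w ∷ T))
    ≈⟨ R.*-congˡ (semistandard-below w T) ⟩
  semistandard (just u) (w ∷ T) ∎

semistandard?-indicator : ∀ T → indicator (semistandard? T) ≈ semistandard nothing T
semistandard?-indicator T = R.trans (indicator-× (all? (linked? ℕ._≤?_) T) (linked? (λ upper lower → prefix? ℕ._>?_ lower upper) T)) (split T)
  where
  split : ∀ T → increasingRows T * strictColumns T ≈ semistandard nothing T
  split []      = R.*-identityˡ 1ℝ
  split (w ∷ T) = R.trans (R.*-congʳ (increasingRows-∷ w T)) (R.trans (R.*-assoc _ _ _)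
    (R.*-cong (R.sym (R.*-identityʳ _)) (semistandard-below w T)))

-- The Kostka number as a real, for shapes that may be any list, because the inductions below run
-- over padded shapes and over all words.
kostka : ℕ → List ℕ → Monomial → ℝ
kostka n ƛ μ = ∑ (fillings n ƛ) (λ T → semistandard nothing T * indicator (List.≡-dec ℕ._≟_ (content n T) μ))

s≈kostka : ∀ ƛ μ → s[ ƛ ] μ ≈ kostka (length μ) (parts ƛ) μ
s≈kostka ƛ μ = R.trans
  (length-filter (λ T → semistandard? T ×-dec List.≡-dec ℕ._≟_ (content (length μ) T) μ) (fillings (length μ) (parts ƛ)))
  (∑-cong (fillings (length μ) (parts ƛ)) λ T _ → R.trans
    (indicator-× (semistandard? T) (List.≡-dec ℕ._≟_ (content (length μ) T) μ))
    (R.*-congʳ (semistandard?-indicator T)))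

-- Deleting the largest letter of a tableau.

leading : ℕ → List ℕ → ℝ
leading a []      = 1ℝ
leading a (b ∷ w) = indicator (a ℕ.≤? b)

increasing-∷ : ∀ a w → increasing (a ∷ w) ≈ increasing w * leading a w
increasing-∷ a []      = R.sym (R.*-identityˡ 1ℝ)
increasing-∷ a (b ∷ w) = R.trans
  (indicator-⇔ (linked? ℕ._≤?_ (a ∷ b ∷ w)) (linked? ℕ._≤?_ (b ∷ w) ×-dec (a ℕ.≤? b))
    (λ { (p ∷ ps) → ps , p }) (λ (ps , p) → p ∷ ps))
  (indicator-× (linked? ℕ._≤?_ (b ∷ w)) (a ℕ.≤? b))

leading-++ : ∀ {a n} u k → a ℕ.< n → leading a (u ++ replicate k n) ≈ leading a u
leading-++ []      zero    a<n = R.refl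
leading-++ {a} {n} [] (suc k) a<n = indicator-yes (a ℕ.≤? n) (ℕ.<⇒≤ a<n)
leading-++ (x ∷ u) k       a<n = R.refl

-- After the largest letter `n`, a weakly increasing word can only repeat it.
∑-increasing-maximum : ∀ n r (f : List ℕ → ℝ) → ∑ (words (suc n) r) (λ w → increasing (n ∷ w) * f w) ≈ f (replicate r n)
∑-increasing-maximum n zero    f = R.trans (R.+-identityʳ _) (R.*-identityˡ _)
∑-increasing-maximum n (suc r) f = begin
  ∑ (words (suc n) (suc r)) (λ w → increasing (n ∷ w) * f w)
    ≈⟨ ∑-cartesianProductWith _∷_ (upTo (suc n)) (words (suc n) r) (λ w → increasing (n ∷ w) * f w) ⟩
  ∑ (upTo (suc n)) (λ a → ∑ (words (suc n) r) (λ w → increasing (n ∷ a ∷ w) * f (a ∷ w)))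
    ≈⟨ ∑-cong (upTo (suc n)) (λ a m → R.trans (∑-cong (words (suc n) r) λ w _ → split a w (ℕ.s≤s⁻¹ (∈.∈-upTo⁻ m)))
         (R.sym (∑-*ˡ (words (suc n) r) _ _))) ⟩
  ∑ (upTo (suc n)) (λ a → indicator (a ℕ.≟ n) * ∑ (words (suc n) r) (λ w → increasing (a ∷ w) * f (a ∷ w)))
    ≈⟨ ∑-indicator {suc n} (λ a → ∑ (words (suc n) r) (λ w → increasing (a ∷ w) * f (a ∷ w))) ℕ.≤-refl ⟩
  ∑ (words (suc n) r) (λ w → increasing (n ∷ w) * f (n ∷ w))
    ≈⟨ ∑-increasing-maximum n r (λ w → f (n ∷ w)) ⟩
  f (replicate (suc r) n) ∎
  where
  split : ∀ a w → a ℕ.≤ n → increasing (n ∷ a ∷ w) * f (a ∷ w) ≈ indicator (a ℕ.≟ n) * (increasing (a ∷ w) * f (a ∷ w))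
  split a w a≤n = R.trans (R.*-congʳ (R.trans (increasing-∷ n (a ∷ w)) (R.*-comm _ _)))
    (R.trans (R.*-assoc _ _ _) (R.*-congʳ (indicator-⇔ (n ℕ.≤? a) (a ℕ.≟ n) (ℕ.≤-antisym a≤n) (λ e → ℕ.≤-reflexive (≡.sym e)))))

-- A weakly increasing word with letters ≤ n is one with letters < n followed by a run of n.
∑-increasing : ∀ n r (g : List ℕ → ℝ) → ∑ (words (suc n) r) (λ w → increasing w * g w) ≈
  ∑ (upTo (suc r)) (λ q → ∑ (words n q) (λ u → increasing u * g (u ++ replicate (r ∸ q) n)))
∑-increasing n zero    g = R.sym (R.+-identityʳ _)
∑-increasing n (suc r) g = begin
  ∑ (words (suc n) (suc r)) (λ w → increasing w * g w)
    ≈⟨ ∑-cartesianProductWith _∷_ (upTo (suc n)) (words (suc n) r) (λ w → increasing w * g w) ⟩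
  ∑ (upTo (suc n)) (λ a → ∑ (words (suc n) r) (λ w → increasing (a ∷ w) * g (a ∷ w)))
    -- Words that begin with `n` are constant and give the term `q = 0`; those that begin with a
    -- smaller letter give the terms with positive `q`.
    ≈⟨ ∑-upTo-sucʳ n _ ⟩
  ∑ (upTo n) (λ a → ∑ (words (suc n) r) (λ w → increasing (a ∷ w) * g (a ∷ w))) + ∑ (words (suc n) r) (λ w → increasing (n ∷ w) * g (n ∷ w))
    ≈⟨ R.+-cong (∑-cong (upTo n) λ a m → smaller a (∈.∈-upTo⁻ m)) (∑-increasing-maximum n r (λ w → g (n ∷ w))) ⟩
  ∑ (upTo n) (λ a → ∑ (upTo (suc r)) (λ q → ∑ (words n q) (λ u → term q (a ∷ u)))) + g (replicate (suc r) n)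
    ≈⟨ R.+-cong (∑-swap (upTo n) (upTo (suc r)) _) (R.sym (R.trans (R.+-identityʳ _) (R.*-identityˡ _))) ⟩
  ∑ (upTo (suc r)) (λ q → ∑ (upTo n) (λ a → ∑ (words n q) (λ u → term q (a ∷ u)))) + first
    ≈⟨ R.+-congʳ (∑-cong (upTo (suc r)) λ q _ → R.sym (∑-cartesianProductWith _∷_ (upTo n) (words n q) (term q))) ⟩
  ∑ (upTo (suc r)) (λ q → ∑ (words n (suc q)) (term q)) + first
    ≈⟨ R.+-comm _ _ ⟩
  first + ∑ (upTo (suc r)) (λ q → ∑ (words n (suc q)) (term q))
    ≈⟨ ∑-upTo-sucˡ (suc r) _ ⟨
  ∑ (upTo (suc (suc r))) (λ q → ∑ (words n q) (λ u → increasing u * g (u ++ replicate (suc r ∸ q) n))) ∎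
  where
  term : ℕ → List ℕ → ℝ
  term q u = increasing u * g (u ++ replicate (r ∸ q) n)
  first = ∑ (words n 0) (λ u → increasing u * g (u ++ replicate (suc r) n))
  smaller : ∀ a → a ℕ.< n → ∑ (words (suc n) r) (λ w → increasing (a ∷ w) * g (a ∷ w)) ≈
            ∑ (upTo (suc r)) (λ q → ∑ (words n q) (λ u → term q (a ∷ u)))
  smaller a a<n = begin
    ∑ (words (suc n) r) (λ w → increasing (a ∷ w) * g (a ∷ w))
      ≈⟨ ∑-cong (words (suc n) r) (λ w _ → R.trans (R.*-congʳ (increasing-∷ a w)) (R.*-assoc _ _ _)) ⟩
    ∑ (words (suc n) r) (λ w → increasing w * (leading a w * g (a ∷ w)))
      ≈⟨ ∑-increasing n r (λ w → leading a w * g (a ∷ w)) ⟩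
    ∑ (upTo (suc r)) (λ q → ∑ (words n q) (λ u → increasing u * (leading a (u ++ replicate (r ∸ q) n) * g (a ∷ u ++ replicate (r ∸ q) n))))
      ≈⟨ ∑-cong (upTo (suc r)) (λ q _ → ∑-cong (words n q) λ u _ → R.trans (R.sym (R.*-assoc _ _ _))
           (R.*-congʳ (R.trans (R.*-congˡ (leading-++ u (r ∸ q) a<n)) (R.sym (increasing-∷ a u))))) ⟩
    ∑ (upTo (suc r)) (λ q → ∑ (words n q) (λ u → term q (a ∷ u))) ∎

∑-upTo-bounded : ∀ {r B} (f : ℕ → ℝ) → r ℕ.≤ B → ∑ (upTo (suc r)) f ≈ ∑ (upTo (suc B)) (λ q → indicator (q ℕ.≤? r) * f q)
∑-upTo-bounded {r} {B} f r≤B = R.trans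
  (∑-cong (upTo (suc r)) λ q m → R.sym (R.trans (R.*-congʳ (indicator-yes (q ℕ.≤? r) (ℕ.s≤s⁻¹ (∈.∈-upTo⁻ m)))) (R.*-identityˡ _)))
  (∑-⊆ ℕ._≟_ (Unique.upTo⁺ (suc r)) (Unique.upTo⁺ (suc B)) (λ m → ∈.∈-upTo⁺ (ℕ.<-≤-trans (∈.∈-upTo⁻ m) (s≤s r≤B)))
    λ q _ q∉ → R.trans (R.*-congʳ (indicator-no (q ℕ.≤? r) λ le → q∉ (∈.∈-upTo⁺ (s≤s le)))) (R.zeroˡ _))

-- No letter up to `n` can lie below an `n` in a strict column, so the whole lower row fits under
-- `u₀`. This is the source of the interlacing condition that a row of the larger shape is at most
-- the preceding row of the smaller one.
prefix-extend⁻ : ∀ {n} u u₀ j k → All (ℕ._< n) u → Prefix ℕ._>_ (u ++ replicate j n) (u₀ ++ replicate k n) →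
                 length u ℕ.+ j ℕ.≤ length u₀ × Prefix ℕ._>_ u u₀
prefix-extend⁻ []      u₀       zero    k       _        _        = z≤n , []
prefix-extend⁻ []      []       (suc j) (suc k) _        (p ∷ ps) = contradiction p (ℕ.<-irrefl ≡.refl)
prefix-extend⁻ []      (x ∷ u₀) (suc j) k       _        (p ∷ ps) = s≤s (proj₁ (prefix-extend⁻ [] u₀ j k [] ps)) , []
prefix-extend⁻ (y ∷ u) []       j       (suc k) (b ∷ bs) (p ∷ ps) = contradiction p (ℕ.<-asym b)
prefix-extend⁻ (y ∷ u) (x ∷ u₀) j       k       (b ∷ bs) (p ∷ ps) =
  let le , qs = prefix-extend⁻ u u₀ j k bs ps in s≤s le , p ∷ qs

prefix-extend⁺ : ∀ {n} u u₀ j k → All (ℕ._< n) u₀ → length u ℕ.+ j ℕ.≤ length u₀ → Prefix ℕ._>_ u u₀ →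
                 Prefix ℕ._>_ (u ++ replicate j n) (u₀ ++ replicate k n)
prefix-extend⁺ []      u₀       zero    k _        _        _        = []
prefix-extend⁺ []      (x ∷ u₀) (suc j) k (b ∷ bs) (s≤s le) _        = b ∷ prefix-extend⁺ [] u₀ j k bs le []
prefix-extend⁺ (y ∷ u) (x ∷ u₀) j       k (b ∷ bs) (s≤s le) (p ∷ ps) = p ∷ prefix-extend⁺ u u₀ j k bs le ps

-- Appends runs of the letter n to the rows, turning the shape ν into ƛ.
extend : ℕ → List ℕ → List ℕ → Tableau → Tableau
extend n (v ∷ ν) (a ∷ ƛ) (u ∷ T) = (u ++ replicate (a ∸ v) n) ∷ extend n ν ƛ T
extend n _       _       _       = []

-- What the induction over rows has to know about the row above: `up` includes its run of `n`, `up₀`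
-- does not, and `b` bounds the next row of the larger shape. The bound is the length of `up₀`, or
-- `B` if there is no row above.
Extends : ℕ → ℕ → ℕ → Maybe (List ℕ) → Maybe (List ℕ) → Set
Extends n B b up up₀ = ∀ u r → All (ℕ._< n) u → length u ℕ.≤ r → r ℕ.≤ B →
  below? up (u ++ replicate (r ∸ length u) n) ≈ indicator (r ℕ.≤? b) * below? up₀ u

extends-nothing : ∀ n B → Extends n B B nothing nothing
extends-nothing n B u r _ _ r≤B = R.sym (R.trans (R.*-identityʳ _) (indicator-yes (r ℕ.≤? B) r≤B))

extends-just : ∀ n B u₀ k → All (ℕ._< n) u₀ → Extends n B (length u₀) (just (u₀ ++ replicate k n)) (just u₀)
extends-just n B u₀ k bs₀ u r bs le _ = R.trans
  (indicator-⇔ (prefix? ℕ._>?_ (u ++ replicate (r ∸ length u) n) (u₀ ++ replicate k n)) ((r ℕ.≤? length u₀) ×-dec prefix? ℕ._>?_ u u₀)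
    (λ p → let le′ , q = prefix-extend⁻ u u₀ (r ∸ length u) k bs p in ≡.subst (ℕ._≤ length u₀) (ℕ.m+[n∸m]≡n le) le′ , q)
    (λ (le′ , q) → prefix-extend⁺ u u₀ (r ∸ length u) k bs₀ (≡.subst (ℕ._≤ length u₀) (≡.sym (ℕ.m+[n∸m]≡n le)) le′) q))
  (indicator-× (r ℕ.≤? length u₀) (prefix? ℕ._>?_ u u₀))

-- Row by row, `∑-increasing` separates the run of `n` from the smaller letters, whose number `q`
-- becomes the part of `ν`. The row above and the test function `g` are arbitrary because fixing the
-- first row changes both.
∑-fillings : ∀ n B b up up₀ → Extends n B b up up₀ → ∀ ƛ → All (ℕ._≤ B) ƛ → ∀ (g : Tableau → ℝ) →
  ∑ (fillings (suc n) ƛ) (λ T → semistandard up T * g T) ≈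
  ∑ (words (suc B) (length ƛ)) (λ ν → interlacing b ν ƛ * ∑ (fillings n ν) (λ T → semistandard up₀ T * g (extend n ν ƛ T)))
∑-fillings n B b up up₀ ext []      []       g = solve 1 (λ g → con 1 :* g :+ con 0 := con 1 :* (con 1 :* g :+ con 0) :+ con 0) R.refl (g [])
∑-fillings n B b up up₀ ext (r ∷ ƛ) (r≤B ∷ bs) g = begin
  ∑ (fillings (suc n) (r ∷ ƛ)) (λ T → semistandard up T * g T)
    ≈⟨ ∑-cartesianProductWith _∷_ (words (suc n) r) (fillings (suc n) ƛ) (λ T → semistandard up T * g T) ⟩
  ∑ (words (suc n) r) (λ w → ∑ (fillings (suc n) ƛ) (λ T → increasing w * below? up w * semistandard (just w) T * g (w ∷ T)))
    ≈⟨ ∑-cong (words (suc n) r) (λ w _ → R.trans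
         (∑-cong (fillings (suc n) ƛ) λ T _ → solve 4 (λ i b s g → i :* b :* s :* g := i :* (b :* (s :* g))) R.refl _ _ _ _)
         (R.trans (R.sym (∑-*ˡ (fillings (suc n) ƛ) (increasing w) _))
           (R.*-congˡ (R.sym (∑-*ˡ (fillings (suc n) ƛ) (below? up w) _))))) ⟩
  ∑ (words (suc n) r) (λ w → increasing w * lower w)
    ≈⟨ ∑-increasing n r lower ⟩
  ∑ (upTo (suc r)) (λ q → ∑ (words n q) (λ u → increasing u * lower (u ++ replicate (r ∸ q) n)))
    ≈⟨ ∑-upTo-bounded _ r≤B ⟩
  ∑ (upTo (suc B)) (λ q → indicator (q ℕ.≤? r) * ∑ (words n q) (λ u → increasing u * lower (u ++ replicate (r ∸ q) n)))
    ≈⟨ ∑-cong (upTo (suc B)) (λ q _ → row q) ⟩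
  ∑ (upTo (suc B)) (λ q → ∑ (words (suc B) (length ƛ)) (λ ν → interlacing b (q ∷ ν) (r ∷ ƛ) * inner (q ∷ ν)))
    ≈⟨ ∑-cartesianProductWith _∷_ (upTo (suc B)) (words (suc B) (length ƛ)) (λ ν → interlacing b ν (r ∷ ƛ) * inner ν) ⟨
  ∑ (words (suc B) (length (r ∷ ƛ))) (λ ν → interlacing b ν (r ∷ ƛ) * inner ν) ∎
  where
  lower : List ℕ → ℝ
  lower w = below? up w * ∑ (fillings (suc n) ƛ) (λ T → semistandard (just w) T * g (w ∷ T))
  inner : List ℕ → ℝ
  inner ν = ∑ (fillings n ν) (λ T → semistandard up₀ T * g (extend n ν (r ∷ ƛ) T))
  W = words (suc B) (length ƛ)
  deeper : ℕ → List ℕ → List ℕ → ℝ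
  deeper q u ν = ∑ (fillings n ν) (λ T → semistandard (just u) T * g ((u ++ replicate (r ∸ q) n) ∷ extend n ν ƛ T))
  lower-extend : ∀ q u → q ℕ.≤ r → u ∈ words n q →
    lower (u ++ replicate (r ∸ q) n) ≈ indicator (r ℕ.≤? b) * below? up₀ u * ∑ W (λ ν → interlacing q ν ƛ * deeper q u ν)
  lower-extend q u q≤r u∈ with words-∈ q u∈
  -- Identifying `q` with the length of `u` makes the bound on the next row of `ƛ` equal to the part
  -- of `ν` just found, as `interlacing` demands.
  ... | ≡.refl , us = R.*-cong (ext u r us q≤r r≤B)
    (∑-fillings n B (length u) (just (u ++ replicate (r ∸ q) n)) (just u) (extends-just n B u (r ∸ q) us) ƛ bs
      (λ T → g ((u ++ replicate (r ∸ q) n) ∷ T)))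
  row : ∀ q → indicator (q ℕ.≤? r) * ∑ (words n q) (λ u → increasing u * lower (u ++ replicate (r ∸ q) n)) ≈
              ∑ W (λ ν → interlacing b (q ∷ ν) (r ∷ ƛ) * inner (q ∷ ν))
  row q = begin
    indicator (q ℕ.≤? r) * ∑ (words n q) (λ u → increasing u * lower (u ++ replicate (r ∸ q) n))
      ≈⟨ indicator-*-cong (q ℕ.≤? r) (λ q≤r → ∑-cong (words n q) λ u m → R.*-congˡ (lower-extend q u q≤r m)) ⟩
    indicator (q ℕ.≤? r) * ∑ (words n q) (λ u → increasing u * (indicator (r ℕ.≤? b) * below? up₀ u * ∑ W (λ ν → interlacing q ν ƛ * deeper q u ν)))
      ≈⟨ ∑-*ˡ (words n q) _ _ ⟩
    ∑ (words n q) (λ u → indicator (q ℕ.≤? r) * (increasing u * (indicator (r ℕ.≤? b) * below? up₀ u * ∑ W (λ ν → interlacing q ν ƛ * deeper q u ν))))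
      ≈⟨ ∑-cong (words n q) (λ u _ → R.trans
           (solve 5 (λ i j k l m → i :* (j :* (k :* l :* m)) := i :* k :* (j :* l) :* m) R.refl
              (indicator (q ℕ.≤? r)) (increasing u) (indicator (r ℕ.≤? b)) (below? up₀ u) _)
           (R.trans (∑-*ˡ W _ _) (∑-cong W λ ν _ →
             solve 4 (λ i j k l → i :* j :* (k :* l) := i :* k :* (j :* l)) R.refl _ _ _ _))) ⟩
    ∑ (words n q) (λ u → ∑ W (λ ν → interlacing b (q ∷ ν) (r ∷ ƛ) * (increasing u * below? up₀ u * deeper q u ν)))
      ≈⟨ ∑-swap (words n q) W _ ⟩
    ∑ W (λ ν → ∑ (words n q) (λ u → interlacing b (q ∷ ν) (r ∷ ƛ) * (increasing u * below? up₀ u * deeper q u ν)))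
      ≈⟨ ∑-cong W (λ ν _ → R.trans (R.sym (∑-*ˡ (words n q) _ _)) (R.*-congˡ (R.trans
           (∑-cong (words n q) λ u _ → R.trans (∑-*ˡ (fillings n ν) _ _) (∑-cong (fillings n ν) λ T _ → R.sym (R.*-assoc _ _ _)))
           (R.sym (∑-cartesianProductWith _∷_ (words n q) (fillings n ν) (λ T → semistandard up₀ T * g (extend n (q ∷ ν) (r ∷ ƛ) T))))))) ⟩
    ∑ W (λ ν → interlacing b (q ∷ ν) (r ∷ ƛ) * inner (q ∷ ν)) ∎

count-++ : ∀ i xs ys → count i (xs ++ ys) ≡ count i xs ℕ.+ count i ys
count-++ i xs ys = ≡.trans (≡.cong length (List.filter-++ (i ℕ.≟_) xs ys)) (List.length-++ (filter (i ℕ.≟_) xs))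

count-replicate-≡ : ∀ n k → count n (replicate k n) ≡ k
count-replicate-≡ n zero    = ≡.refl
count-replicate-≡ n (suc k) = ≡.trans (count-∷-≡ n (replicate k n)) (≡.cong suc (count-replicate-≡ n k))

count-replicate-≢ : ∀ {i n} k → i ≢ n → count i (replicate k n) ≡ 0
count-replicate-≢ zero    i≢n = ≡.refl
count-replicate-≢ (suc k) i≢n = ≡.trans (count-∷-≢ (replicate k _) i≢n) (count-replicate-≢ k i≢n)

fillings-∷ : ∀ n v ν {T} → T ∈ fillings n (v ∷ ν) → ∃₂ λ u T′ → T ≡ u ∷ T′ × All (ℕ._< n) u × T′ ∈ fillings n ν
fillings-∷ n v ν m with ∈.∈-cartesianProductWith⁻ _∷_ (words n v) (fillings n ν) m
... | u , T′ , u∈ , T′∈ , e = u , T′ , e , proj₂ (words-∈ v u∈) , T′∈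

count-extend-< : ∀ {n i} → i ℕ.< n → ∀ ν ƛ {T} → length ν ≡ length ƛ → T ∈ fillings n ν →
  count i (concat (extend n ν ƛ T)) ≡ count i (concat T)
count-extend-< i<n []      []      _ (here ≡.refl) = ≡.refl
count-extend-< {n} {i} i<n (v ∷ ν) (a ∷ ƛ) l m with fillings-∷ n v ν m
... | u , T , ≡.refl , us , T∈ = ≡.trans (count-++ i (u ++ replicate (a ∸ v) n) (concat (extend n ν ƛ T)))
  (≡.trans (≡.cong₂ ℕ._+_
    (≡.trans (count-++ i u (replicate (a ∸ v) n))
      (≡.trans (≡.cong (count i u ℕ.+_) (count-replicate-≢ (a ∸ v) (ℕ.<⇒≢ i<n))) (ℕ.+-identityʳ _)))
    (count-extend-< i<n ν ƛ (ℕ.suc-injective l) T∈))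
  (≡.sym (count-++ i u (concat T))))

count-extend-≡ : ∀ n ν ƛ {T} → length ν ≡ length ƛ → T ∈ fillings n ν → count n (concat (extend n ν ƛ T)) ≡ gap ν ƛ
count-extend-≡ n []      []      _ (here ≡.refl) = ≡.refl
count-extend-≡ n (v ∷ ν) (a ∷ ƛ) l m with fillings-∷ n v ν m
... | u , T , ≡.refl , us , T∈ = ≡.trans (count-++ n (u ++ replicate (a ∸ v) n) (concat (extend n ν ƛ T)))
  (≡.cong₂ ℕ._+_
    (≡.trans (count-++ n u (replicate (a ∸ v) n)) (≡.cong₂ ℕ._+_
      (count-absent λ n∈u → ℕ.<-irrefl ≡.refl (All.lookup us n∈u)) (count-replicate-≡ n (a ∸ v))))
    (count-extend-≡ n ν ƛ (ℕ.suc-injective l) T∈))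

content-extend : ∀ n ν ƛ {T} → length ν ≡ length ƛ → T ∈ fillings n ν →
  content (suc n) (extend n ν ƛ T) ≡ content n T ++ gap ν ƛ ∷ []
content-extend n ν ƛ {T} l m = ≡.trans (≡.cong (map f) (≡.sym (List.upTo-∷ʳ n)))
  (≡.trans (List.map-++ f (upTo n) (n ∷ [])) (≡.cong₂ (λ xs x → xs ++ x ∷ [])
    (List.map-cong-local (All.tabulate λ i∈ → count-extend-< (∈.∈-upTo⁻ i∈) ν ƛ l m))
    (count-extend-≡ n ν ƛ l m)))
  where
  f : ℕ → ℕ
  f i = count i (concat (extend n ν ƛ T))

-- The branching rule: the last exponent counts the letters `n`, and these are the cells that
-- `extend` adds.
kostka-snoc : ∀ n B ƛ μ e → All (ℕ._≤ B) ƛ → kostka (suc n) ƛ (μ ++ e ∷ []) ≈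
  ∑ (words (suc B) (length ƛ)) (λ ν → interlacing B ν ƛ * indicator (gap ν ƛ ℕ.≟ e) * kostka n ν μ)
kostka-snoc n B ƛ μ e bs = R.trans
  (∑-fillings n B B nothing nothing (extends-nothing n B) ƛ bs (λ T → indicator (List.≡-dec ℕ._≟_ (content (suc n) T) (μ ++ e ∷ []))))
  (∑-cong (words (suc B) (length ƛ)) λ ν ν∈ → R.trans (R.*-congˡ (R.trans
    (∑-cong (fillings n ν) λ T T∈ → R.trans (R.*-congˡ (split ν (proj₁ (words-∈ (length ƛ) ν∈)) T T∈))
      (solve 3 (λ s c g → s :* (g :* c) := g :* (s :* c)) R.refl _ _ _))
    (R.sym (∑-*ˡ (fillings n ν) (indicator (gap ν ƛ ℕ.≟ e)) _)))) (R.sym (R.*-assoc _ _ _)))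
  where
  split : ∀ ν → length ν ≡ length ƛ → ∀ T → T ∈ fillings n ν →
    indicator (List.≡-dec ℕ._≟_ (content (suc n) (extend n ν ƛ T)) (μ ++ e ∷ [])) ≈
    indicator (gap ν ƛ ℕ.≟ e) * indicator (List.≡-dec ℕ._≟_ (content n T) μ)
  split ν l T T∈ = R.trans
    (indicator-⇔ (List.≡-dec ℕ._≟_ (content (suc n) (extend n ν ƛ T)) (μ ++ e ∷ [])) ((gap ν ƛ ℕ.≟ e) ×-dec List.≡-dec ℕ._≟_ (content n T) μ)
      (λ p → let q , q′ = List.∷ʳ-injective (content n T) μ (≡.trans (≡.sym (content-extend n ν ƛ l T∈)) p) in q′ , q)
      (λ (p , q) → ≡.trans (content-extend n ν ƛ l T∈) (≡.cong₂ (λ xs x → xs ++ x ∷ []) q p)))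
    (indicator-× (gap ν ƛ ℕ.≟ e) (List.≡-dec ℕ._≟_ (content n T) μ))

-- The expansion in Schur functions

prepend-≥ : ∀ {a v xs} → v ℕ.≤ a → Linked ℕ._≥_ (v ∷ xs) → Linked ℕ._≥_ (a ∷ xs)
prepend-≥ v≤a [-]      = [-]
prepend-≥ v≤a (p ∷ ps) = ℕ.≤-trans p v≤a ∷ ps

Interlaced : ℕ → List ℕ → List ℕ → Set
Interlaced b ν ƛ = sumℕ ƛ ≡ sumℕ ν ℕ.+ gap ν ƛ × Linked ℕ._≥_ (b ∷ ƛ) × Linked ℕ._≥_ (b ∷ ν)

interlacing-cases : ∀ b ν ƛ → interlacing b ν ƛ ≈ 0ℝ ⊎ Interlaced b ν ƛ
interlacing-cases b []      []      = inj₂ (≡.refl , [-] , [-])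
interlacing-cases b []      (_ ∷ _) = inj₁ R.refl
interlacing-cases b (_ ∷ _) []      = inj₁ R.refl
interlacing-cases b (v ∷ ν) (a ∷ ƛ) with v ℕ.≤? a | a ℕ.≤? b | interlacing-cases v ν ƛ
... | no _    | _       | _      = inj₁ (R.trans (R.*-congʳ (R.zeroˡ _)) (R.zeroˡ _))
... | yes _   | no _    | _      = inj₁ (R.trans (R.*-congʳ (R.zeroʳ _)) (R.zeroˡ _))
... | yes _   | yes _   | inj₁ e = inj₁ (R.trans (R.*-congˡ e) (R.zeroʳ _))
... | yes v≤a | yes a≤b | inj₂ (s , l , l′) = inj₂ (size , a≤b ∷ prepend-≥ v≤a l , ℕ.≤-trans v≤a a≤b ∷ l′)
  where
  open ℕ.+-*-Solver renaming (solve to solveℕ; _:+_ to _⊞_; _:=_ to _≔_)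
  size : a ℕ.+ sumℕ ƛ ≡ v ℕ.+ sumℕ ν ℕ.+ (a ∸ v ℕ.+ gap ν ƛ)
  size = ≡.trans (≡.cong₂ ℕ._+_ (≡.sym (ℕ.m+[n∸m]≡n v≤a)) s)
    (solveℕ 4 (λ v d s g → v ⊞ d ⊞ (s ⊞ g) ≔ v ⊞ s ⊞ (d ⊞ g)) ≡.refl v (a ∸ v) (sumℕ ν) (gap ν ƛ))

sum-snoc : ∀ μ e → sumℕ (μ ++ e ∷ []) ≡ sumℕ μ ℕ.+ e
sum-snoc μ e = ≡.trans (ℕ.sum-++ μ (e ∷ [])) (≡.cong (sumℕ μ ℕ.+_) (ℕ.+-identityʳ e))

fillings-0 : ∀ ƛ f → sumℕ ƛ ≢ 0 → ∑ (fillings 0 ƛ) f ≈ 0ℝ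
fillings-0 []          f ne = contradiction ≡.refl ne
fillings-0 (zero ∷ ƛ)  f ne = R.trans (∑-cartesianProductWith _∷_ ([] ∷ []) (fillings 0 ƛ) f)
  (R.trans (R.+-identityʳ _) (fillings-0 ƛ (λ T → f ([] ∷ T)) ne))
fillings-0 (suc a ∷ ƛ) f ne = R.refl

kostka-cong-size : ∀ {m n} ƛ μ → m ≡ n → kostka m ƛ μ ≈ kostka n ƛ μ
kostka-cong-size ƛ μ ≡.refl = R.refl

kostka-length-snoc : ∀ ƛ μ e → kostka (length (μ ++ e ∷ [])) ƛ (μ ++ e ∷ []) ≈
  ∑ (words (suc (sumℕ ƛ)) (length ƛ)) (λ ν → interlacing (sumℕ ƛ) ν ƛ * indicator (gap ν ƛ ℕ.≟ e) * kostka (length μ) ν μ)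
kostka-length-snoc ƛ μ e = R.trans
  (kostka-cong-size ƛ (μ ++ e ∷ []) (≡.trans (List.length-++ μ) (ℕ.+-comm (length μ) 1)))
  (kostka-snoc (length μ) (sumℕ ƛ) ƛ μ e (parts≤sum ƛ))

kostka-degree : ∀ μ ƛ → sumℕ ƛ ≢ sumℕ μ → kostka (length μ) ƛ μ ≈ 0ℝ
kostka-degree μ = go (reverseView μ)
  where
  go : ∀ {μ} → Reverse μ → ∀ ƛ → sumℕ ƛ ≢ sumℕ μ → kostka (length μ) ƛ μ ≈ 0ℝ
  go []            ƛ ne = fillings-0 ƛ _ ne
  go (μ ∶ r ∶ʳ e) ƛ ne = R.trans (kostka-length-snoc ƛ μ e) (∑-zero (words (suc (sumℕ ƛ)) (length ƛ)) λ ν _ → zero-term ν)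
    where
    zero-term : ∀ ν → interlacing (sumℕ ƛ) ν ƛ * indicator (gap ν ƛ ℕ.≟ e) * kostka (length μ) ν μ ≈ 0ℝ
    zero-term ν with interlacing-cases (sumℕ ƛ) ν ƛ
    ... | inj₁ z = R.trans (R.*-congʳ (R.trans (R.*-congʳ z) (R.zeroˡ _))) (R.zeroˡ _)
    ... | inj₂ (s , _) with sumℕ ν ℕ.≟ sumℕ μ
    ...   | no ne′ = R.trans (R.*-congˡ (go r ν ne′)) (R.zeroʳ _)
    ...   | yes e′ = R.trans (R.*-congʳ (R.trans (R.*-congˡ (indicator-no (gap ν ƛ ℕ.≟ e)
        λ g → ne (≡.trans s (≡.trans (≡.cong₂ ℕ._+_ e′ g) (≡.sym (sum-snoc μ e)))))) (R.zeroʳ _))) (R.zeroˡ _)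

zeros-decreasing : ∀ {xs} → sumℕ xs ≡ 0 → Linked ℕ._≥_ xs
zeros-decreasing {[]}             e = []
zeros-decreasing {zero ∷ []}      e = [-]
zeros-decreasing {zero ∷ zero ∷ xs} e = z≤n ∷ zeros-decreasing e

-- One branching step suffices, since interlacing with any `ν` already forces `ƛ` to be decreasing.
-- Without variables there are no letters, and only shapes consisting of zeros have fillings.
kostka-decreasing : ∀ μ ƛ → ¬ Linked ℕ._≥_ ƛ → kostka (length μ) ƛ μ ≈ 0ℝ
kostka-decreasing μ ƛ ¬l with reverseView μ
... | []           = fillings-0 ƛ _ (¬l ∘ zeros-decreasing)
... | μ ∶ r ∶ʳ e = R.trans (kostka-length-snoc ƛ μ e) (∑-zero (words (suc (sumℕ ƛ)) (length ƛ)) λ ν _ → zero-term ν)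
  where
  zero-term : ∀ ν → interlacing (sumℕ ƛ) ν ƛ * indicator (gap ν ƛ ℕ.≟ e) * kostka (length μ) ν μ ≈ 0ℝ
  zero-term ν with interlacing-cases (sumℕ ƛ) ν ƛ
  ... | inj₁ z           = R.trans (R.*-congʳ (R.trans (R.*-congʳ z) (R.zeroˡ _))) (R.zeroˡ _)
  ... | inj₂ (_ , l , _) = contradiction (Linked.tail l) ¬l

∑-fillings-snoc-zero : ∀ n ƛ f → ∑ (fillings n (ƛ ++ 0 ∷ [])) f ≈ ∑ (fillings n ƛ) (λ T → f (T ++ [] ∷ []))
∑-fillings-snoc-zero n []      f = R.refl
∑-fillings-snoc-zero n (a ∷ ƛ) f = R.trans (∑-cartesianProductWith _∷_ (words n a) (fillings n (ƛ ++ 0 ∷ [])) f)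
  (R.trans (∑-cong (words n a) λ w _ → ∑-fillings-snoc-zero n ƛ (λ T → f (w ∷ T)))
    (R.sym (∑-cartesianProductWith _∷_ (words n a) (fillings n ƛ) (λ T → f (T ++ [] ∷ [])))))

semistandard-snoc-[] : ∀ up T → semistandard up (T ++ [] ∷ []) ≈ semistandard up T
semistandard-snoc-[] up []      = R.trans (R.*-identityʳ _) (R.trans (R.*-identityˡ _) (none up))
  where
  none : ∀ up → below? up [] ≈ 1ℝ
  none nothing  = R.refl
  none (just u) = indicator-yes (prefix? ℕ._>?_ [] u) []
semistandard-snoc-[] up (w ∷ T) = R.*-congˡ (semistandard-snoc-[] (just w) T)

concat-snoc-[] : ∀ (T : Tableau) → concat (T ++ [] ∷ []) ≡ concat T
concat-snoc-[] []      = ≡.refl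
concat-snoc-[] (w ∷ T) = ≡.cong (w ++_) (concat-snoc-[] T)

kostka-snoc-zero : ∀ n ƛ μ → kostka n (ƛ ++ 0 ∷ []) μ ≈ kostka n ƛ μ
kostka-snoc-zero n ƛ μ = R.trans (∑-fillings-snoc-zero n ƛ _) (∑-cong (fillings n ƛ) λ T _ →
  R.*-cong (semistandard-snoc-[] nothing T)
    (R.reflexive (≡.cong (λ xs → indicator (List.≡-dec ℕ._≟_ (map (λ i → count i xs) (upTo n)) μ)) (concat-snoc-[] T))))

replicate-snoc : ∀ k (xs : List ℕ) → xs ++ replicate (suc k) 0 ≡ (xs ++ replicate k 0) ++ 0 ∷ []
replicate-snoc zero    []       = ≡.refl
replicate-snoc (suc k) []       = ≡.cong (0 ∷_) (replicate-snoc k [])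
replicate-snoc k       (x ∷ xs) = ≡.cong (x ∷_) (replicate-snoc k xs)

snoc-invariant : ∀ (f : List ℕ → ℝ) → (∀ ƛ → f (ƛ ++ 0 ∷ []) ≈ f ƛ) → ∀ k ƛ → f (ƛ ++ replicate k 0) ≈ f ƛ
snoc-invariant f e zero    ƛ = R.reflexive (≡.cong f (List.++-identityʳ ƛ))
snoc-invariant f e (suc k) ƛ = R.trans (R.reflexive (≡.cong f (replicate-snoc k ƛ)))
  (R.trans (e (ƛ ++ replicate k 0)) (snoc-invariant f e k ƛ))

kostka-zeros : ∀ k → kostka 0 (replicate k 0) [] ≈ 1ℝ
kostka-zeros k = R.trans (snoc-invariant (λ ƛ → kostka 0 ƛ []) (λ ƛ → kostka-snoc-zero 0 ƛ []) k [])
  (R.trans (R.+-identityʳ _) (R.*-identityˡ 1ℝ))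

words-unique : ∀ n k → Unique (words n k)
words-unique n zero    = [] ∷ []
words-unique n (suc k) = Unique.cartesianProductWith⁺ _∷_ List.∷-injective (Unique.upTo⁺ n) (words-unique n k)

sum-zero-replicate : ∀ xs → sumℕ xs ≡ 0 → xs ≡ replicate (length xs) 0
sum-zero-replicate []          e = ≡.refl
sum-zero-replicate (zero ∷ xs) e = ≡.cong (0 ∷_) (sum-zero-replicate xs e)

-- If all parts were positive, the sum would be at least the length; in a decreasing list a zero
-- entry forces the last entry to be zero.
last-part-zero : ∀ v κ → Linked ℕ._≥_ (v ∷ κ) → sumℕ (v ∷ κ) ℕ.< length (v ∷ κ) → ∃ λ ν → v ∷ κ ≡ ν ++ 0 ∷ []
last-part-zero zero    []      l        lt = [] , ≡.refl
last-part-zero (suc v) []      l        (s≤s ())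
last-part-zero zero    (w ∷ κ) (z≤n ∷ l) lt =
  let ν , e = last-part-zero 0 κ l (ℕ.<-≤-trans (ℕ.≤-<-trans (ℕ.≤-reflexive (zero-sum l)) (s≤s z≤n)) ℕ.≤-refl) in 0 ∷ ν , ≡.cong (0 ∷_) e
  where
  zero-sum : ∀ {κ} → Linked ℕ._≥_ (0 ∷ κ) → sumℕ (0 ∷ κ) ≡ 0
  zero-sum [-]       = ≡.refl
  zero-sum (z≤n ∷ l) = zero-sum l
last-part-zero (suc v) (w ∷ κ) (_ ∷ l)  (s≤s lt) =
  let ν , e = last-part-zero w κ l (ℕ.≤-<-trans (ℕ.m≤n+m _ v) lt) in suc v ∷ ν , ≡.cong (suc v ∷_) e

module SchurExpansion (P : Parameters) where

  open JacobiTrudi P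
  open PowerSumExpansion P using (G)

  G-snoc : ∀ μ e → h̃ P e * G μ ≈ G (μ ++ e ∷ [])
  G-snoc []      e = R.refl
  G-snoc (x ∷ μ) e = R.trans (solve 3 (λ a b c → a :* (b :* c) := b :* (a :* c)) R.refl _ _ _) (R.*-congˡ (G-snoc μ e))

  D-zeros : ∀ k → D (replicate k 0) ≈ 1ℝ
  D-zeros k = snoc-invariant D D-snoc-zero k []

  -- With more rows than the degree, every decreasing `ν` of size `sumℕ μ` ends in a zero, as
  -- `pieri` requires; the bound by `B` provides its other hypothesis. Both hypotheses pass to a
  -- shorter `μ`, so one box serves the whole induction on the last variable.
  boxed : ∀ μ M B → sumℕ μ ℕ.< M → sumℕ μ ℕ.≤ B →
    ∑ (words (suc B) M) (λ ƛ → kostka (length μ) ƛ μ * D ƛ) ≈ G μ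
  boxed μ M B = go (reverseView μ)
    where
    go : ∀ {μ} → Reverse μ → sumℕ μ ℕ.< M → sumℕ μ ℕ.≤ B →
      ∑ (words (suc B) M) (λ ƛ → kostka (length μ) ƛ μ * D ƛ) ≈ G μ
    go [] _ _ = R.trans
      (∑-single (words-unique (suc B) M)
        (≡.subst (λ k → replicate M 0 ∈ words (suc B) k) (List.length-replicate M) (∈-words (All.replicate⁺ M (s≤s z≤n))))
        λ ƛ ƛ∈ ne → R.trans (R.*-congʳ (kostka-degree [] ƛ λ e → ne
          (≡.trans (sum-zero-replicate ƛ e) (≡.cong (λ k → replicate k 0) (proj₁ (words-∈ M ƛ∈)))))) (R.zeroˡ _))
      (R.trans (R.*-cong (kostka-zeros M) (D-zeros M)) (R.*-identityˡ 1ℝ))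
    go (μ ∶ r ∶ʳ e) lt le = begin
      ∑ ws (λ ƛ → kostka (length (μ ++ e ∷ [])) ƛ (μ ++ e ∷ []) * D ƛ)
        ≈⟨ ∑-cong ws (λ ƛ ƛ∈ → R.trans (R.*-congʳ (expand ƛ ƛ∈)) (∑-*ʳ ws (D ƛ) _)) ⟩
      ∑ ws (λ ƛ → ∑ ws (λ ν → interlacing B ν ƛ * indicator (gap ν ƛ ℕ.≟ e) * kostka (length μ) ν μ * D ƛ))
        ≈⟨ ∑-swap ws ws _ ⟩
      ∑ ws (λ ν → ∑ ws (λ ƛ → interlacing B ν ƛ * indicator (gap ν ƛ ℕ.≟ e) * kostka (length μ) ν μ * D ƛ))
        ≈⟨ ∑-cong ws (λ ν ν∈ → R.trans
             (R.trans (∑-cong ws λ ƛ _ → solve 3 (λ i k d → i :* k :* d := k :* (i :* d)) R.refl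
                (interlacing B ν ƛ * indicator (gap ν ƛ ℕ.≟ e)) (kostka (length μ) ν μ) (D ƛ))
               (R.sym (∑-*ˡ ws (kostka (length μ) ν μ) _)))
             (apply-pieri ν (proj₁ (words-∈ M ν∈)))) ⟩
      ∑ ws (λ ν → kostka (length μ) ν μ * (h̃ P e * D ν))
        ≈⟨ ∑-cong ws (λ ν _ → solve 3 (λ k h d → k :* (h :* d) := h :* (k :* d)) R.refl _ _ _) ⟩
      ∑ ws (λ ν → h̃ P e * (kostka (length μ) ν μ * D ν))
        ≈⟨ ∑-*ˡ ws (h̃ P e) _ ⟨
      h̃ P e * ∑ ws (λ ν → kostka (length μ) ν μ * D ν)
        ≈⟨ R.*-congˡ (go r (ℕ.≤-<-trans |μ|≤ lt) (ℕ.≤-trans |μ|≤ le)) ⟩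
      h̃ P e * G μ
        ≈⟨ G-snoc μ e ⟩
      G (μ ++ e ∷ []) ∎
      where
      ws = words (suc B) M
      |μ|≤ : sumℕ μ ℕ.≤ sumℕ (μ ++ e ∷ [])
      |μ|≤ = ≡.subst (sumℕ μ ℕ.≤_) (≡.sym (sum-snoc μ e)) (ℕ.m≤m+n (sumℕ μ) e)
      expand : ∀ ƛ → ƛ ∈ ws → kostka (length (μ ++ e ∷ [])) ƛ (μ ++ e ∷ []) ≈
        ∑ ws (λ ν → interlacing B ν ƛ * indicator (gap ν ƛ ℕ.≟ e) * kostka (length μ) ν μ)
      expand ƛ ƛ∈ = let l , bs = words-∈ M ƛ∈ in R.trans
        (kostka-cong-size ƛ (μ ++ e ∷ []) (length-snoc μ e))
        (R.trans (kostka-snoc (length μ) B ƛ μ e (All.map ℕ.s≤s⁻¹ bs))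
          (R.reflexive (≡.cong (λ k → ∑ (words (suc B) k) (λ ν → interlacing B ν ƛ * indicator (gap ν ƛ ℕ.≟ e) * kostka (length μ) ν μ)) l)))
      -- The Pieri rule is available only for decreasing `ν` of the right size. For any other word
      -- the Kostka factor vanishes and makes both sides zero.
      apply-pieri : ∀ ν → length ν ≡ M →
        kostka (length μ) ν μ * ∑ ws (λ ƛ → interlacing B ν ƛ * indicator (gap ν ƛ ℕ.≟ e) * D ƛ) ≈
        kostka (length μ) ν μ * (h̃ P e * D ν)
      apply-pieri ν l with sumℕ ν ℕ.≟ sumℕ μ | linked? ℕ._≥?_ ν
      ... | no ne | _      = R.trans (R.*-congʳ (kostka-degree μ ν ne)) (R.trans (R.zeroˡ _)
              (R.sym (R.trans (R.*-congʳ (kostka-degree μ ν ne)) (R.zeroˡ _))))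
      ... | yes _ | no ¬d  = R.trans (R.*-congʳ (kostka-decreasing μ ν ¬d)) (R.trans (R.zeroˡ _)
              (R.sym (R.trans (R.*-congʳ (kostka-decreasing μ ν ¬d)) (R.zeroˡ _))))
      ... | yes s | yes d  = R.*-congˡ (nonempty ν l s d)
        where
        nonempty : ∀ ν → length ν ≡ M → sumℕ ν ≡ sumℕ μ → Linked ℕ._≥_ ν →
          ∑ ws (λ ƛ → interlacing B ν ƛ * indicator (gap ν ƛ ℕ.≟ e) * D ƛ) ≈ h̃ P e * D ν
        nonempty []      l s d = contradiction (≡.subst (sumℕ (μ ++ e ∷ []) ℕ.<_) (≡.sym l) lt) λ ()
        nonempty (v ∷ κ) l s d with last-part-zero v κ d
          (≡.subst₂ ℕ._<_ (≡.sym s) (≡.sym l) (ℕ.≤-<-trans |μ|≤ lt))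
        ... | ν′ , eq = R.trans
          (R.reflexive (≡.cong (λ k → ∑ (words (suc B) k) (λ ƛ → interlacing B (v ∷ κ) ƛ * indicator (gap (v ∷ κ) ƛ ℕ.≟ e) * D ƛ)) (≡.sym l)))
          (R.trans (Pieri.pieri P B e v κ ν′ eq d
            (ℕ.≤-trans (ℕ.+-monoˡ-≤ e (ℕ.≤-trans (ℕ.m≤m+n v (sumℕ κ)) (ℕ.≤-reflexive s)))
              (ℕ.≤-trans (ℕ.≤-reflexive (≡.sym (sum-snoc μ e))) le)))
            (R.*-congˡ (R.trans (R.sym (D-snoc-zero ν′)) (R.reflexive (≡.cong D (≡.sym eq))))))

  -- From determinants over `Fin` to determinants over lists, and from padded words to partitions.

  -- Taking one factor `- 1ℝ` out of all terms after the first turns the explicit signs into the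
  -- nested subtraction of `laplace`.
  laplace-tabulate : ∀ {X : Set} (r : X → ℝ) n (c : Fin (suc n) → X) F →
    sum {suc n} (λ j → (- 1ℝ) ^ toℕ j * r (c j) * F (tabulate (c ∘ punchIn j))) ≈ Det.laplace r (tabulate c) F
  laplace-tabulate r zero    c F = R.+-cong (R.*-congʳ (R.*-identityˡ _)) (R.sym -0#≈0#)
  laplace-tabulate r (suc n) c F = R.+-cong (R.*-congʳ (R.*-identityˡ _)) (begin
    sum {suc n} (λ j → (- 1ℝ) * (- 1ℝ) ^ toℕ j * r (c (suc j)) * F (tabulate (c ∘ punchIn (suc j))))
      ≈⟨ Sum.sum-cong-≋ {n = suc n} (λ j → solve 4 (λ m s r f → m :* s :* r :* f := m :* (s :* r :* f)) R.refl
           (- 1ℝ) ((- 1ℝ) ^ toℕ j) (r (c (suc j))) (F (tabulate (c ∘ punchIn (suc j))))) ⟩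
    sum {suc n} (λ j → (- 1ℝ) * ((- 1ℝ) ^ toℕ j * r (c (suc j)) * F (tabulate (c ∘ punchIn (suc j)))))
      ≈⟨ Sum.*-distribˡ-sum {n = suc n} (- 1ℝ) (λ j → (- 1ℝ) ^ toℕ j * r (c (suc j)) * F (c zero ∷ tabulate (c ∘ suc ∘ punchIn j))) ⟨
    (- 1ℝ) * sum {suc n} (λ j → (- 1ℝ) ^ toℕ j * r (c (suc j)) * F (c zero ∷ tabulate (c ∘ suc ∘ punchIn j)))
      ≈⟨ R.*-congˡ (laplace-tabulate r n (c ∘ suc) (λ C → F (c zero ∷ C))) ⟩
    (- 1ℝ) * Det.laplace r (tabulate (c ∘ suc)) (λ C → F (c zero ∷ C))
      ≈⟨ -1*x≈-x _ ⟩
    - Det.laplace r (tabulate (c ∘ suc)) (λ C → F (c zero ∷ C)) ∎)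

  det-tabulate : ∀ {X : Set} n (ρ : Fin n → X → ℝ) (c : Fin n → X) →
    det (λ i j → ρ i (c j)) ≈ Det.detL (tabulate ρ) (tabulate c)
  det-tabulate zero    ρ c = R.refl
  det-tabulate (suc n) ρ c = R.trans
    (Sum.sum-cong-≋ {n = suc n} (λ j → R.*-congˡ {(- 1ℝ) ^ toℕ j * ρ zero (c j)} (det-tabulate n (ρ ∘ suc) (c ∘ punchIn j))))
    (laplace-tabulate (ρ zero) n c (Det.detL (tabulate (ρ ∘ suc))))

  rows-tabulate : ∀ i ƛ → tabulate (λ k → row (i ℕ.+ toℕ k) (lookup ƛ k)) ≡ rows i ƛ
  rows-tabulate i []      = ≡.refl
  rows-tabulate i (a ∷ ƛ) = ≡.cong₂ _∷_ (≡.cong (λ k → row k a) (ℕ.+-identityʳ i))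
    (≡.trans (List.tabulate-cong (λ k → ≡.cong (λ m → row m (lookup ƛ k)) (ℕ.+-suc i (toℕ k)))) (rows-tabulate (suc i) ƛ))

  upTo-tabulate : ∀ n (f : ℕ → ℕ) → tabulate {n = n} (f ∘ toℕ) ≡ applyUpTo f n
  upTo-tabulate zero    f = ≡.refl
  upTo-tabulate (suc n) f = ≡.cong (f 0 ∷_) (upTo-tabulate n (f ∘ suc))

  S̃≈D : ∀ ƛ → S̃[ ƛ ] P ≈ D (parts ƛ)
  S̃≈D ƛ = R.trans
    (det-tabulate (length (parts ƛ)) (λ i → row (toℕ i) (lookup (parts ƛ) i)) toℕ)
    (R.reflexive (≡.cong₂ Det.detL (rows-tabulate 0 (parts ƛ)) (upTo-tabulate (length (parts ƛ)) (λ i → i))))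

  term : Partition → Series
  term ƛ = S̃[ ƛ ] P ∙ s[ ƛ ]

  term≈ : ∀ ƛ μ → term ƛ μ ≈ kostka (length μ) (parts ƛ) μ * D (parts ƛ)
  term≈ ƛ μ = R.trans (R.*-cong (S̃≈D ƛ) (s≈kostka ƛ μ)) (R.*-comm _ _)

  term-degree : ∀ ƛ μ → sumℕ μ ≢ ∣ ƛ ∣ₚ → term ƛ μ ≈ 0ℝ
  term-degree ƛ μ ne = R.trans (term≈ ƛ μ) (R.trans (R.*-congʳ (kostka-degree μ (parts ƛ) (≡.≢-sym ne))) (R.zeroˡ _))

  pad : ℕ → Partition → List ℕ
  pad M ƛ = parts ƛ ++ replicate (M ∸ length (parts ƛ)) 0

  filter-pad : ∀ M ƛ → filter (0 ℕ.<?_) (pad M ƛ) ≡ parts ƛ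
  filter-pad M ƛ = ≡.trans (List.filter-++ (0 ℕ.<?_) (parts ƛ) (replicate (M ∸ length (parts ƛ)) 0))
    (≡.trans (≡.cong₂ _++_ (List.filter-all (0 ℕ.<?_) (positive ƛ))
      (List.filter-none (0 ℕ.<?_) (All.replicate⁺ (M ∸ length (parts ƛ)) λ ()))) (List.++-identityʳ (parts ƛ)))

  pad-injective : ∀ {M ƛ κ} → pad M ƛ ≡ pad M κ → ƛ ≡ κ
  pad-injective {M} {ƛ} {κ} e = partition-≡ (≡.trans (≡.sym (filter-pad M ƛ)) (≡.trans (≡.cong (filter (0 ℕ.<?_)) e) (filter-pad M κ)))

  Linked-++⁻ˡ : ∀ xs {ys} → Linked ℕ._≥_ (xs ++ ys) → Linked ℕ._≥_ xs
  Linked-++⁻ˡ []           l       = []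
  Linked-++⁻ˡ (x ∷ [])     l       = [-]
  Linked-++⁻ˡ (x ∷ y ∷ xs) (p ∷ l) = p ∷ Linked-++⁻ˡ (y ∷ xs) l

  trailing-zeros : ∀ κ → Linked ℕ._≥_ κ → ∃₂ λ ps k → All (0 ℕ.<_) ps × κ ≡ ps ++ replicate k 0
  trailing-zeros []          l = [] , 0 , [] , ≡.refl
  trailing-zeros (suc x ∷ κ) l = let ps , k , pos , e = trailing-zeros κ (Linked.tail l) in
    suc x ∷ ps , k , s≤s z≤n ∷ pos , ≡.cong (suc x ∷_) e
  trailing-zeros (zero ∷ κ)  l = [] , suc (length κ) , [] , ≡.cong (0 ∷_) (zeros l)
    where
    zeros : ∀ {κ} → Linked ℕ._≥_ (0 ∷ κ) → κ ≡ replicate (length κ) 0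
    zeros [-]       = ≡.refl
    zeros (z≤n ∷ l) = ≡.cong (0 ∷_) (zeros l)

  pad-surjective : ∀ M κ → length κ ≡ M → Linked ℕ._≥_ κ → ∃ λ ƛ → κ ≡ pad M ƛ
  pad-surjective M κ l d with trailing-zeros κ d
  ... | ps , k , pos , e = ƛ , ≡.trans e (≡.cong (λ k → ps ++ replicate k 0) (≡.sym (≡.trans
          (≡.cong (_∸ length ps) (≡.trans (≡.sym l) (≡.trans (≡.cong length e) (≡.trans (List.length-++ ps)
            (≡.cong (length ps ℕ.+_) (List.length-replicate k)))))) (ℕ.m+n∸m≡n (length ps) k))))
    where
    ƛ : Partition
    ƛ = record { parts = ps ; decreasing = Linked-++⁻ˡ ps (≡.subst (Linked ℕ._≥_) e d) ; positive = pos }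

  sum-pad : ∀ M ƛ → sumℕ (pad M ƛ) ≡ ∣ ƛ ∣ₚ
  sum-pad M ƛ = ≡.trans (ℕ.sum-++ (parts ƛ) (replicate (M ∸ length (parts ƛ)) 0))
    (≡.trans (≡.cong (∣ ƛ ∣ₚ ℕ.+_) (sum-zeros (All.replicate⁺ (M ∸ length (parts ƛ)) ≡.refl))) (ℕ.+-identityʳ _))

  -- Padding is a bijection from the partitions of `sumℕ μ` onto the decreasing words of that size
  -- in the box, and all other words have Kostka number zero.
  expansion≈G : ∀ μ → ∑ (partitions (sumℕ μ)) (λ ƛ → term ƛ μ) ≈ G μ
  expansion≈G μ = begin
    ∑ (partitions N) (λ ƛ → term ƛ μ)
      ≈⟨ ∑-cong (partitions N) (λ ƛ _ → R.trans (term≈ ƛ μ) (R.sym (R.*-cong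
           (snoc-invariant (λ κ → kostka (length μ) κ μ) (λ κ → kostka-snoc-zero (length μ) κ μ) (M ∸ length (parts ƛ)) (parts ƛ))
           (snoc-invariant D D-snoc-zero (M ∸ length (parts ƛ)) (parts ƛ))))) ⟩
    ∑ (partitions N) (λ ƛ → f (pad M ƛ))
      ≈⟨ ∑-map (pad M) (partitions N) f ⟨
    ∑ (map (pad M) (partitions N)) f
      ≈⟨ ∑-⊆ (List.≡-dec ℕ._≟_) (Unique.map⁺ pad-injective (partitions-unique N)) (words-unique (suc N) M) inclusion vanish ⟩
    ∑ (words (suc N) M) f
      ≈⟨ boxed μ M N ℕ.≤-refl ℕ.≤-refl ⟩
    G μ ∎
    where
    N = sumℕ μ
    -- One row more than the degree, so that `boxed` always finds an empty bottom row.
    M = suc N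
    f : List ℕ → ℝ
    f κ = kostka (length μ) κ μ * D κ
    inclusion : ∀ {κ} → κ ∈ map (pad M) (partitions N) → κ ∈ words (suc N) M
    inclusion m with ∈.∈-map⁻ (pad M) m
    ... | ƛ , ƛ∈ , ≡.refl = ≡.subst (λ k → pad M ƛ ∈ words (suc N) k) length-pad
          (∈-words (All.++⁺ (All.map (λ le → s≤s (≡.subst (_ ℕ.≤_) (∈-partitions⁻ ƛ∈) le)) (parts≤sum (parts ƛ)))
            (All.replicate⁺ (M ∸ length (parts ƛ)) (s≤s z≤n))))
      where
      length-pad : length (pad M ƛ) ≡ M
      length-pad = ≡.trans (List.length-++ (parts ƛ)) (≡.trans
        (≡.cong (length (parts ƛ) ℕ.+_) (List.length-replicate (M ∸ length (parts ƛ))))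
        (ℕ.m+[n∸m]≡n (ℕ.m≤n⇒m≤1+n (≡.subst (length (parts ƛ) ℕ.≤_) (∈-partitions⁻ ƛ∈) (length≤sum (positive ƛ))))))
    vanish : ∀ κ → κ ∈ words (suc N) M → κ ∉ map (pad M) (partitions N) → f κ ≈ 0ℝ
    vanish κ κ∈ κ∉ with sumℕ κ ℕ.≟ N | linked? ℕ._≥?_ κ
    ... | no ne | _     = R.trans (R.*-congʳ (kostka-degree μ κ ne)) (R.zeroˡ _)
    ... | yes _ | no ¬d = R.trans (R.*-congʳ (kostka-decreasing μ κ ¬d)) (R.zeroˡ _)
    ... | yes s | yes d with pad-surjective M κ (proj₁ (words-∈ M κ∈)) d
    ...   | ƛ , ≡.refl = contradiction (∈.∈-map⁺ (pad M) (∈-partitions⁺ {ƛ = ƛ} (≡.trans (≡.sym (sum-pad M ƛ)) s))) κ∉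

  hasSum : HasSum term G
  hasSum μ = partitions (sumℕ μ) , partitions-unique (sumℕ μ) ,
    (λ ƛ ƛ∉ → term-degree ƛ μ λ e → ƛ∉ (∈-partitions⁺ (≡.sym e))) , expansion≈G μ

theorem5 : (P : Parameters) →
    ∃ λ (G : Series) →
    HasSum (λ ƛ → S̃[ ƛ ] P ∙ s[ ƛ ]) G
    × HasSum (λ ƛ → (1/z ƛ * p̃[ ƛ ] P) ∙ p[ ƛ ]) G
theorem5 P = PowerSumExpansion.G P , SchurExpansion.hasSum P , PowerSumExpansion.hasSum P
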